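{- For any fixed $k\geq 1$, there is a finite set of patterns $\mathcal{S}_k$ such that the class of binary CSP instances whose constraint graph has treewidth at most $k$ equals $\mathrm{CSP}_{TM}(\mathcal{S}_k)$.
   Context: A binary CSP instance is a triple $\langle V,D,C\rangle$: $V$ a finite set of variables, a finite domain $D(v)$ for each $v\in V$, and for each ordered pair of distinct variables $(u,v)$ a relation $R_{uv}\subseteq D(u)\times D(v)$, with $R_{vu}=\{(b,a):(a,b)\in R_{uv}\}$. A constraint $R_{uv}$ is trivial if $R_{uv}=D(u)\times D(v)$. The constraint graph of $I$ has vertex set $V$ and an edge $\{u,v\}$ for each non-trivial constraint $R_{uv}$. A pattern is a structure $\langle X,E^{\sim},E^{+},E^{ - }\rangle$ where $X$ is a set of points, $E^{\sim}$ is an equivalence relation on $X$ whose classes are called parts, and $E^{+}$ (positive edges), $E^{ - }$ (negative edges) are symmetric binary relations on $X$ each disjoint from $E^{\sim}$. For an instance $I$, the pattern $\mathcal{P}(I)$ has points $x_{v,a}$ ($v\in V$, $a\in D(v)$), with $x_{u,a},x_{v,b}$ in the same part iff $u=v$, and for $u\neq v$ the pair $(x_{u,a},x_{v,b})$ is a positive edge if $(a,b)\in R_{uv}$ and a negative edge otherwise. A homomorphism of patterns is a map of points sending same-part pairs to same-part pairs, positive edges to positive edges and negative edges to negative edges; it preserves parts if points in distinct parts are mapped to points in distinct parts. $P_1 \stackrel{SP}{\rightarrow} P_2$ if there is a part-preserving homomorphism $P_1\to P_2$. The subdivision of a pattern at two distinct parts $U,V$ adds a new part containing one new point $z_{xy}$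 per positive edge $\{x,y\}$ between $U$ and $V$ and two new points $z'_{xy},z''_{xy}$ per negative edge $\{x,y\}$ between $U$ and $V$, removes these edges, and adds positive edges $\{x,z_{xy}\},\{z_{xy},y\}$ respectively negative edges $\{x,z'_{xy}\},\{z''_{xy},y\}$. A subdivision of $P$ is the result of a finite (possibly empty) sequence of such operations. $P_1 \stackrel{TM}{\rightarrow} P_2$ if some subdivision of $P_1$ occurs as a sub-pattern in $P_2$. For a set $\mathcal{S}$ of patterns, $\mathrm{CSP}_{TM}(\mathcal{S})$ is the class of binary CSP instances $I$ such that for no $Q\in\mathcal{S}$ do we have $Q \stackrel{TM}{\rightarrow} \mathcal{P}(I)$. -}

module Defs where

open import Data.Nat using (ℕ; suc; _≤_)
open import Data.Fin using (Fin; zero; suc; toℕ) renaming (_≟_ to _≟F_)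
open import Data.Fin.Subset using (Subset; _∈_; ∣_∣)
open import Data.Bool using (Bool; true; false; _∧_; _∨_; not; T)
open import Data.Bool.Properties using (T-irrelevant; ∨-comm) renaming (_≟_ to _≟B_)
open import Data.Empty using (⊥-elim)
open import Data.Product using (Σ; _×_; _,_; proj₁; proj₂)
open import Data.Sum using (_⊎_; inj₁; inj₂)
open import Data.Maybe using (Maybe; just; nothing)
open import Data.Maybe.Properties using (just-injective)
import Data.Product.Properties as ΣP
import Data.Sum.Properties as ⊎P
import Data.Maybe.Properties as MP
open import Relation.Binary.PropositionalEquality
open import Relation.Binary.Definitions using (DecidableEquality)
open import Relation.Nullary using (¬_; Dec; yes; no)
open import Relation.Nullary.Decidable using (⌊_⌋)
open import Function.Bundles using (_↔_)
open import Data.List using (List)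
open import Data.List.Membership.Propositional using () renaming (_∈_ to _∈L_)

∧-true-l : ∀ a b → a ∧ b ≡ true → a ≡ true
∧-true-l true b _ = refl
∧-true-l false b ()

not⌊⌋-true : ∀ {A : Set} (d : Dec A) → not ⌊ d ⌋ ≡ true → ¬ A
not⌊⌋-true (yes a) ()
not⌊⌋-true (no ¬a) _ = ¬a

⌊⌋-sym : ∀ {A : Set} (_≟_ : DecidableEquality A) (x y : A) →
         ⌊ x ≟ y ⌋ ≡ ⌊ y ≟ x ⌋
⌊⌋-sym _≟_ x y with x ≟ y | y ≟ x
... | yes _ | yes _ = refl
... | no _  | no _  = refl
... | yes p | no q  = ⊥-elim (q (sym p))
... | no q  | yes p = ⊥-elim (q (sym p))

-- Patterns  ⟨X, E~, E+, E-⟩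
-- Points form a type with decidable equality; the equivalence relation
-- E~ is "same part", given by a labelling  part : Point → Part.
-- E+ / E- are Boolean-valued, symmetric, and disjoint from E~.

record Pattern : Set₁ where
  field
    Point   : Set
    Part    : Set
    _≟pt_   : DecidableEquality Point
    _≟pa_   : DecidableEquality Part
    part    : Point → Part
    pos     : Point → Point → Bool
    neg     : Point → Point → Bool
    pos-sym : ∀ x y → pos x y ≡ pos y x
    neg-sym : ∀ x y → neg x y ≡ neg y x
    pos-irr : ∀ x y → pos x y ≡ true → part x ≢ part y
    neg-irr : ∀ x y → neg x y ≡ true → part x ≢ part y

open Pattern public

FinitePattern : Pattern → Set
FinitePattern P = Σ ℕ λ m → Point P ↔ Fin m

_→SP_ : Pattern → Pattern → Set
P₁ →SP P₂ =
  Σ (Point P₁ → Point P₂) λ f →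
    (∀ x y → part P₁ x ≡ part P₁ y → part P₂ (f x) ≡ part P₂ (f y)) ×
    (∀ x y → pos P₁ x y ≡ true → pos P₂ (f x) (f y) ≡ true) ×
    (∀ x y → neg P₁ x y ≡ true → neg P₂ (f x) (f y) ≡ true) ×
    (∀ x y → part P₁ x ≢ part P₁ y → part P₂ (f x) ≢ part P₂ (f y))

module Subdiv (P : Pattern) (U V : Part P) where
  private
    _≟p_ = _≟pt_ P
    _≟q_ = _≟pa_ P

  UV : Point P → Point P → Bool
  UV x y = ⌊ part P x ≟q U ⌋ ∧ ⌊ part P y ≟q V ⌋

  btw : Point P → Point P → Bool
  btw x y = UV x y ∨ UV y x

  -- positive / negative edges between U and V, each counted once
  -- (as the ordered pair (x,y) with x ∈ U, y ∈ V)
  PosE : Set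
  PosE = Σ (Point P × Point P) λ e → T (UV (proj₁ e) (proj₂ e) ∧ pos P (proj₁ e) (proj₂ e))

  NegE : Set
  NegE = Σ (Point P × Point P) λ e → T (UV (proj₁ e) (proj₂ e) ∧ neg P (proj₁ e) (proj₂ e))

  -- old points, z_xy for positive edges, and z'_xy (false) / z''_xy (true)
  -- for negative edges
  SPoint : Set
  SPoint = Point P ⊎ (PosE ⊎ (NegE × Bool))

  private
    decPP : DecidableEquality (Point P × Point P)
    decPP = ΣP.≡-dec _≟p_ _≟p_
    decT : ∀ {b} → DecidableEquality (T b)
    decT p q = yes (T-irrelevant p q)

  _≟s_ : DecidableEquality SPoint
  _≟s_ = ⊎P.≡-dec _≟p_ (⊎P.≡-dec (ΣP.≡-dec decPP decT)
                                 (ΣP.≡-dec (ΣP.≡-dec decPP decT) _≟B_))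

  spart : SPoint → Maybe (Part P)
  spart (inj₁ x) = just (part P x)
  spart (inj₂ _) = nothing

  eq : Point P → Point P → Bool
  eq x a = ⌊ x ≟p a ⌋

  spos : SPoint → SPoint → Bool
  spos (inj₁ x) (inj₁ y) = pos P x y ∧ not (btw x y)
  spos (inj₁ x) (inj₂ (inj₁ ((a , b) , _))) = eq x a ∨ eq x b
  spos (inj₁ x) (inj₂ (inj₂ _)) = false
  spos (inj₂ (inj₁ ((a , b) , _))) (inj₁ y) = eq y a ∨ eq y b
  spos (inj₂ (inj₂ _)) (inj₁ y) = false
  spos (inj₂ (inj₁ _)) (inj₂ _) = false
  spos (inj₂ (inj₂ _)) (inj₂ _) = false

  -- endpoint of a negative edge (a,b) to which z'/z'' is attached
  end : Bool → Point P → Point P → Point P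
  end false a b = a
  end true  a b = b

  sneg : SPoint → SPoint → Bool
  sneg (inj₁ x) (inj₁ y) = neg P x y ∧ not (btw x y)
  sneg (inj₁ x) (inj₂ (inj₁ _)) = false
  sneg (inj₁ x) (inj₂ (inj₂ (((a , b) , _) , c))) = eq x (end c a b)
  sneg (inj₂ (inj₁ _)) (inj₁ y) = false
  sneg (inj₂ (inj₂ (((a , b) , _) , c))) (inj₁ y) = eq y (end c a b)
  sneg (inj₂ (inj₁ _)) (inj₂ _) = false
  sneg (inj₂ (inj₂ _)) (inj₂ _) = false

  spos-sym : ∀ x y → spos x y ≡ spos y x
  spos-sym (inj₁ x) (inj₁ y) =
    cong₂ _∧_ (pos-sym P x y) (cong not (∨-comm (UV x y) (UV y x)))
  spos-sym (inj₁ x) (inj₂ (inj₁ _)) = refl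
  spos-sym (inj₁ x) (inj₂ (inj₂ _)) = refl
  spos-sym (inj₂ (inj₁ _)) (inj₁ y) = refl
  spos-sym (inj₂ (inj₂ _)) (inj₁ y) = refl
  spos-sym (inj₂ (inj₁ _)) (inj₂ (inj₁ _)) = refl
  spos-sym (inj₂ (inj₁ _)) (inj₂ (inj₂ _)) = refl
  spos-sym (inj₂ (inj₂ _)) (inj₂ (inj₁ _)) = refl
  spos-sym (inj₂ (inj₂ _)) (inj₂ (inj₂ _)) = refl

  sneg-sym : ∀ x y → sneg x y ≡ sneg y x
  sneg-sym (inj₁ x) (inj₁ y) =
    cong₂ _∧_ (neg-sym P x y) (cong not (∨-comm (UV x y) (UV y x)))
  sneg-sym (inj₁ x) (inj₂ (inj₁ _)) = refl
  sneg-sym (inj₁ x) (inj₂ (inj₂ _)) = refl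
  sneg-sym (inj₂ (inj₁ _)) (inj₁ y) = refl
  sneg-sym (inj₂ (inj₂ _)) (inj₁ y) = refl
  sneg-sym (inj₂ (inj₁ _)) (inj₂ (inj₁ _)) = refl
  sneg-sym (inj₂ (inj₁ _)) (inj₂ (inj₂ _)) = refl
  sneg-sym (inj₂ (inj₂ _)) (inj₂ (inj₁ _)) = refl
  sneg-sym (inj₂ (inj₂ _)) (inj₂ (inj₂ _)) = refl

  spos-irr : ∀ x y → spos x y ≡ true → spart x ≢ spart y
  spos-irr (inj₁ x) (inj₁ y) h e =
    pos-irr P x y (∧-true-l (pos P x y) _ h) (just-injective e)
  spos-irr (inj₁ x) (inj₂ _) h ()
  spos-irr (inj₂ _) (inj₁ y) h ()
  spos-irr (inj₂ (inj₁ _)) (inj₂ _) () _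
  spos-irr (inj₂ (inj₂ _)) (inj₂ _) () _

  sneg-irr : ∀ x y → sneg x y ≡ true → spart x ≢ spart y
  sneg-irr (inj₁ x) (inj₁ y) h e =
    neg-irr P x y (∧-true-l (neg P x y) _ h) (just-injective e)
  sneg-irr (inj₁ x) (inj₂ _) h ()
  sneg-irr (inj₂ _) (inj₁ y) h ()
  sneg-irr (inj₂ (inj₁ _)) (inj₂ _) () _
  sneg-irr (inj₂ (inj₂ _)) (inj₂ _) () _

  subdivide : Pattern
  subdivide = record
    { Point = SPoint ; Part = Maybe (Part P)
    ; _≟pt_ = _≟s_ ; _≟pa_ = MP.≡-dec _≟q_
    ; part = spart ; pos = spos ; neg = sneg
    ; pos-sym = spos-sym ; neg-sym = sneg-sym
    ; pos-irr = spos-irr ; neg-irr = sneg-irr }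

open Subdiv public using (subdivide)

data IsSubdivisionOf (P : Pattern) : Pattern → Set₁ where
  done : IsSubdivisionOf P P
  step : ∀ {Q} → IsSubdivisionOf P Q → (U V : Part Q) → U ≢ V →
         IsSubdivisionOf P (subdivide Q U V)

_→TM_ : Pattern → Pattern → Set₁
P₁ →TM P₂ = Σ Pattern λ Q → IsSubdivisionOf P₁ Q × (Q →SP P₂)

record Instance : Set where
  field
    n       : ℕ
    dom     : Fin n → ℕ
    rel     : (u v : Fin n) → Fin (dom u) → Fin (dom v) → Bool
    rel-sym : ∀ u v a b → rel u v a b ≡ rel v u b a

open Instance public

patternOf : Instance → Pattern
patternOf I = record
  { Point = Σ (Fin (n I)) (λ v → Fin (dom I v))
  ; Part = Fin (n I)
  ; _≟pt_ = ΣP.≡-dec _≟F_ _≟F_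
  ; _≟pa_ = _≟F_
  ; part = proj₁
  ; pos = λ { (u , a) (v , b) → not ⌊ u ≟F v ⌋ ∧ rel I u v a b }
  ; neg = λ { (u , a) (v , b) → not ⌊ u ≟F v ⌋ ∧ not (rel I u v a b) }
  ; pos-sym = λ { (u , a) (v , b) →
      cong₂ _∧_ (cong not (⌊⌋-sym _≟F_ u v)) (rel-sym I u v a b) }
  ; neg-sym = λ { (u , a) (v , b) →
      cong₂ _∧_ (cong not (⌊⌋-sym _≟F_ u v)) (cong not (rel-sym I u v a b)) }
  ; pos-irr = λ { (u , a) (v , b) h →
      not⌊⌋-true (u ≟F v) (∧-true-l _ _ h) }
  ; neg-irr = λ { (u , a) (v , b) h →
      not⌊⌋-true (u ≟F v) (∧-true-l _ _ h) }
  }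

InCSP-TM : List Pattern → Instance → Set₁
InCSP-TM S I = ∀ Q → Q ∈L S → ¬ (Q →TM patternOf I)

ConstraintEdge : (I : Instance) → Fin (n I) → Fin (n I) → Set
ConstraintEdge I u v =
  u ≢ v × Σ (Fin (dom I u)) λ a → Σ (Fin (dom I v)) λ b → rel I u v a b ≡ false

-- Tree decompositions and treewidth.
-- A tree with nodes Fin (suc t) is given by a parent function: node
-- (suc i) has parent (parent i), whose index is ≤ i.  (Every finite tree
-- is isomorphic to one of this form.)

TreeAdj : ∀ {t} → (Fin t → Fin (suc t)) → Fin (suc t) → Fin (suc t) → Set
TreeAdj {t} parent a b =
  Σ (Fin t) λ i → (a ≡ suc i × b ≡ parent i) ⊎ (b ≡ suc i × a ≡ parent i)

data PathIn {t} (parent : Fin t → Fin (suc t)) (S : Fin (suc t) → Set)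
     : Fin (suc t) → Fin (suc t) → Set where
  here  : ∀ {a} → S a → PathIn parent S a a
  there : ∀ {a b c} → S a → TreeAdj parent a b → PathIn parent S b c →
          PathIn parent S a c

record TreeDecomposition (N : ℕ) (E : Fin N → Fin N → Set) : Set where
  field
    t          : ℕ
    parent     : Fin t → Fin (suc t)
    parent-<   : ∀ i → toℕ (parent i) ≤ toℕ i
    bag        : Fin (suc t) → Subset N
    cover-vert : ∀ v → Σ (Fin (suc t)) λ x → v ∈ bag x
    cover-edge : ∀ u v → E u v → Σ (Fin (suc t)) λ x → u ∈ bag x × v ∈ bag x
    connected  : ∀ v x y → v ∈ bag x → v ∈ bag y →
                 PathIn parent (λ z → v ∈ bag z) x y

TreewidthAtMost : ℕ → (N : ℕ) → (Fin N → Fin N → Set) → Set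
TreewidthAtMost k N E =
  Σ (TreeDecomposition N E) λ D → ∀ x → ∣ TreeDecomposition.bag D x ∣ ≤ suc k

ConstraintTreewidthAtMost : ℕ → Instance → Set
ConstraintTreewidthAtMost k I = TreewidthAtMost k (n I) (ConstraintEdge I)

-- Let c = k + 1 bound the bags. A graph F of treewidth more than k that loses this property when a
-- vertex is deleted has a tree decomposition with bags of size at most c + 1. If F is large, a heavy
-- branch of this decomposition gives a long chain of nested separations of order at most c + 1, and
-- by Menger's theorem a long chain of separations of one order r that are linked by r disjoint
-- paths. What one side of a separation contributes to a tree decomposition of width k of the whole
-- graph is described by finitely many protocols of bounded depth, as for the typical sequences of
-- Bodlaender and Kloks, so two separations of the chain have equivalent sides. Contracting the
-- paths between these two and dropping what lies in between yields a smaller topological minor of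
-- treewidth more than k. Repetition ends with one of finitely many graphs H. Its pattern has a part
-- for each vertex and a negative edge for each edge, no two at the same point; it occurs in every
-- instance whose constraint graph contains H topologically, and conversely a part-preserving
-- homomorphism from one of its subdivisions exhibits H as a minor of the constraint graph.
-- Case distinctions are made under a double negation, which is harmless because having treewidth
-- at most k is decidable.

module Submission where

open import Defs
open import Data.Nat using (ℕ; zero; suc; _+_; _*_; _^_; _≤_; _<_; z≤n; s≤s; _≤?_; _<?_)
import Data.Nat.Properties as ℕ
open import Data.Fin using (Fin; zero; suc)
import Data.Fin as Fin
import Data.Fin.Properties as Fin
open import Data.Bool using (Bool; true; false; _∧_; _∨_; not; T)
import Data.Bool.Properties as Bool
open import Data.Empty using (⊥; ⊥-elim)
open import Data.Unit using (tt)
open import Data.Product using (Σ; _×_; _,_; proj₁; proj₂; ∃)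
import Data.Product.Properties as Product
open import Data.Sum using (_⊎_; inj₁; inj₂; [_,_]′)
import Data.Sum.Properties as Sum
open import Data.Maybe using (Maybe; just; nothing)
import Data.Maybe as Maybe
open import Data.Maybe.Properties using (just-injective)
import Data.Maybe.Properties as Maybe
open import Data.List using (List; []; _∷_; _++_; length; map; filter; allFin)
import Data.List as List
import Data.List.Properties as List
open import Data.List.Membership.Propositional using (_∈_; _∉_; find; lose)
import Data.List.Membership.Propositional.Properties as ∈
open import Data.List.Relation.Unary.Any using (Any; here; there)
import Data.List.Relation.Unary.Any as Any
import Data.List.Relation.Unary.Any.Properties as Any
open import Data.List.Relation.Unary.All using (All; []; _∷_)
import Data.List.Relation.Unary.All as All
import Data.List.Relation.Unary.All.Properties as All
open import Data.List.Relation.Unary.Unique.Propositional using (Unique; []; _∷_)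
import Data.List.Relation.Unary.Unique.Propositional.Properties as Unique
open import Data.Vec using (Vec; lookup; _[_]≔_)
import Data.Vec as Vec
import Data.Vec.Properties as Vec
open import Data.Fin.Subset using (Subset)
import Data.Fin.Subset as Subset
import Data.Fin.Subset.Properties as Subset
open import Relation.Nullary using (¬_; Dec; yes; no)
open import Relation.Nullary.Decidable using (⌊_⌋; ¬¬-excluded-middle; _×-dec_; _⊎-dec_; _→-dec_; ¬?; map′; decidable-stable)
open import Relation.Binary.Definitions using (DecidableEquality; tri<; tri≈; tri>)
open import Relation.Binary.PropositionalEquality
open import Relation.Binary.PropositionalEquality.WithK using (≡-irrelevant)
open import Function using (_∘_; id; case_of_)
open import Function.Bundles using (_⇔_; mk⇔)
open import Function.Construct.Symmetry using (↔-sym)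

-- Topological minors are not well-quasi-ordered in general, so finiteness needs an explicit size
-- bound. The obstacle is that a decomposition of the whole graph may switch between the two sides
-- of a separation arbitrarily often. But each side feels only how many places of the bag the other
-- one occupies, a number at most c; reordering the private moves around the states where one share
-- is least leaves a number of alternations that depends on c alone. Every boundary step lowers a
-- potential that is at most twice the number of boundary vertices, which bounds the rest of a
-- protocol. Tree decompositions are read as derivations over functions to `Status` because one such
-- function is at once a bag, a separation and a place in the tree: the states along a branch are
-- the nested separations that Menger's theorem links. Occurrence in an instance has to be built
-- from a topological minor, since `subdivide` only replaces edges by paths; in the other direction
-- a minor is enough, because `Good` passes to minors. That lemma is stated for arbitrary
-- intermediate states, so that it also serves restriction to a half, gluing and ungluing.

DN : ∀ {a} → Set a → Set a
DN A = ¬ ¬ A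

pure : ∀ {a} {A : Set a} → A → DN A
pure x k = k x

infixl 1 _>>=_
_>>=_ : ∀ {a b} {A : Set a} {B : Set b} → DN A → (A → DN B) → DN B
(m >>= f) k = m λ x → f x k

lem : ∀ {a} (A : Set a) → DN (Dec A)
lem A = ¬¬-excluded-middle

-- Double negation passes the quantifier because it is finite; finitely many classical decisions can
-- thus be made at once.
DN-Fin : ∀ {m} {a} {P : Fin m → Set a} → (∀ i → DN (P i)) → DN (∀ i → P i)
DN-Fin {zero} h = pure λ ()
DN-Fin {suc m} h = do
  p ← h zero
  q ← DN-Fin (h ∘ suc)
  pure λ { zero → p ; (suc i) → q i }

-- Counting with duplicate-free lists

∈-remove : ∀ {A : Set} {x : A} {xs} → x ∈ xs →
  Σ (List A) λ ys → (length xs ≡ suc (length ys)) × (∀ y → y ∈ xs → y ≢ x → y ∈ ys) ×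
    (∀ y → y ∈ ys → y ∈ xs) × (Unique xs → Unique ys × x ∉ ys)
∈-remove {xs = _ ∷ xs} (here refl) =
  xs , refl , (λ { y (here e) ne → ⊥-elim (ne e) ; y (there p) ne → p }) , (λ _ → there) ,
  λ { (p ∷ u) → u , λ q → All.lookup p q refl }
∈-remove {xs = x ∷ xs} (there p) with ∈-remove p
... | ys , l , f , g , h = x ∷ ys , cong suc l ,
  (λ { y (here e) ne → here e ; y (there q) ne → there (f y q ne) }) ,
  (λ { y (here e) → here e ; y (there q) → there (g y q) }) ,
  λ { (q ∷ u) → (All.tabulate (λ {y} r → All.lookup q (g y r)) ∷ proj₁ (h u)) ,
      λ { (here e) → All.lookup q p (sym e) ; (there r) → proj₂ (h u) r } }

-- `R` is the graph of a partial function. Each b uses up a member of `as`, which is removed before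
-- the next b is treated.
unique-length-≤ : ∀ {A B : Set} (R : A → B → Set) →
  (∀ {a b b′} → R a b → R a b′ → b ≡ b′) → ∀ {bs as} → Unique bs →
  (∀ b → b ∈ bs → Σ A λ a → a ∈ as × R a b) → length bs ≤ length as
unique-length-≤ R fun [] h = z≤n
unique-length-≤ R fun {b ∷ bs} {as} (p ∷ u) h with h b (here refl)
... | a , a∈ , r with ∈-remove a∈
... | as′ , l , f , _ rewrite l = s≤s (unique-length-≤ R fun u λ b′ b′∈ →
  let a′ , a′∈ , r′ = h b′ (there b′∈) in
  a′ , f a′ a′∈ (λ { refl → All.lookup p b′∈ (fun r r′) }) , r′)

unique-⊆-length : ∀ {A : Set} {xs ys : List A} → Unique xs → (∀ x → x ∈ xs → x ∈ ys) →
  length xs ≤ length ys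
unique-⊆-length u h = unique-length-≤ _≡_ (λ p q → trans (sym p) q) u λ x x∈ → x , h x x∈ , refl

unique-lookup-injective : ∀ {A : Set} {xs : List A} → Unique xs →
  ∀ {i j} → List.lookup xs i ≡ List.lookup xs j → i ≡ j
unique-lookup-injective (p ∷ u) {zero} {zero} e = refl
unique-lookup-injective (p ∷ u) {zero} {suc j} e = ⊥-elim (All.lookup p (∈.∈-lookup j) e)
unique-lookup-injective (p ∷ u) {suc i} {zero} e = ⊥-elim (All.lookup p (∈.∈-lookup i) (sym e))
unique-lookup-injective (p ∷ u) {suc i} {suc j} e = cong suc (unique-lookup-injective u e)

-- Tree decompositions as derivations

data Status : Set where
  new cur old : Status

_≟ₛ_ : DecidableEquality Status
new ≟ₛ new = yes refl
new ≟ₛ cur = no λ ()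
new ≟ₛ old = no λ ()
cur ≟ₛ new = no λ ()
cur ≟ₛ cur = yes refl
cur ≟ₛ old = no λ ()
old ≟ₛ new = no λ ()
old ≟ₛ cur = no λ ()
old ≟ₛ old = yes refl

-- In each branch the vertices of the other branch count as `old`, so that the state of a branch is
-- again a separation of the whole graph.
data Distribute : Status → Status → Status → Set where
  left    : Distribute new new old
  right   : Distribute new old new
  current : Distribute cur cur cur
  outside : Distribute old old old

Distribute-sym : ∀ {s s₁ s₂} → Distribute s s₁ s₂ → Distribute s s₂ s₁
Distribute-sym left = right
Distribute-sym right = left
Distribute-sym current = current
Distribute-sym outside = outside

Distribute-new : ∀ {s s₁ s₂} → Distribute s s₁ s₂ → s₁ ≡ new → s ≡ new
Distribute-new left refl = refl

Distribute-cur : ∀ {s s₁ s₂} → Distribute s s₁ s₂ → s₁ ≡ cur → s ≡ cur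
Distribute-cur current refl = refl

Distribute-cur⁻ : ∀ {s s₁ s₂} → Distribute s s₁ s₂ → s ≡ cur → s₁ ≡ cur
Distribute-cur⁻ current refl = refl

Distribute-old : ∀ {s s₁ s₂} → Distribute s s₁ s₂ → s₁ ≡ old → s ≡ old ⊎ s₂ ≡ new
Distribute-old right refl = inj₂ refl
Distribute-old outside refl = inj₁ refl

Distribute-old⁻ : ∀ {s s₁ s₂} → Distribute s s₁ s₂ → s ≡ old → s₁ ≡ old
Distribute-old⁻ outside refl = refl

Distribute-same : ∀ {s s₁ s₂} → Distribute s s₁ s₂ → s₁ ≡ s → s₂ ≢ new
Distribute-same left _ ()
Distribute-same right () _
Distribute-same current _ ()
Distribute-same outside _ ()

Distribute-choose : ∀ {s s₁ s₂} → Distribute s s₁ s₂ → s ≡ new → s₁ ≡ new × s₂ ≡ old ⊎ s₁ ≡ old × s₂ ≡ new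
Distribute-choose left refl = inj₁ (refl , refl)
Distribute-choose right refl = inj₂ (refl , refl)

-- A relation rather than a function: derivations then need no decidable equality and can be
-- transported along pointwise equality and bijections without function extensionality.
Update : {V : Set} → (V → Status) → V → Status → (V → Status) → Set
Update st v s st′ = st′ v ≡ s × (∀ u → u ≢ v → st′ u ≡ st u)

module _ {V : Set} (_≟_ : DecidableEquality V) where
  update : (V → Status) → V → Status → V → Status
  update st v s u with u ≟ v
  ... | yes _ = s
  ... | no _  = st u

  update-Update : ∀ st v s → Update st v s (update st v s)
  update-Update st v s = at , away
    where
    at : update st v s v ≡ s
    at with v ≟ v
    ... | yes _ = refl
    ... | no ne = ⊥-elim (ne refl)
    away : ∀ u → u ≢ v → update st v s u ≡ st u
    away u ne with u ≟ v
    ... | yes e = ⊥-elim (ne e)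
    ... | no _  = refl

-- A derivation is a tree decomposition read from the root downwards: `cur` is the current bag,
-- `new` the vertices strictly below it, and the number counts the bag.
data Good {V : Set} (E : V → V → Set) (c : ℕ) : (V → Status) → ℕ → Set where
  leaf   : ∀ {st m} → (∀ v → st v ≢ new) → Good E c st m
  intro  : ∀ {st st′ m} v → st v ≡ new → suc m ≤ c → Update st v cur st′ →
           Good E c st′ (suc m) → Good E c st m
  forget : ∀ {st st′ m} v → st v ≡ cur → (∀ w → st w ≡ new → ¬ E v w) → Update st v old st′ →
           Good E c st′ m → Good E c st (suc m)
  split  : ∀ {st st₁ st₂ m} → (∀ v → Distribute (st v) (st₁ v) (st₂ v)) →
           (∀ u v → st₁ u ≡ new → st₂ v ≡ new → ¬ E u v) →
           Good E c st₁ m → Good E c st₂ m → Good E c st m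

Good-resp : ∀ {V} {E : V → V → Set} {c st st′ m} → st ≗ st′ → Good E c st m → Good E c st′ m
Good-resp e (leaf h) = leaf λ v p → h v (trans (e v) p)
Good-resp e (intro v p le (q , q′) g) =
  intro v (trans (sym (e v)) p) le (q , λ u ne → trans (q′ u ne) (e u)) g
Good-resp e (forget v p h (q , q′) g) =
  forget v (trans (sym (e v)) p) (λ w r → h w (trans (e w) r)) (q , λ u ne → trans (q′ u ne) (e u)) g
Good-resp e (split d h g₁ g₂) =
  split (λ v → subst (λ s → Distribute s _ _) (e v) (d v)) h g₁ g₂

Separation : {V : Set} → (V → V → Set) → (V → Status) → Set
Separation E st = ∀ u v → st u ≡ old → st v ≡ new → ¬ E u v

Symmetric : {V : Set} → (V → V → Set) → Set
Symmetric E = ∀ {u v} → E u v → E v u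

separation-intro : ∀ {V} {E : V → V → Set} {st st′ : V → Status} {v} → DecidableEquality V →
  Update st v cur st′ → Separation E st → Separation E st′
separation-intro {v = v} _≟_ (p , q) sep a b ea eb with a ≟ v | b ≟ v
... | yes refl | _ = case trans (sym p) ea of λ ()
... | no _ | yes refl = case trans (sym p) eb of λ ()
... | no na | no nb = sep a b (trans (sym (q a na)) ea) (trans (sym (q b nb)) eb)

separation-forget : ∀ {V} {E : V → V → Set} {st st′ : V → Status} {v} → DecidableEquality V →
  Update st v old st′ → (∀ w → st w ≡ new → ¬ E v w) → Separation E st → Separation E st′
separation-forget {v = v} _≟_ (p , q) h sep a b ea eb with b ≟ v
... | yes refl = case trans (sym p) eb of λ ()
... | no nb with a ≟ v
...   | yes refl = h b (trans (sym (q b nb)) eb)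
...   | no na = sep a b (trans (sym (q a na)) ea) (trans (sym (q b nb)) eb)

-- A vertex that the split makes `old` lies below the other branch, and the split allows no edge
-- between the two branches.
separation-split : ∀ {V} {E : V → V → Set} {st st₁ st₂ : V → Status} →
  (∀ v → Distribute (st v) (st₁ v) (st₂ v)) → (∀ u v → st₂ u ≡ new → st₁ v ≡ new → ¬ E u v) →
  Separation E st → Separation E st₁
separation-split d h sep a b ea eb with Distribute-old (d a) ea
... | inj₁ e = sep a b e (Distribute-new (d b) eb)
... | inj₂ e = h a b e eb

-- The number in `Good` is mere bookkeeping; this ties it to the actual bag.
Count : {V : Set} → (V → Status) → ℕ → Set
Count {V} st m = Σ (List V) λ xs → Unique xs × (length xs ≡ m) ×
  (∀ v → st v ≡ cur → v ∈ xs) × (∀ v → v ∈ xs → st v ≡ cur)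

count-intro : ∀ {V} {st st′ : V → Status} {v m} → DecidableEquality V →
  Count st m → st v ≡ new → Update st v cur st′ → Count st′ (suc m)
count-intro {st = st} {st′} {v = v} _≟_ (xs , u , l , f , g) e (p , q) =
  v ∷ xs , (All.tabulate (λ {x} x∈ eq → case trans (sym e) (trans (cong st eq) (g x x∈)) of λ ()) ∷ u) ,
  cong suc l , from , to
  where
  from : ∀ w → st′ w ≡ cur → w ∈ v ∷ xs
  from w ew with w ≟ v
  ... | yes refl = here refl
  ... | no ne = there (f w (trans (sym (q w ne)) ew))
  to : ∀ w → w ∈ v ∷ xs → st′ w ≡ cur
  to w (here refl) = p
  to w (there w∈) with w ≟ v
  ... | yes refl = p
  ... | no ne = trans (q w ne) (g w w∈)

count-forget : ∀ {V} {st st′ : V → Status} {v m} → DecidableEquality V →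
  Count st m → st v ≡ cur → Update st v old st′ → Σ ℕ λ m′ → (m ≡ suc m′) × Count st′ m′
count-forget {st = st} {st′} {v = v} _≟_ (xs , u , l , f , g) e (p , q) with ∈-remove (f v e)
... | ys , l′ , f′ , g′ , h = length ys , trans (sym l) l′ , ys , proj₁ (h u) , refl , from , to
  where
  from : ∀ w → st′ w ≡ cur → w ∈ ys
  from w ew with w ≟ v
  ... | yes refl = case trans (sym p) ew of λ ()
  ... | no ne = f′ w (f w (trans (sym (q w ne)) ew)) ne
  to : ∀ w → w ∈ ys → st′ w ≡ cur
  to w w∈ with w ≟ v
  ... | yes refl = ⊥-elim (proj₂ (h u) w∈)
  ... | no ne = trans (q w ne) (g w (g′ w w∈))

count-resp : ∀ {V} {st st′ : V → Status} {m} →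
  (∀ v → st v ≡ cur → st′ v ≡ cur) → (∀ v → st′ v ≡ cur → st v ≡ cur) → Count st m → Count st′ m
count-resp p q (xs , u , l , f , g) = xs , u , l , (λ v e → f v (q v e)) , λ v v∈ → p v (g v v∈)

count-split : ∀ {V} {st st₁ st₂ : V → Status} {m} →
  (∀ v → Distribute (st v) (st₁ v) (st₂ v)) → Count st m → Count st₁ m
count-split d = count-resp (λ v → Distribute-cur⁻ (d v)) (λ v → Distribute-cur (d v))

-- As φ is single-valued, distinct current images are represented by distinct current vertices. This
-- is why a bag does not grow when passing to a minor.
count-≤ : ∀ {V V′ : Set} {st : V → Status} {st′ : V′ → Status} {m m′} (φ : V → Maybe V′) →
  Count st m → Count st′ m′ → (∀ u → st′ u ≡ cur → Σ V λ v → φ v ≡ just u × st v ≡ cur) → m′ ≤ m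
count-≤ φ (xs , _ , refl , f , _) (ys , u , refl , _ , g) h =
  unique-length-≤ (λ v u → φ v ≡ just u) (λ p q → just-injective (trans (sym p) q)) u
    λ y y∈ → let v , e , s = h y (g y y∈) in v , f v s , e

count-empty : ∀ {V} {st : V → Status} → (∀ v → st v ≢ cur) → Count st 0
count-empty h = [] , [] , refl , (λ v e → ⊥-elim (h v e)) , λ v ()

-- Derivations pass to minors

-- Connectedness of the fibres is stated through cuts: a two-colouring that is constant along the
-- edges inside a fibre is constant on it.
record MinorModel {V V′ : Set} (E : V → V → Set) (E′ : V′ → V′ → Set) : Set where
  field
    φ         : V → Maybe V′
    center    : V′ → Maybe V
    connected : ∀ (S : V → Bool) u →
      (∀ a b → φ a ≡ just u → φ b ≡ just u → E a b → S a ≡ S b) →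
      ∀ a b → φ a ≡ just u → φ b ≡ just u → S a ≡ S b
    edge      : ∀ {u u′} → E′ u u′ → Σ V λ a → Σ V λ b → φ a ≡ just u × φ b ≡ just u′ × E a b

isNew : Status → Bool
isNew new = true
isNew cur = false
isNew old = false

isNew⁻ : ∀ {s} → isNew s ≡ true → s ≡ new
isNew⁻ {new} _ = refl

module _ {V V′ : Set} (_≟_ : DecidableEquality V) (_≟′_ : DecidableEquality V′)
  {E : V → V → Set} {E′ : V′ → V′ → Set} (E-sym : Symmetric E) (M : MinorModel E E′) where
  open MinorModel M

  -- The invariant under which a derivation for E is imitated for E′: u is introduced with the first
  -- vertex of its fibre and forgotten when the last current vertex of the fibre goes, so each
  -- current u is represented in the bag.
  record Over (st : V → Status) (st′ : V′ → Status) : Set where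
    field
      center-new : ∀ u → st′ u ≡ new → Σ V λ v → center u ≡ just v × φ v ≡ just u
      fibre-new  : ∀ u v → st′ u ≡ new → φ v ≡ just u → st v ≡ new
      fibre-cur  : ∀ u → st′ u ≡ cur → Σ V λ v → φ v ≡ just u × st v ≡ cur

  private
    restrict : Status → Maybe Status → Status
    restrict new (just s) = s
    restrict new nothing  = old
    restrict cur _        = cur
    restrict old _        = old

    restrict-new : ∀ s x → restrict s x ≡ new → s ≡ new × x ≡ just new
    restrict-new new (just new) refl = refl , refl

    -- A fibre that is still `new` is connected, and no edge joins the branches of a split; so it
    -- lies in one branch, and the status of its center tells in which. The default `old` for a
    -- missing center is never met, by `center-new`.
    restricted : (V → Status) → (V′ → Status) → V′ → Status
    restricted st₁ st′ u = restrict (st′ u) (Maybe.map st₁ (center u))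

    restricted-new : ∀ {st} st₁ {st′} → Over st st′ → ∀ u → restricted st₁ st′ u ≡ new →
      st′ u ≡ new × Σ V λ v → φ v ≡ just u × st₁ v ≡ new
    restricted-new st₁ {st′} R u e with restrict-new (st′ u) _ e
    ... | p , q with Over.center-new R u p
    ... | v , r , s rewrite r = p , v , s , just-injective q

    restricted-cur : ∀ {st : V → Status} st₁ {st₂ : V → Status} {st′} → (∀ v → Distribute (st v) (st₁ v) (st₂ v)) →
      Over st st′ → ∀ u → restricted st₁ st′ u ≡ cur → st′ u ≡ cur
    restricted-cur st₁ {st₂} {st′} d R u e with st′ u in eq
    ... | cur = refl
    ... | new with Over.center-new R u eq
    ... | v , r , s rewrite r = case trans (sym (Distribute-cur (d v) e)) (Over.fibre-new R u v eq s) of λ ()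

    restricted-Distribute : ∀ {st st₁ st₂ : V → Status} {st′} → (∀ v → Distribute (st v) (st₁ v) (st₂ v)) →
      Over st st′ → ∀ u → Distribute (st′ u) (restricted st₁ st′ u) (restricted st₂ st′ u)
    restricted-Distribute {st} {st₁} {st₂} {st′} d R u with st′ u in eq
    ... | cur = current
    ... | old = outside
    ... | new with Over.center-new R u eq
    ... | v , r , s rewrite r with Over.fibre-new R u v eq s
    ... | t = subst (λ x → Distribute x (st₁ v) (st₂ v)) t (d v)

    -- The cut to which connectedness is applied is `isNew ∘ st₁`: along an edge inside the fibre it
    -- cannot change, since the edge would join the two branches.
    restricted-Over : ∀ {st st₁ st₂ : V → Status} {st′} → (∀ v → Distribute (st v) (st₁ v) (st₂ v)) →
      (∀ u v → st₁ u ≡ new → st₂ v ≡ new → ¬ E u v) →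
      Over st st′ → Over st₁ (restricted st₁ st′)
    restricted-Over {st} {st₁} {st₂} {st′} d h R = record
      { center-new = λ u e → Over.center-new R u (proj₁ (restricted-new st₁ R u e))
      ; fibre-new  = fibre-new
      ; fibre-cur  = λ u e → let v , p , q = Over.fibre-cur R u (restricted-cur st₁ d R u e) in
                             v , p , Distribute-cur⁻ (d v) q }
      where
      fibre-new : ∀ u v → restricted st₁ st′ u ≡ new → φ v ≡ just u → st₁ v ≡ new
      fibre-new u v e p with restricted-new st₁ R u e
      ... | q , a , r , t = isNew⁻ (trans (connected (isNew ∘ st₁) u constant v a p r) (cong isNew t))
        where
        constant : ∀ a b → φ a ≡ just u → φ b ≡ just u → E a b → isNew (st₁ a) ≡ isNew (st₁ b)
        constant a b pa pb ab
          with Distribute-choose (d a) (Over.fibre-new R u a q pa)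
             | Distribute-choose (d b) (Over.fibre-new R u b q pb)
        ... | inj₁ (x , _) | inj₁ (y , _) = cong isNew (trans x (sym y))
        ... | inj₂ (x , _) | inj₂ (y , _) = cong isNew (trans x (sym y))
        ... | inj₁ (x , _) | inj₂ (_ , y) = ⊥-elim (h a b x y ab)
        ... | inj₂ (_ , x) | inj₁ (y , _) = ⊥-elim (h b a y x (E-sym ab))

  -- Induction on the derivation for E. Each of its steps becomes the same kind of step for E′ or
  -- none at all, as `Over` prescribes.
  good-minor : ∀ {c st st′ m m′} → Good E c st m → Separation E st → Count st m →
    Over st st′ → Count st′ m′ → Good E′ c st′ m′
  good-minor (leaf h) sep n R n′ =
    leaf λ u e → let v , _ , p = Over.center-new R u e in h v (Over.fibre-new R u v e p)
  good-minor {c} {st} {st′} (intro {st′ = st₁} v e le up g) sep n R n′ with φ v in φv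
  ... | nothing = good-minor g (separation-intro _≟_ up sep) (count-intro _≟_ n e up) R₁ n′
    where
    away : ∀ u w → φ w ≡ just u → w ≢ v
    away u w p refl = case trans (sym p) φv of λ ()
    R₁ : Over st₁ st′
    R₁ = record
      { center-new = Over.center-new R
      ; fibre-new = λ u w p q → trans (proj₂ up w (away u w q)) (Over.fibre-new R u w p q)
      ; fibre-cur = λ u p → let w , q , r = Over.fibre-cur R u p in
                            w , q , trans (proj₂ up w (away u w q)) r }
  ... | just u with st′ u ≟ₛ new
  ...   | no ne = good-minor g (separation-intro _≟_ up sep) (count-intro _≟_ n e up) R₁ n′
    where
    R₁ : Over st₁ st′
    R₁ = record
      { center-new = Over.center-new R
      ; fibre-new = λ u′ w p q → trans
          (proj₂ up w λ { refl → ne (trans (cong st′ (just-injective (trans (sym φv) q))) p) })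
          (Over.fibre-new R u′ w p q)
      ; fibre-cur = λ u p → let w , q , r = Over.fibre-cur R u p in
                            w , q , trans (proj₂ up w λ { refl → case trans (sym e) r of λ () }) r }
  ...   | yes eu = intro u eu (ℕ.≤-trans (count-≤ φ n₁ n₁′ (Over.fibre-cur R₁)) le) up′
                     (good-minor g (separation-intro _≟_ up sep) n₁ R₁ n₁′)
    where
    st₁′ : V′ → Status
    st₁′ = update _≟′_ st′ u cur
    up′ : Update st′ u cur st₁′
    up′ = update-Update _≟′_ st′ u cur
    n₁ = count-intro _≟_ n e up
    n₁′ = count-intro _≟′_ n′ eu up′
    back : ∀ u′ → st₁′ u′ ≡ new → u′ ≢ u × st′ u′ ≡ new
    back u′ p with u′ ≟′ u
    ... | no ne = ne , p
    R₁ : Over st₁ st₁′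
    R₁ = record
      { center-new = λ u′ p → Over.center-new R u′ (proj₂ (back u′ p))
      ; fibre-new = λ u′ w p q → let ne , p′ = back u′ p in trans
          (proj₂ up w λ { refl → ne (just-injective (trans (sym q) φv)) })
          (Over.fibre-new R u′ w p′ q)
      ; fibre-cur = fibre-cur }
      where
      fibre-cur : ∀ u′ → st₁′ u′ ≡ cur → Σ V λ v → φ v ≡ just u′ × st₁ v ≡ cur
      fibre-cur u′ p with u′ ≟′ u
      ... | yes refl = v , φv , proj₁ up
      ... | no ne = let w , q , r = Over.fibre-cur R u′ p in
        w , q , trans (proj₂ up w λ { refl → case trans (sym e) r of λ () }) r
  good-minor {c} {st} {st′} {m′ = m′} (forget {st′ = st₁} v e h up g) sep n R n′
    with count-forget _≟_ n e up
  ... | _ , refl , n₁ = result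
    where
    sep₁ = separation-forget _≟_ up h sep
    fibre-new₁ : ∀ u w → st′ u ≡ new → φ w ≡ just u → st₁ w ≡ new
    fibre-new₁ u w p q = trans (proj₂ up w λ { refl → case trans (sym e) (Over.fibre-new R u w p q) of λ () })
                               (Over.fibre-new R u w p q)
    Represented : V′ → Set
    Represented u = Σ V λ w → φ w ≡ just u × st₁ w ≡ cur

    stays : (∀ u → st′ u ≡ cur → Represented u) → Good E′ c st′ m′
    stays r = good-minor g sep₁ n₁ (record
      { center-new = Over.center-new R ; fibre-new = fibre-new₁ ; fibre-cur = r }) n′

    represented : ∀ u → st′ u ≡ cur → φ v ≢ just u → Represented u
    represented u p ne = let w , q , r = Over.fibre-cur R u p in
      w , q , trans (proj₂ up w λ { refl → ne q }) r

    leaves : ∀ u → φ v ≡ just u → st′ u ≡ cur → ¬ Represented u → Good E′ c st′ m′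
    leaves u φv eu no-rep with count-forget _≟′_ n′ eu (update-Update _≟′_ st′ u old)
    ... | _ , refl , n₁′ = forget u eu no-new (update-Update _≟′_ st′ u old)
                             (good-minor g sep₁ n₁ R₁ n₁′)
      where
      st₁′ = update _≟′_ st′ u old
      no-new : ∀ u₂ → st′ u₂ ≡ new → ¬ E′ u u₂
      no-new u₂ eu₂ uu₂ with edge uu₂
      ... | a , b , φa , φb , ab with Over.fibre-new R u₂ b eu₂ φb | st a in ea
      ... | eb | old = sep a b ea eb ab
      ... | eb | cur with a ≟ v
      ...   | yes refl = h b eb ab
      ...   | no ne = no-rep (a , φa , trans (proj₂ up a ne) ea)
      -- Here a is `new` while v is current. An edge of the fibre that leaves the `new` vertices
      -- would end at an `old` vertex, at v or at another current vertex; the separation, the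
      -- condition of `forget` and `no-rep` exclude these. So the cut into `new` and the rest is
      -- constant on a connected fibre, and yet it separates a from v.
      no-new u₂ eu₂ uu₂ | a , b , φa , φb , ab | eb | new =
        case trans (sym (cong isNew ea)) (trans (connected (isNew ∘ st) u constant a v φa φv) (cong isNew e)) of λ ()
        where
        oneway : ∀ a b → φ b ≡ just u → E a b → st a ≡ new → st b ≡ new
        oneway a b pb ab ea with st b in eb
        ... | new = refl
        ... | old = ⊥-elim (sep b a eb ea (E-sym ab))
        ... | cur with b ≟ v
        ...   | yes refl = ⊥-elim (h a ea (E-sym ab))
        ...   | no ne = ⊥-elim (no-rep (b , pb , trans (proj₂ up b ne) eb))
        constant : ∀ a b → φ a ≡ just u → φ b ≡ just u → E a b → isNew (st a) ≡ isNew (st b)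
        constant a b pa pb ab with st a ≟ₛ new | st b ≟ₛ new
        ... | yes x | _ = cong isNew (trans x (sym (oneway a b pb ab x)))
        ... | no x | yes y = ⊥-elim (x (oneway b a pa (E-sym ab) y))
        ... | no x | no y = trans (notNew x) (sym (notNew y))
          where
          notNew : ∀ {s} → s ≢ new → isNew s ≡ false
          notNew {new} ne = ⊥-elim (ne refl)
          notNew {cur} ne = refl
          notNew {old} ne = refl
      back : ∀ u′ s → s ≢ old → st₁′ u′ ≡ s → u′ ≢ u × st′ u′ ≡ s
      back u′ s ns p with u′ ≟′ u
      ... | yes _ = ⊥-elim (ns (sym p))
      ... | no ne = ne , p
      R₁ : Over st₁ st₁′
      R₁ = record
        { center-new = λ u′ p → Over.center-new R u′ (proj₂ (back u′ new (λ ()) p))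
        ; fibre-new = λ u′ w p → fibre-new₁ u′ w (proj₂ (back u′ new (λ ()) p))
        ; fibre-cur = λ u′ p → let ne , p′ = back u′ cur (λ ()) p in
            represented u′ p′ λ q → ne (just-injective (trans (sym q) φv)) }

    result : Good E′ c st′ m′
    result with φ v in φv
    ... | nothing = stays λ u p → represented u p λ q → case trans (sym φv) q of λ ()
    ... | just u with st′ u ≟ₛ cur
    ...   | no ne = stays λ u′ p → represented u′ p
              λ q → ne (trans (cong st′ (just-injective (trans (sym φv) q))) p)
    ...   | yes eu = decide n₁
      where
      decide : Count st₁ _ → Good E′ c st′ m′
      decide (xs , _ , _ , f , g) with Any.any? (λ w → Maybe.≡-dec _≟′_ (φ w) (just u)) xs
      ... | no nope = leaves u φv eu λ { (w , p , q) → nope (lose (f w q) p) }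
      ... | yes ok with find ok
      ...   | w , w∈ , p = stays λ u′ q → cover u′ q
        where
        cover : ∀ u′ → st′ u′ ≡ cur → Represented u′
        cover u′ q with u′ ≟′ u
        ... | yes refl = w , p , g w w∈
        ... | no ne = represented u′ q λ r → ne (just-injective (trans (sym r) φv))
  good-minor {c} {st} {st′} (split {st₁ = st₁} {st₂} d h g₁ g₂) sep n R n′ =
    split (restricted-Distribute d R)
      (λ u u′ e e′ uu′ → separated u u′ e e′ uu′)
      (good-minor g₁ (separation-split d h′ sep) (count-split d n) (restricted-Over d h R)
        (count-split (restricted-Distribute d R) n′))
      (good-minor g₂ (separation-split d̃ h sep) (count-split d̃ n) (restricted-Over d̃ h′ R)
        (count-split (λ u → Distribute-sym (restricted-Distribute d R u)) n′))
    where
    d̃ = λ v → Distribute-sym (d v)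
    h′ : ∀ u v → st₂ u ≡ new → st₁ v ≡ new → ¬ E u v
    h′ u v e e′ uv = h v u e′ e (E-sym uv)
    separated : ∀ u u′ → restricted st₁ st′ u ≡ new → restricted st₂ st′ u′ ≡ new → ¬ E′ u u′
    separated u u′ e e′ uu′ with edge uu′
    ... | a , b , φa , φb , ab = h a b
      (Over.fibre-new (restricted-Over d h R) u a e φa)
      (Over.fibre-new (restricted-Over d̃ h′ R) u′ b e′ φb) ab

-- Graphs with a labelled boundary and protocols

record Half (r : ℕ) : Set₁ where
  field
    Inner      : Set
    _≟ᵢ_       : DecidableEquality Inner
    inner      : Inner → Inner → Set
    attach     : Inner → Fin r → Set
    border     : Fin r → Fin r → Set
    inner-sym  : Symmetric inner
    border-sym : Symmetric border

  soloE : Inner ⊎ Fin r → Inner ⊎ Fin r → Set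
  soloE (inj₁ u) (inj₁ v) = inner u v
  soloE (inj₁ u) (inj₂ t) = attach u t
  soloE (inj₂ t) (inj₁ u) = attach u t
  soloE (inj₂ t) (inj₂ t′) = border t t′

  local : (Inner → Status) → Vec Status r → Inner ⊎ Fin r → Status
  local α σ = [ α , lookup σ ]′

open Half

GlueV : ∀ {r} → Half r → Half r → Set
GlueV {r} h₁ h₂ = Inner h₁ ⊎ (Inner h₂ ⊎ Fin r)

-- The usual gluing of boundaried graphs along r labelled vertices; an edge inside the boundary may
-- be contributed by either half.
glueE : ∀ {r} (h₁ h₂ : Half r) → GlueV h₁ h₂ → GlueV h₁ h₂ → Set
glueE h₁ h₂ (inj₁ u) (inj₁ v) = inner h₁ u v
glueE h₁ h₂ (inj₁ u) (inj₂ (inj₁ v)) = ⊥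
glueE h₁ h₂ (inj₁ u) (inj₂ (inj₂ t)) = attach h₁ u t
glueE h₁ h₂ (inj₂ (inj₁ v)) (inj₁ u) = ⊥
glueE h₁ h₂ (inj₂ (inj₁ u)) (inj₂ (inj₁ v)) = inner h₂ u v
glueE h₁ h₂ (inj₂ (inj₁ u)) (inj₂ (inj₂ t)) = attach h₂ u t
glueE h₁ h₂ (inj₂ (inj₂ t)) (inj₁ u) = attach h₁ u t
glueE h₁ h₂ (inj₂ (inj₂ t)) (inj₂ (inj₁ u)) = attach h₂ u t
glueE h₁ h₂ (inj₂ (inj₂ t)) (inj₂ (inj₂ t′)) = border h₁ t t′ ⊎ border h₂ t t′

glueE-sym : ∀ {r} (h₁ h₂ : Half r) → Symmetric (glueE h₁ h₂)
glueE-sym h₁ h₂ {inj₁ u} {inj₁ v} e = inner-sym h₁ e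
glueE-sym h₁ h₂ {inj₁ u} {inj₂ (inj₂ t)} e = e
glueE-sym h₁ h₂ {inj₂ (inj₁ u)} {inj₂ (inj₁ v)} e = inner-sym h₂ e
glueE-sym h₁ h₂ {inj₂ (inj₁ u)} {inj₂ (inj₂ t)} e = e
glueE-sym h₁ h₂ {inj₂ (inj₂ t)} {inj₁ u} e = e
glueE-sym h₁ h₂ {inj₂ (inj₂ t)} {inj₂ (inj₁ v)} e = e
glueE-sym h₁ h₂ {inj₂ (inj₂ t)} {inj₂ (inj₂ t′)} (inj₁ e) = inj₁ (border-sym h₁ e)
glueE-sym h₁ h₂ {inj₂ (inj₂ t)} {inj₂ (inj₂ t′)} (inj₂ e) = inj₂ (border-sym h₂ e)

glued : ∀ {r} (h₁ h₂ : Half r) → (Inner h₁ → Status) → (Inner h₂ → Status) → (Fin r → Status) →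
  GlueV h₁ h₂ → Status
glued h₁ h₂ α β σ = [ α , [ β , σ ]′ ]′

-- A protocol is what the two sides of a separation have to agree on when they are decomposed
-- together: the boundary moves, and after each run of private moves of one side
-- (`run true` for the first half) the size of that side's share of the bag.
data Proto (r : ℕ) : Set where
  stop  : Proto r
  run   : Bool → ℕ → Proto r → Proto r
  enter : Fin r → Proto r → Proto r
  leave : Fin r → Proto r → Proto r
  fork  : Vec Status r → Vec Status r → Proto r → Proto r → Proto r

module _ {r : ℕ} (c : ℕ) (h : Half r) where

  -- `discharge` splits off a branch that the half finishes alone. Since σ is the same before and
  -- after, τ has no `new` boundary vertex; the share of the other half can be forgotten there at
  -- once, so the size a + s is the right one.
  data Move (σ : Vec Status r) (s : ℕ) : (Inner h → Status) → ℕ → (Inner h → Status) → ℕ → Set where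
    intro     : ∀ {α α′ a} v → α v ≡ new → Update α v cur α′ → Move σ s α a α′ (suc a)
    forget    : ∀ {α α′ a} v → α v ≡ cur → (∀ w → local h α σ w ≡ new → ¬ soloE h (inj₁ v) w) →
                Update α v old α′ → Move σ s α (suc a) α′ a
    discharge : ∀ {α α′ a} τ → (∀ w → Distribute (local h α σ w) (local h α′ σ w) (τ w)) →
                (∀ u w → local h α′ σ u ≡ new → τ w ≡ new → ¬ soloE h u w) →
                Good (soloE h) c τ (a + s) → Move σ s α a α′ a

  -- In `Run σ s b` the other side occupies b places of the bag throughout.
  data Run (σ : Vec Status r) (s b : ℕ) : (Inner h → Status) → ℕ → (Inner h → Status) → ℕ → Set where
    stay : ∀ {α α′ a} → α ≗ α′ → Run σ s b α a α′ a
    move : ∀ {α α₁ α′ a a₁ a′} → Move σ s α a α₁ a₁ → a₁ + b + s ≤ c →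
           Run σ s b α₁ a₁ α′ a′ → Run σ s b α a α′ a′

  -- The other half enters only through the size b of its share, so halves that implement the same
  -- protocols can replace each other. At `stop` no boundary vertex is `new`, and from there on the
  -- halves do not interact.
  data Impl (side : Bool) : Proto r → Vec Status r → ℕ → (Inner h → Status) → ℕ → ℕ → Set where
    stop  : ∀ {σ s α a b} → (∀ t → lookup σ t ≢ new) → Good (soloE h) c (local h α σ) (a + s) →
            Impl side stop σ s α a b
    mine  : ∀ {p σ s α α′ a x b} → Run σ s b α a α′ x → Impl side p σ s α′ x b →
            Impl side (run side x p) σ s α a b
    other : ∀ {p σ s α a x b} → Impl side p σ s α a x → Impl side (run (not side) x p) σ s α a b
    enter : ∀ {p σ s α a b} t → lookup σ t ≡ new → suc (a + b + s) ≤ c →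
            Impl side p (σ [ t ]≔ cur) (suc s) α a b → Impl side (enter t p) σ s α a b
    leave : ∀ {p σ s α a b} t → lookup σ t ≡ cur →
            (∀ w → local h α σ w ≡ new → ¬ soloE h (inj₂ t) w) →
            Impl side p (σ [ t ]≔ old) s α a b → Impl side (leave t p) σ (suc s) α a b
    fork  : ∀ {p₁ p₂ σ σ₁ σ₂ s α α₁ α₂ a b} →
            (∀ w → Distribute (local h α σ w) (local h α₁ σ₁ w) (local h α₂ σ₂ w)) →
            (∀ u w → local h α₁ σ₁ u ≡ new → local h α₂ σ₂ w ≡ new → ¬ soloE h u w) →
            Impl side p₁ σ₁ s α₁ a b → Impl side p₂ σ₂ s α₂ a b →
            Impl side (fork σ₁ σ₂ p₁ p₂) σ s α a b

  count-move : ∀ {σ s α a α′ a′} → Move σ s α a α′ a′ → Count α a → Count α′ a′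
  count-move (intro v e up) n = count-intro (_≟ᵢ_ h) n e up
  count-move (forget v e _ up) n with count-forget (_≟ᵢ_ h) n e up
  ... | _ , refl , n′ = n′
  count-move (discharge τ d _ _) n = count-split (λ v → d (inj₁ v)) n

  count-run : ∀ {σ s b α a α′ a′} → Run σ s b α a α′ a′ → Count α a → Count α′ a′
  count-run (stay e) n = count-resp (λ v p → trans (sym (e v)) p) (λ v p → trans (e v) p) n
  count-run (move m _ R) n = count-run R (count-move m n)

-- Soundness of protocols

-- The status in a branch that leaves everything `new` to the sibling branch.
retire : Status → Status
retire new = old
retire cur = cur
retire old = old

retire-new : ∀ s → retire s ≢ new
retire-new new ()
retire-new cur ()
retire-new old ()

retire-Distribute : ∀ s → Distribute s s (retire s)
retire-Distribute new = left
retire-Distribute cur = current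
retire-Distribute old = outside

retire-cur : ∀ s → retire s ≡ cur → s ≡ cur
retire-cur cur refl = refl

count-retire : ∀ {V} {α : V → Status} {a} → Count α a → Count (retire ∘ α) a
count-retire {α = α} = count-resp (λ v p → cong retire p) (λ v → retire-cur (α v))

good-iso : ∀ {V V′ : Set} {E : V → V → Set} {E′ : V′ → V′ → Set} {c} (e : V → V′) (e⁻ : V′ → V) →
  (∀ v → e⁻ (e v) ≡ v) → (∀ u → e (e⁻ u) ≡ u) → (∀ {u v} → E′ u v → E (e⁻ u) (e⁻ v)) →
  ∀ {st m} → Good E c st m → Good E′ c (st ∘ e⁻) m
good-iso {V} {V′} {E} {E′} {c} e e⁻ l r hom = go
  where
  up′ : ∀ {st v s st′} → Update st v s st′ → Update (st ∘ e⁻) (e v) s (st′ ∘ e⁻)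
  up′ {st′ = st′} (p , q) = trans (cong st′ (l _)) p ,
    λ u ne → q (e⁻ u) λ x → ne (trans (sym (r u)) (cong e x))
  go : ∀ {st m} → Good E c st m → Good E′ c (st ∘ e⁻) m
  go (leaf h) = leaf λ v → h (e⁻ v)
  go {st} (intro v p le u g) = intro (e v) (trans (cong st (l v)) p) le (up′ u) (go g)
  go {st} (forget v p h u g) = forget (e v) (trans (cong st (l v)) p)
    (λ w q x → h (e⁻ w) q (subst (λ z → E z (e⁻ w)) (l v) (hom x))) (up′ u) (go g)
  go (split d h g₁ g₂) = split (λ v → d (e⁻ v)) (λ u v p q x → h _ _ p q (hom x)) (go g₁) (go g₂)

lookup-Update : ∀ {r} (σ : Vec Status r) t s → Update (lookup σ) t s (lookup (σ [ t ]≔ s))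
lookup-Update σ t s = Vec.lookup∘update t σ s , λ u ne → Vec.lookup∘update′ ne σ s

+-swap₁₂ : ∀ a b s → a + b + s ≡ b + a + s
+-swap₁₂ a b s = cong (_+ s) (ℕ.+-comm a b)

+-rotate : ∀ a b s → b + (a + s) ≡ a + b + s
+-rotate a b s = trans (sym (ℕ.+-assoc b a s)) (+-swap₁₂ b a s)

module _ {r : ℕ} (h₁ h₂ : Half r) where
  glue-swap : GlueV h₁ h₂ → GlueV h₂ h₁
  glue-swap (inj₁ u) = inj₂ (inj₁ u)
  glue-swap (inj₂ (inj₁ v)) = inj₁ v
  glue-swap (inj₂ (inj₂ t)) = inj₂ (inj₂ t)

  glue-swap-edge : ∀ {u v} → glueE h₁ h₂ u v → glueE h₂ h₁ (glue-swap u) (glue-swap v)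
  glue-swap-edge {inj₁ u} {inj₁ v} e = e
  glue-swap-edge {inj₁ u} {inj₂ (inj₂ t)} e = e
  glue-swap-edge {inj₂ (inj₁ u)} {inj₂ (inj₁ v)} e = e
  glue-swap-edge {inj₂ (inj₁ u)} {inj₂ (inj₂ t)} e = e
  glue-swap-edge {inj₂ (inj₂ t)} {inj₁ u} e = e
  glue-swap-edge {inj₂ (inj₂ t)} {inj₂ (inj₁ v)} e = e
  glue-swap-edge {inj₂ (inj₂ t)} {inj₂ (inj₂ t′)} (inj₁ e) = inj₂ e
  glue-swap-edge {inj₂ (inj₂ t)} {inj₂ (inj₂ t′)} (inj₂ e) = inj₁ e

glue-swap-involutive : ∀ {r} (h₁ h₂ : Half r) v → glue-swap h₂ h₁ (glue-swap h₁ h₂ v) ≡ v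
glue-swap-involutive h₁ h₂ (inj₁ u) = refl
glue-swap-involutive h₁ h₂ (inj₂ (inj₁ v)) = refl
glue-swap-involutive h₁ h₂ (inj₂ (inj₂ t)) = refl

good-swap : ∀ {r} (h₁ h₂ : Half r) {c α β σ} a b s → Good (glueE h₁ h₂) c (glued h₁ h₂ α β σ) (a + b + s) →
  Good (glueE h₂ h₁) c (glued h₂ h₁ β α σ) (b + a + s)
good-swap h₁ h₂ a b s g = subst (Good _ _ _) (+-swap₁₂ a b s) (Good-resp
  (λ { (inj₁ u) → refl ; (inj₂ (inj₁ v)) → refl ; (inj₂ (inj₂ t)) → refl })
  (good-iso (glue-swap h₁ h₂) (glue-swap h₂ h₁) (glue-swap-involutive h₁ h₂) (glue-swap-involutive h₂ h₁)
    (λ {u} {v} → glue-swap-edge h₂ h₁ {u} {v}) g))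

module _ {r : ℕ} (c : ℕ) (h₁ h₂ : Half r) where
  private
    extend : (Inner h₁ ⊎ Fin r → Status) → (Inner h₂ → Status) → GlueV h₁ h₂ → Status
    extend τ γ = glued h₁ h₂ (τ ∘ inj₁) γ (τ ∘ inj₂)

    emb : Inner h₁ ⊎ Fin r → GlueV h₁ h₂
    emb (inj₁ u) = inj₁ u
    emb (inj₂ t) = inj₂ (inj₂ t)

    extend-Update : ∀ {τ γ v s τ′} → Update τ v s τ′ → Update (extend τ γ) (emb v) s (extend τ′ γ)
    extend-Update {v = inj₁ v} (p , q) = p , λ
      { (inj₁ u) ne → q (inj₁ u) λ { refl → ne refl }
      ; (inj₂ (inj₁ u)) ne → refl
      ; (inj₂ (inj₂ t)) ne → q (inj₂ t) λ () }
    extend-Update {v = inj₂ v} (p , q) = p , λ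
      { (inj₁ u) ne → q (inj₁ u) λ ()
      ; (inj₂ (inj₁ u)) ne → refl
      ; (inj₂ (inj₂ t)) ne → q (inj₂ t) λ { refl → ne refl } }

    extend-emb : ∀ {τ γ} v → extend τ γ (emb v) ≡ τ v
    extend-emb (inj₁ v) = refl
    extend-emb (inj₂ t) = refl

    good-extend : ∀ {τ γ m} → Good (soloE h₁) c τ m → (∀ t → τ (inj₂ t) ≢ new) → (∀ v → γ v ≢ new) →
      Good (glueE h₁ h₂) c (extend τ γ) m
    good-extend (leaf h) nσ nγ = leaf λ
      { (inj₁ u) → h (inj₁ u) ; (inj₂ (inj₁ v)) → nγ v ; (inj₂ (inj₂ t)) → nσ t }
    good-extend (intro (inj₂ t) p le up g) nσ nγ = ⊥-elim (nσ t p)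
    good-extend {τ} (intro {st′ = τ′} (inj₁ v) p le up g) nσ nγ =
      intro (inj₁ v) p le (extend-Update {v = inj₁ v} up)
        (good-extend g (λ t e → nσ t (trans (sym (proj₂ up (inj₂ t) λ ())) e)) nγ)
    good-extend {τ} {γ} (forget {st′ = τ′} v p h up g) nσ nγ =
      forget (emb v) (trans (extend-emb {τ} {γ} v) p) (blocked v h) (extend-Update up)
        (good-extend g nσ′ nγ)
      where
      nσ′ : ∀ t → τ′ (inj₂ t) ≢ new
      nσ′ t e with Sum.≡-dec (_≟ᵢ_ h₁) Fin._≟_ (inj₂ t) v
      ... | yes refl = case trans (sym (proj₁ up)) e of λ ()
      ... | no ne = nσ t (trans (sym (proj₂ up (inj₂ t) ne)) e)
      blocked : ∀ v → (∀ w → τ w ≡ new → ¬ soloE h₁ v w) →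
        ∀ w → extend τ γ w ≡ new → ¬ glueE h₁ h₂ (emb v) w
      blocked (inj₁ v) h (inj₁ w) e = h (inj₁ w) e
      blocked (inj₁ v) h (inj₂ (inj₂ t)) e = ⊥-elim (nσ t e)
      blocked (inj₁ v) h (inj₂ (inj₁ w)) e ()
      blocked (inj₂ v) h (inj₁ w) e = h (inj₁ w) e
      blocked (inj₂ v) h (inj₂ (inj₂ t)) e = ⊥-elim (nσ t e)
      blocked (inj₂ v) h (inj₂ (inj₁ w)) e = ⊥-elim (nγ w e)
    good-extend {τ} {γ} (split {st₁ = τ₁} {τ₂} d h g₁ g₂) nσ nγ =
      split (λ { (inj₁ u) → d (inj₁ u)
               ; (inj₂ (inj₁ v)) → same v
               ; (inj₂ (inj₂ t)) → d (inj₂ t) })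
        separated
        (good-extend g₁ (λ t e → nσ t (Distribute-new (d (inj₂ t)) e)) nγ)
        (good-extend g₂ (λ t e → nσ t (Distribute-new (Distribute-sym (d (inj₂ t))) e)) nγ)
      where
      same : ∀ v → Distribute (γ v) (γ v) (γ v)
      same v with γ v in e
      ... | new = ⊥-elim (nγ v e)
      ... | cur = current
      ... | old = outside
      separated : ∀ u v → extend τ₁ γ u ≡ new → extend τ₂ γ v ≡ new → ¬ glueE h₁ h₂ u v
      separated (inj₁ u) (inj₁ v) p q = h (inj₁ u) (inj₁ v) p q
      separated (inj₂ (inj₁ u)) v p q = ⊥-elim (nγ u p)
      separated (inj₂ (inj₂ t)) v p q = ⊥-elim (nσ t (Distribute-new (d (inj₂ t)) p))
      separated (inj₁ u) (inj₂ (inj₁ v)) p q = ⊥-elim (nγ v q)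
      separated (inj₁ u) (inj₂ (inj₂ t)) p q =
        ⊥-elim (nσ t (Distribute-new (Distribute-sym (d (inj₂ t))) q))

  -- Once nothing new is left on the second side and on the boundary, the second side's share of
  -- the bag can be forgotten.
  good-solo : ∀ {τ γ m b} → Good (soloE h₁) c τ m → (∀ t → τ (inj₂ t) ≢ new) → (∀ v → γ v ≢ new) →
    Count γ b → Good (glueE h₁ h₂) c (glued h₁ h₂ (τ ∘ inj₁) γ (τ ∘ inj₂)) (b + m)
  good-solo {b = zero} g nσ nγ n = good-extend g nσ nγ
  good-solo {τ} {γ} {b = suc b} g nσ nγ n@(v ∷ xs , u , l , f , k)
    with count-forget (_≟ᵢ_ h₂) n (k v (here refl)) (update-Update (_≟ᵢ_ h₂) γ v old)
  ... | _ , refl , n′ = forget (inj₂ (inj₁ v)) (k v (here refl)) blocked up (good-solo g nσ nγ′ n′)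
    where
    γ′ = update (_≟ᵢ_ h₂) γ v old
    up₀ = update-Update (_≟ᵢ_ h₂) γ v old
    nγ′ : ∀ w → γ′ w ≢ new
    nγ′ w e with _≟ᵢ_ h₂ w v
    ... | no ne = nγ w e
    up : Update (extend τ γ) (inj₂ (inj₁ v)) old (extend τ γ′)
    up = proj₁ up₀ , λ
      { (inj₁ u) ne → refl
      ; (inj₂ (inj₁ w)) ne → proj₂ up₀ w λ { refl → ne refl }
      ; (inj₂ (inj₂ t)) ne → refl }
    blocked : ∀ w → extend τ γ w ≡ new → ¬ glueE h₁ h₂ (inj₂ (inj₁ v)) w
    blocked (inj₂ (inj₁ w)) e = ⊥-elim (nγ w e)
    blocked (inj₂ (inj₂ t)) e = ⊥-elim (nσ t e)

  good-move : ∀ {σ s b α a α₁ a₁ β} → Move c h₁ σ s α a α₁ a₁ → a₁ + b + s ≤ c → Count β b →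
    Good (glueE h₁ h₂) c (glued h₁ h₂ α₁ β (lookup σ)) (a₁ + b + s) →
    Good (glueE h₁ h₂) c (glued h₁ h₂ α β (lookup σ)) (a + b + s)
  good-move {σ} {α = α} {β = β} (intro {α′ = α₁} v e up) le n g = intro (inj₁ v) e le up′ g
    where
    up′ : Update (glued h₁ h₂ α β (lookup σ)) (inj₁ v) cur (glued h₁ h₂ α₁ β (lookup σ))
    up′ = proj₁ up , λ
      { (inj₁ u) ne → proj₂ up u λ { refl → ne refl }
      ; (inj₂ (inj₁ w)) ne → refl ; (inj₂ (inj₂ t)) ne → refl }
  good-move {σ} {α = α} {β = β} (forget {α′ = α₁} v e h up) le n g = forget (inj₁ v) e blocked up′ g
    where
    up′ : Update (glued h₁ h₂ α β (lookup σ)) (inj₁ v) old (glued h₁ h₂ α₁ β (lookup σ))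
    up′ = proj₁ up , λ
      { (inj₁ u) ne → proj₂ up u λ { refl → ne refl }
      ; (inj₂ (inj₁ w)) ne → refl ; (inj₂ (inj₂ t)) ne → refl }
    blocked : ∀ w → glued h₁ h₂ α β (lookup σ) w ≡ new → ¬ glueE h₁ h₂ (inj₁ v) w
    blocked (inj₁ w) p = h (inj₁ w) p
    blocked (inj₂ (inj₂ t)) p = h (inj₂ t) p
  good-move {σ} {s} {b} {α} {a} {α₁} {β = β} (discharge τ d h g₂) le n g =
    split d′ separated g
      (subst (Good _ c _) (+-rotate a b s) (good-solo g₂ nτ (λ v → retire-new (β v)) (count-retire n)))
    where
    nτ : ∀ t → τ (inj₂ t) ≢ new
    nτ t = Distribute-same (d (inj₂ t)) refl
    d′ : ∀ v → Distribute (glued h₁ h₂ α β (lookup σ) v) (glued h₁ h₂ α₁ β (lookup σ) v)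
                          (glued h₁ h₂ (τ ∘ inj₁) (retire ∘ β) (τ ∘ inj₂) v)
    d′ (inj₁ u) = d (inj₁ u)
    d′ (inj₂ (inj₁ v)) = retire-Distribute (β v)
    d′ (inj₂ (inj₂ t)) = d (inj₂ t)
    separated : ∀ u v → glued h₁ h₂ α₁ β (lookup σ) u ≡ new →
      glued h₁ h₂ (τ ∘ inj₁) (retire ∘ β) (τ ∘ inj₂) v ≡ new → ¬ glueE h₁ h₂ u v
    separated u (inj₂ (inj₁ v)) p q = ⊥-elim (retire-new (β v) q)
    separated u (inj₂ (inj₂ t)) p q = ⊥-elim (nτ t q)
    separated (inj₁ u) (inj₁ v) p q = h (inj₁ u) (inj₁ v) p q
    separated (inj₂ (inj₂ t)) (inj₁ v) p q = h (inj₂ t) (inj₁ v) p q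

  good-run : ∀ {σ s b α a α′ a′ β} → Run c h₁ σ s b α a α′ a′ → Count β b →
    Good (glueE h₁ h₂) c (glued h₁ h₂ α′ β (lookup σ)) (a′ + b + s) →
    Good (glueE h₁ h₂) c (glued h₁ h₂ α β (lookup σ)) (a + b + s)
  good-run (stay e) n g = Good-resp
    (λ { (inj₁ u) → sym (e u) ; (inj₂ (inj₁ v)) → refl ; (inj₂ (inj₂ t)) → refl }) g
  good-run (move m le R) n g = good-move m le n (good-run R n g)

module _ {r : ℕ} (c : ℕ) (h₁ h₂ : Half r) where
  -- The two implementations are interleaved: during a `run` of one half the other one rests, and
  -- its share is exactly the number b for which that run was checked.
  impl-sound : ∀ {p σ s α a β b} → Impl c h₁ true p σ s α a b → Impl c h₂ false p σ s β b a →
    Count α a → Count β b → Good (glueE h₁ h₂) c (glued h₁ h₂ α β (lookup σ)) (a + b + s)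
  -- A split gives each half a branch of its own, in which the other half is retired.
  impl-sound {σ = σ} {s} {α} {a} {β} {b} (stop nσ g₁) (stop _ g₂) n₁ n₂ =
    split {st₁ = glued h₁ h₂ α (retire ∘ β) (lookup σ)} {st₂ = glued h₁ h₂ (retire ∘ α) β (lookup σ)}
      (λ { (inj₁ u) → retire-Distribute (α u)
         ; (inj₂ (inj₁ v)) → Distribute-sym (retire-Distribute (β v))
         ; (inj₂ (inj₂ t)) → same t })
      separated
      (subst (Good _ c _) (+-rotate a b s)
        (good-solo c h₁ h₂ g₁ nσ (λ v → retire-new (β v)) (count-retire n₂)))
      (good-swap h₂ h₁ b a s (subst (Good _ c _) (+-rotate b a s)
        (good-solo c h₂ h₁ g₂ nσ (λ v → retire-new (α v)) (count-retire n₁))))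
    where
    same : ∀ t → Distribute (lookup σ t) (lookup σ t) (lookup σ t)
    same t with lookup σ t in e
    ... | new = ⊥-elim (nσ t e)
    ... | cur = current
    ... | old = outside
    separated : ∀ u v → glued h₁ h₂ α (retire ∘ β) (lookup σ) u ≡ new →
      glued h₁ h₂ (retire ∘ α) β (lookup σ) v ≡ new → ¬ glueE h₁ h₂ u v
    separated u (inj₁ v) p q = ⊥-elim (retire-new (α v) q)
    separated (inj₂ (inj₁ u)) v p q = ⊥-elim (retire-new (β u) p)
    separated (inj₂ (inj₂ t)) v p q = ⊥-elim (nσ t p)
    separated (inj₁ u) (inj₂ (inj₂ t)) p q = ⊥-elim (nσ t q)
  impl-sound (mine R i) (other j) n₁ n₂ = good-run c h₁ h₂ R n₂ (impl-sound i j (count-run c h₁ R n₁) n₂)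
  impl-sound {s = s} {a = a} {b = b} (other i) (mine {x = x} R j) n₁ n₂ = good-swap h₂ h₁ b a s
    (good-run c h₂ h₁ R n₁ (good-swap h₁ h₂ a x s (impl-sound i j n₁ (count-run c h₂ R n₂))))
  impl-sound {σ = σ} {s} {α} {a} {β} {b} (enter t e le i) (enter .t _ _ j) n₁ n₂ =
    intro (inj₂ (inj₂ t)) e le
      (proj₁ up , λ { (inj₁ u) ne → refl ; (inj₂ (inj₁ v)) ne → refl
                    ; (inj₂ (inj₂ t′)) ne → proj₂ up t′ λ { refl → ne refl } })
      (subst (Good _ c _) (ℕ.+-suc (a + b) s) (impl-sound i j n₁ n₂))
    where up = lookup-Update σ t cur
  impl-sound {σ = σ} {suc s} {α} {a} {β} {b} (leave t e h i) (leave .t _ h′ j) n₁ n₂ =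
    subst (Good _ c _) (sym (ℕ.+-suc (a + b) s)) (forget (inj₂ (inj₂ t)) e blocked
      (proj₁ up , λ { (inj₁ u) ne → refl ; (inj₂ (inj₁ v)) ne → refl
                    ; (inj₂ (inj₂ t′)) ne → proj₂ up t′ λ { refl → ne refl } })
      (impl-sound i j n₁ n₂))
    where
    up = lookup-Update σ t old
    blocked : ∀ w → glued h₁ h₂ α β (lookup σ) w ≡ new → ¬ glueE h₁ h₂ (inj₂ (inj₂ t)) w
    blocked (inj₁ w) p = h (inj₁ w) p
    blocked (inj₂ (inj₁ w)) p = h′ (inj₁ w) p
    blocked (inj₂ (inj₂ w)) p (inj₁ x) = h (inj₂ w) p x
    blocked (inj₂ (inj₂ w)) p (inj₂ x) = h′ (inj₂ w) p x
  impl-sound {σ = σ} {α = α} {β = β} (fork {σ₁ = σ₁} {σ₂} {α₁ = α₁} {α₂} d h i₁ i₂)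
    (fork {α₁ = β₁} {β₂} d′ h′ j₁ j₂) n₁ n₂ =
    split (λ { (inj₁ u) → d (inj₁ u) ; (inj₂ (inj₁ v)) → d′ (inj₁ v) ; (inj₂ (inj₂ t)) → d (inj₂ t) })
      separated
      (impl-sound i₁ j₁ (count-split (d ∘ inj₁) n₁) (count-split (d′ ∘ inj₁) n₂))
      (impl-sound i₂ j₂ (count-split (λ v → Distribute-sym (d (inj₁ v))) n₁)
        (count-split (λ v → Distribute-sym (d′ (inj₁ v))) n₂))
    where
    separated : ∀ u v → glued h₁ h₂ α₁ β₁ (lookup σ₁) u ≡ new →
      glued h₁ h₂ α₂ β₂ (lookup σ₂) v ≡ new → ¬ glueE h₁ h₂ u v
    separated (inj₁ u) (inj₁ v) p q = h (inj₁ u) (inj₁ v) p q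
    separated (inj₁ u) (inj₂ (inj₂ t)) p q = h (inj₁ u) (inj₂ t) p q
    separated (inj₂ (inj₁ u)) (inj₂ (inj₁ v)) p q = h′ (inj₁ u) (inj₁ v) p q
    separated (inj₂ (inj₁ u)) (inj₂ (inj₂ t)) p q = h′ (inj₁ u) (inj₂ t) p q
    separated (inj₂ (inj₂ t)) (inj₁ v) p q = h (inj₂ t) (inj₁ v) p q
    separated (inj₂ (inj₂ t)) (inj₂ (inj₁ v)) p q = h′ (inj₂ t) (inj₁ v) p q
    separated (inj₂ (inj₂ t)) (inj₂ (inj₂ t′)) p q (inj₁ x) = h (inj₂ t) (inj₂ t′) p q x
    separated (inj₂ (inj₂ t)) (inj₂ (inj₂ t′)) p q (inj₂ x) = h′ (inj₂ t) (inj₂ t′) p q x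

-- Completeness of protocols of bounded depth

-- Depth and announced shares are the only unbounded data of a protocol; with both bounded, `protos`
-- can list them all.
data Bounded {r : ℕ} (c : ℕ) : ℕ → Proto r → Set where
  stop  : ∀ {d} → Bounded c (suc d) stop
  run   : ∀ {d w x p} → x ≤ c → Bounded c d p → Bounded c (suc d) (run w x p)
  enter : ∀ {d t p} → Bounded c d p → Bounded c (suc d) (enter t p)
  leave : ∀ {d t p} → Bounded c d p → Bounded c (suc d) (leave t p)
  fork  : ∀ {d σ₁ σ₂ p₁ p₂} → Bounded c d p₁ → Bounded c d p₂ → Bounded c (suc d) (fork σ₁ σ₂ p₁ p₂)

bounded-mono : ∀ {r c d d′} {p : Proto r} → d ≤ d′ → Bounded c d p → Bounded c d′ p
bounded-mono (s≤s le) stop = stop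
bounded-mono (s≤s le) (run x b) = run x (bounded-mono le b)
bounded-mono (s≤s le) (enter b) = enter (bounded-mono le b)
bounded-mono (s≤s le) (leave b) = leave (bounded-mono le b)
bounded-mono (s≤s le) (fork b b′) = fork (bounded-mono le b) (bounded-mono le b′)

allStatus : List Status
allStatus = new ∷ cur ∷ old ∷ []

∈-allStatus : ∀ s → s ∈ allStatus
∈-allStatus new = here refl
∈-allStatus cur = there (here refl)
∈-allStatus old = there (there (here refl))

allBool : List Bool
allBool = true ∷ false ∷ []

∈-allBool : ∀ b → b ∈ allBool
∈-allBool true = here refl
∈-allBool false = there (here refl)

allVec : ∀ {A : Set} → List A → ∀ m → List (Vec A m)
allVec xs zero = Vec.[] ∷ []
allVec xs (suc m) = List.cartesianProductWith Vec._∷_ xs (allVec xs m)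

∈-allVec : ∀ {A : Set} {xs : List A} → (∀ x → x ∈ xs) → ∀ {m} (v : Vec A m) → v ∈ allVec xs m
∈-allVec h Vec.[] = here refl
∈-allVec h (x Vec.∷ v) = ∈.∈-cartesianProductWith⁺ Vec._∷_ (h x) (∈-allVec h v)

runs enters leaves forks : ∀ {r} → ℕ → List (Proto r) → List (Proto r)
runs c ps = List.cartesianProductWith (λ wx p → run (proj₁ wx) (proj₂ wx) p)
  (List.cartesianProduct allBool (List.upTo (suc c))) ps
enters c ps = List.cartesianProductWith enter (allFin _) ps
leaves c ps = List.cartesianProductWith leave (allFin _) ps
forks c ps = List.cartesianProductWith (λ σ p → fork (proj₁ σ) (proj₂ σ) (proj₁ p) (proj₂ p))
  (List.cartesianProduct (allVec allStatus _) (allVec allStatus _)) (List.cartesianProduct ps ps)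

families : ∀ {r} → ℕ → List (Proto r) → List (List (Proto r))
families c ps = runs c ps ∷ enters c ps ∷ leaves c ps ∷ forks c ps ∷ []

protos : ∀ (r c : ℕ) → ℕ → List (Proto r)
protos r c zero = []
protos r c (suc d) = stop ∷ List.concat (families c (protos r c d))

∈-protos : ∀ {r c d} {p : Proto r} → Bounded c d p → p ∈ protos r c d
∈-protos stop = here refl
∈-protos {r} {c} {suc d} (run {w = w} x b) = there (∈.∈-concat⁺′ {xss = families c (protos r c d)}
  (∈.∈-cartesianProductWith⁺ (λ wx p → run (proj₁ wx) (proj₂ wx) p)
    (∈.∈-cartesianProduct⁺ (∈-allBool w) (∈.∈-upTo⁺ (s≤s x))) (∈-protos b)) (here refl))
∈-protos {r} {c} {suc d} (enter b) = there (∈.∈-concat⁺′ {xss = families c (protos r c d)}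
  (∈.∈-cartesianProductWith⁺ enter (∈.∈-allFin _) (∈-protos b)) (there (here refl)))
∈-protos {r} {c} {suc d} (leave b) = there (∈.∈-concat⁺′ {xss = families c (protos r c d)}
  (∈.∈-cartesianProductWith⁺ leave (∈.∈-allFin _) (∈-protos b)) (there (there (here refl))))
∈-protos {r} {c} {suc d} (fork {σ₁ = σ₁} {σ₂} b b′) = there (∈.∈-concat⁺′ {xss = families c (protos r c d)}
  (∈.∈-cartesianProductWith⁺ (λ σ p → fork (proj₁ σ) (proj₂ σ) (proj₁ p) (proj₂ p))
    (∈.∈-cartesianProduct⁺ (∈-allVec ∈-allStatus σ₁) (∈-allVec ∈-allStatus σ₂))
    (∈.∈-cartesianProduct⁺ (∈-protos b) (∈-protos b′))) (there (there (there (here refl)))))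

Update-resp : ∀ {V : Set} {st st₀ : V → Status} {v s st′} → st ≗ st₀ → Update st v s st′ → Update st₀ v s st′
Update-resp e (p , q) = p , λ u ne → trans (q u ne) (e u)

module _ {r c : ℕ} {h : Half r} where
  private
    local-resp : ∀ {α α₀} σ → α ≗ α₀ → local h α σ ≗ local h α₀ σ
    local-resp σ e (inj₁ u) = e u
    local-resp σ e (inj₂ t) = refl

  move-resp : ∀ {σ s α α₀ a α′ a′} → α ≗ α₀ → Move c h σ s α a α′ a′ → Move c h σ s α₀ a α′ a′
  move-resp e (intro v p up) = intro v (trans (sym (e v)) p) (Update-resp e up)
  move-resp {σ} e (forget v p b up) = forget v (trans (sym (e v)) p)
    (λ w q → b w (trans (local-resp σ e w) q)) (Update-resp e up)
  move-resp {σ} e (discharge τ d b g) =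
    discharge τ (λ w → subst (λ s → Distribute s _ _) (local-resp σ e w) (d w)) b g

  run-resp : ∀ {σ s b α α₀ a α′ a′} → α ≗ α₀ → Run c h σ s b α a α′ a′ → Run c h σ s b α₀ a α′ a′
  run-resp e (stay e′) = stay λ v → trans (sym (e v)) (e′ v)
  run-resp e (move m le R) = move (move-resp e m) le R

  impl-resp : ∀ {side p σ s α α₀ a b} → α ≗ α₀ → Impl c h side p σ s α a b → Impl c h side p σ s α₀ a b
  impl-resp {σ = σ} e (stop nσ g) = stop nσ (Good-resp (local-resp σ e) g)
  impl-resp e (mine R i) = mine (run-resp e R) i
  impl-resp e (other i) = other (impl-resp e i)
  impl-resp e (enter t p le i) = enter t p le (impl-resp e i)
  impl-resp {σ = σ} e (leave t p b i) =
    leave t p (λ w q → b w (trans (local-resp σ e w) q)) (impl-resp e i)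
  impl-resp {σ = σ} e (fork d b i₁ i₂) =
    fork (λ w → subst (λ s → Distribute s _ _) (local-resp σ e w) (d w)) b i₁ i₂

-- The argument bounds the number of values that the first share can take. The summands belong to
-- the stretch before the first state of least share, the move into it, the three runs between the
-- first and the last such state, the move out of the last one, and the stretch after it.
alternations : ℕ → ℕ
alternations zero = 0
alternations (suc h) = (alternations h + 1) + (3 + (1 + alternations h))

segment : ℕ → ℕ
segment c = alternations (suc c)

module _ {r : ℕ} (c : ℕ) (h₁ h₂ : Half r) where

  record JointState : Set where
    constructor joint
    field
      α : Inner h₁ → Status
      a : ℕ
      β : Inner h₂ → Status
      b : ℕ
  open JointState

  -- Interleaved private moves of both sides, with lower bounds la and lb on the two shares.
  data Joint (σ : Vec Status r) (s la lb : ℕ) : JointState → JointState → Set where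
    done  : ∀ {α a β b α′ β′} → la ≤ a → lb ≤ b → a + b + s ≤ c → α ≗ α′ → β ≗ β′ →
            Joint σ s la lb (joint α a β b) (joint α′ a β′ b)
    step₁ : ∀ {α a β b α₁ a₁ y} → la ≤ a → lb ≤ b → a + b + s ≤ c → Move c h₁ σ s α a α₁ a₁ →
            Joint σ s la lb (joint α₁ a₁ β b) y → Joint σ s la lb (joint α a β b) y
    step₂ : ∀ {α a β b β₁ b₁ y} → la ≤ a → lb ≤ b → a + b + s ≤ c → Move c h₂ σ s β b β₁ b₁ →
            Joint σ s la lb (joint α a β₁ b₁) y → Joint σ s la lb (joint α a β b) y

  private variable
    σ : Vec Status r
    s la lb : ℕ
    x y z : JointState

  joint-resp : ∀ {α α₀ a β β₀ b} → α ≗ α₀ → β ≗ β₀ →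
    Joint σ s la lb (joint α a β b) y → Joint σ s la lb (joint α₀ a β₀ b) y
  joint-resp e f (done p q r e′ f′) = done p q r (λ v → trans (sym (e v)) (e′ v)) λ v → trans (sym (f v)) (f′ v)
  joint-resp e f (step₁ p q r m j) = step₁ p q r (move-resp e m) (joint-resp (λ _ → refl) f j)
  joint-resp e f (step₂ p q r m j) = step₂ p q r (move-resp f m) (joint-resp e (λ _ → refl) j)

  joint-trans : Joint σ s la lb x y → Joint σ s la lb y z → Joint σ s la lb x z
  joint-trans (done _ _ _ e f) k = joint-resp (λ v → sym (e v)) (λ v → sym (f v)) k
  joint-trans (step₁ p q r m j) k = step₁ p q r m (joint-trans j k)
  joint-trans (step₂ p q r m j) k = step₂ p q r m (joint-trans j k)

  joint-weaken : ∀ {lb′} → lb′ ≤ lb → Joint σ s la lb x y → Joint σ s la lb′ x y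
  joint-weaken le (done p q r e f) = done p (ℕ.≤-trans le q) r e f
  joint-weaken le (step₁ p q r m j) = step₁ p (ℕ.≤-trans le q) r m (joint-weaken le j)
  joint-weaken le (step₂ p q r m j) = step₂ p (ℕ.≤-trans le q) r m (joint-weaken le j)

  joint-head : Joint σ s la lb x y → (la ≤ a x) × (lb ≤ b x) × (a x + b x + s ≤ c)
  joint-head (done p q r _ _) = p , q , r
  joint-head (step₁ p q r _ _) = p , q , r
  joint-head (step₂ p q r _ _) = p , q , r

  joint-last : Joint σ s la lb x y → a y + b y + s ≤ c
  joint-last (done _ _ r _ _) = r
  joint-last (step₁ _ _ _ _ j) = joint-last j
  joint-last (step₂ _ _ _ _ j) = joint-last j

  joint-run₁ : ∀ {b₀} → b₀ ≤ lb → Joint σ s la lb x y → Run c h₁ σ s b₀ (α x) (a x) (α y) (a y)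
  joint-run₁ le (done _ _ _ e _) = stay e
  joint-run₁ {s = s} le (step₁ {a₁ = a₁} _ _ _ m j) = let _ , q , r = joint-head j in
    move m (ℕ.≤-trans (ℕ.+-monoˡ-≤ s (ℕ.+-monoʳ-≤ a₁ (ℕ.≤-trans le q))) r) (joint-run₁ le j)
  joint-run₁ le (step₂ _ _ _ m j) = joint-run₁ le j

  joint-run₂ : ∀ {a₀} → a₀ ≤ la → Joint σ s la lb x y → Run c h₂ σ s a₀ (β x) (b x) (β y) (b y)
  joint-run₂ le (done _ _ _ _ f) = stay f
  joint-run₂ {s = s} {a₀ = a₀} le (step₂ {b₁ = b₁} _ _ _ m j) = let p , _ , r = joint-head j in
    move m (ℕ.≤-trans (ℕ.≤-reflexive (+-swap₁₂ b₁ a₀ s))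
      (ℕ.≤-trans (ℕ.+-monoˡ-≤ s (ℕ.+-monoˡ-≤ b₁ (ℕ.≤-trans le p))) r)) (joint-run₂ le j)
  joint-run₂ le (step₁ _ _ _ m j) = joint-run₂ le j

  -- With `b z` as lower bound on both pieces, the first side can make all its moves of the whole
  -- stretch while the second one rests at z.
  joint-argmin-b : Joint σ s la lb x y →
    Σ JointState λ z → Joint σ s la (b z) x z × Joint σ s la (b z) z y
  joint-argmin-b {x = x} (done p q r e f) =
    x , done p ℕ.≤-refl r (λ _ → refl) (λ _ → refl) , done p ℕ.≤-refl r e f
  joint-argmin-b {x = x} (step₁ p q r m j) with joint-argmin-b j
  ... | z , k , l with ℕ.≤-total (b z) (b x)
  ... | inj₁ le = z , step₁ p le r m k , l
  ... | inj₂ le = x , done p ℕ.≤-refl r (λ _ → refl) (λ _ → refl) ,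
    step₁ p ℕ.≤-refl r m (joint-weaken le (joint-trans k l))
  joint-argmin-b {x = x} (step₂ p q r m j) with joint-argmin-b j
  ... | z , k , l with ℕ.≤-total (b z) (b x)
  ... | inj₁ le = z , step₂ p le r m k , l
  ... | inj₂ le = x , done p ℕ.≤-refl r (λ _ → refl) (λ _ → refl) ,
    step₂ p ℕ.≤-refl r m (joint-weaken le (joint-trans k l))

  -- x can be brought to y by at most ℓ runs, each of one side only.
  Runs : ℕ → Vec Status r → ℕ → JointState → JointState → Set
  Runs ℓ σ s x y = ∀ {d p} → Bounded c d p →
    Impl c h₁ true p σ s (α y) (a y) (b y) → Impl c h₂ false p σ s (β y) (b y) (a y) →
    Σ (Proto r) λ p′ → Bounded c (ℓ + d) p′ ×
      Impl c h₁ true p′ σ s (α x) (a x) (b x) × Impl c h₂ false p′ σ s (β x) (b x) (a x)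

  runs-trans : ∀ {ℓ ℓ′} → Runs ℓ σ s x y → Runs ℓ′ σ s y z → Runs (ℓ + ℓ′) σ s x z
  runs-trans {ℓ = ℓ} {ℓ′} f g {d} bd i j with g bd i j
  ... | p , bp , i′ , j′ with f bp i′ j′
  ... | p″ , bp″ , i″ , j″ = p″ , bounded-mono (ℕ.≤-reflexive (sym (ℕ.+-assoc ℓ ℓ′ d))) bp″ , i″ , j″

  runs-mono : ∀ {ℓ ℓ′} → ℓ ≤ ℓ′ → Runs ℓ σ s x y → Runs ℓ′ σ s x y
  runs-mono le f {d} bd i j with f bd i j
  ... | p , bp , i′ , j′ = p , bounded-mono (ℕ.+-monoˡ-≤ d le) bp , i′ , j′

  runs-≗ : ∀ {α α′ a β β′ b} → α ≗ α′ → β ≗ β′ → Runs 0 σ s (joint α a β b) (joint α′ a β′ b)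
  runs-≗ e f bd i j = _ , bd , impl-resp (λ v → sym (e v)) i , impl-resp (λ v → sym (f v)) j

  runs-run₁ : ∀ {α a β b α′ a′} → a′ ≤ c → Run c h₁ σ s b α a α′ a′ →
    Runs 1 σ s (joint α a β b) (joint α′ a′ β b)
  runs-run₁ le R bd i j = _ , run le bd , mine R i , other j

  runs-run₂ : ∀ {α a β b β′ b′} → b′ ≤ c → Run c h₂ σ s a β b β′ b′ →
    Runs 1 σ s (joint α a β b) (joint α a β′ b′)
  runs-run₂ le R bd i j = _ , run le bd , other i , mine R j

  share₁≤c : ∀ {s} a b → a + b + s ≤ c → a ≤ c
  share₁≤c a b le = ℕ.≤-trans (ℕ.m≤m+n a b) (ℕ.m+n≤o⇒m≤o (a + b) le)

  share₂≤c : ∀ {s} a b → a + b + s ≤ c → b ≤ c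
  share₂≤c a b le = ℕ.≤-trans (ℕ.m≤n+m b a) (ℕ.m+n≤o⇒m≤o (a + b) le)

  runs-step₁ : ∀ {α a β b α₁ a₁ y} → Move c h₁ σ s α a α₁ a₁ → Joint σ s la lb (joint α₁ a₁ β b) y →
    Runs 1 σ s (joint α a β b) (joint α₁ a₁ β b)
  runs-step₁ {b = b} {a₁ = a₁} m j = let _ , _ , r = joint-head j in
    runs-run₁ (share₁≤c a₁ b r) (move m r (stay λ _ → refl))

  runs-step₂ : ∀ {α a β b β₁ b₁ y} → Move c h₂ σ s β b β₁ b₁ → Joint σ s la lb (joint α a β₁ b₁) y →
    Runs 1 σ s (joint α a β b) (joint α a β₁ b₁)
  runs-step₂ {s = s} {a = a} {b₁ = b₁} m j = let _ , _ , r = joint-head j in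
    runs-run₂ (share₂≤c a b₁ r) (move m (ℕ.≤-trans (ℕ.≤-reflexive (+-swap₁₂ b₁ a s)) r) (stay λ _ → refl))

  joint-here : Joint σ s la lb x y → ∀ {la′} → la′ ≤ a x → Joint σ s la′ lb x x
  joint-here j le = let _ , q , r = joint-head j in done le q r (λ _ → refl) (λ _ → refl)

  -- z is the first state whose first share equals the lower bound. If it is not the start, it is
  -- reached by one move from a state w, and up to w the share stays above the bound.
  FromBottom : Vec Status r → ℕ → ℕ → ℕ → JointState → JointState → Set
  FromBottom σ s la lb x y = Σ JointState λ z → (a z ≡ la) × Joint σ s la lb z y ×
    (x ≡ z ⊎ Σ JointState λ w → Joint σ s (suc la) lb x w × Runs 1 σ s w z)

  first-bottom : Joint σ s la lb x y → Joint σ s (suc la) lb x y ⊎ FromBottom σ s la lb x y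
  first-bottom {la = la} {x = x} j with ℕ.m≤n⇒m<n∨m≡n (proj₁ (joint-head j))
  first-bottom {x = x} j | inj₂ e = inj₂ (x , sym e , j , inj₁ refl)
  first-bottom (done p q r e f) | inj₁ lt = inj₁ (done lt q r e f)
  first-bottom {x = x} (step₁ p q r m j) | inj₁ lt with first-bottom j
  ... | inj₁ j′ = inj₁ (step₁ lt q r m j′)
  ... | inj₂ (z , e , k , inj₁ refl) =
    inj₂ (z , e , k , inj₂ (x , done lt q r (λ _ → refl) (λ _ → refl) , runs-step₁ m j))
  ... | inj₂ (z , e , k , inj₂ (w , j′ , f)) = inj₂ (z , e , k , inj₂ (w , step₁ lt q r m j′ , f))
  first-bottom {x = x} (step₂ p q r m j) | inj₁ lt with first-bottom j
  ... | inj₁ j′ = inj₁ (step₂ lt q r m j′)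
  ... | inj₂ (z , e , k , inj₁ refl) =
    inj₂ (z , e , k , inj₂ (x , done lt q r (λ _ → refl) (λ _ → refl) , runs-step₂ m j))
  ... | inj₂ (z , e , k , inj₂ (w , j′ , f)) = inj₂ (z , e , k , inj₂ (w , step₂ lt q r m j′ , f))

  ToBottom : Vec Status r → ℕ → ℕ → ℕ → JointState → JointState → Set
  ToBottom σ s la lb x y = Σ JointState λ z → (a z ≡ la) × Joint σ s la lb x z ×
    (Runs 0 σ s z y ⊎ Σ JointState λ w → Runs 1 σ s z w × Joint σ s (suc la) lb w y)

  last-bottom : Joint σ s la lb x y → Joint σ s (suc la) lb x y ⊎ ToBottom σ s la lb x y
  last-bottom {x = x} j₀@(done p q r e f) with ℕ.m≤n⇒m<n∨m≡n p
  ... | inj₁ lt = inj₁ (done lt q r e f)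
  ... | inj₂ refl = inj₂ (x , refl , joint-here j₀ p , inj₁ (runs-≗ e f))
  last-bottom {x = x} j₀@(step₁ p q r m j) with last-bottom j
  ... | inj₂ (z , e , k , t) = inj₂ (z , e , step₁ p q r m k , t)
  ... | inj₁ k with ℕ.m≤n⇒m<n∨m≡n p
  ...   | inj₁ lt = inj₁ (step₁ lt q r m k)
  ...   | inj₂ refl = inj₂ (x , refl , joint-here j₀ p , inj₂ (_ , runs-step₁ m j , k))
  last-bottom {x = x} j₀@(step₂ p q r m j) with last-bottom j
  ... | inj₂ (z , e , k , t) = inj₂ (z , e , step₂ p q r m k , t)
  ... | inj₁ k with ℕ.m≤n⇒m<n∨m≡n p
  ...   | inj₁ lt = inj₁ (step₂ lt q r m k)
  ...   | inj₂ refl = inj₂ (x , refl , joint-here j₀ p , inj₂ (_ , runs-step₂ m j , k))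

  -- Between two states where the first share is minimal, the second side moves while the first one
  -- rests there, and the first side moves while the second share is minimal.
  runs-between : ∀ {x y} → a x ≡ la → a y ≡ la → Joint σ s la lb x y → Runs 3 σ s x y
  runs-between {x = joint αx ax βx bx} {joint αy ay βy by} refl refl j with joint-argmin-b j
  ... | joint αz az βz bz , k , l =
    runs-trans {y = joint αx ax βz bz}
      (runs-run₂ (share₂≤c az bz (joint-last k)) (joint-run₂ ℕ.≤-refl k))
      (runs-trans {y = joint αy ay βz bz}
        (runs-run₁ (share₁≤c ay by (joint-last j)) (joint-run₁ ℕ.≤-refl (joint-trans k l)))
        (runs-run₂ (share₂≤c ay by (joint-last j)) (joint-run₂ ℕ.≤-refl l)))

  -- Induction on the number of values left for the first share: before the first and after the last
  -- state with share la, the lower bound rises to `suc la`. When no value is left, the bound c on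
  -- the bag is violated. From la = 0 there are `suc c` values, which explains `segment`.
  dealternate : ∀ h → suc c ≤ la + h → Joint σ s la lb x y → Runs (alternations h) σ s x y
  dealternate {la = la} {x = x} zero lt j = let p , _ , r = joint-head j in
    ⊥-elim (ℕ.<-irrefl refl (ℕ.≤-trans lt (ℕ.≤-trans (ℕ.≤-reflexive (ℕ.+-identityʳ la))
      (ℕ.≤-trans p (share₁≤c (a x) (b x) r)))))
  dealternate {la = la} (suc h) lt j = whole
    where
    ℓ = alternations h
    lt′ : suc c ≤ suc la + h
    lt′ = ℕ.≤-trans lt (ℕ.≤-reflexive (ℕ.+-suc la h))
    before : ∀ {σ s lb x z} →
      (x ≡ z ⊎ Σ JointState λ w → Joint σ s (suc la) lb x w × Runs 1 σ s w z) → Runs (ℓ + 1) σ s x z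
    before (inj₁ refl) = runs-mono z≤n (runs-≗ (λ _ → refl) (λ _ → refl))
    before (inj₂ (w , k , f)) = runs-trans (dealternate h lt′ k) f
    after : ∀ {σ s lb z y} →
      (Runs 0 σ s z y ⊎ Σ JointState λ w → Runs 1 σ s z w × Joint σ s (suc la) lb w y) → Runs (1 + ℓ) σ s z y
    after (inj₁ f) = runs-mono z≤n f
    after (inj₂ (w , f , k)) = runs-trans f (dealternate h lt′ k)
    whole : Runs ((ℓ + 1) + (3 + (1 + ℓ))) _ _ _ _
    whole with first-bottom j
    ... | inj₁ k = runs-mono (ℕ.≤-trans (ℕ.m≤m+n ℓ 1) (ℕ.m≤m+n (ℓ + 1) _)) (dealternate h lt′ k)
    ... | inj₂ (z , ez , k , pre) with last-bottom k
    ...   | inj₁ l = runs-trans (before pre)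
              (runs-mono (ℕ.≤-trans (ℕ.n≤1+n ℓ) (ℕ.m≤n+m (1 + ℓ) 3)) (dealternate h lt′ l))
    ...   | inj₂ (w , ew , l , post) = runs-trans (before pre) (runs-trans (runs-between ez ew l) (after post))

  dealternate-all : Joint σ s 0 0 x y → Runs (segment c) σ s x y
  dealternate-all = dealternate (suc c) ℕ.≤-refl

-- A status advances from `new` towards `old` and never returns. Hence a boundary of r vertices
-- allows at most 2r boundary steps on a branch; over all vertices of a graph the same potential
-- terminates the search in `good?`.
weight : Status → ℕ
weight new = 2
weight cur = 1
weight old = 0

potential : ∀ {r} → Vec Status r → ℕ
potential Vec.[] = 0
potential (s Vec.∷ σ) = weight s + potential σ

potential-mono : ∀ {r} (σ σ′ : Vec Status r) →
  (∀ t → weight (lookup σ′ t) ≤ weight (lookup σ t)) → potential σ′ ≤ potential σ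
potential-mono Vec.[] Vec.[] h = z≤n
potential-mono (_ Vec.∷ σ) (_ Vec.∷ σ′) h = ℕ.+-mono-≤ (h zero) (potential-mono σ σ′ (h ∘ suc))

potential-strict : ∀ {r} (σ σ′ : Vec Status r) → (∀ t → weight (lookup σ′ t) ≤ weight (lookup σ t)) →
  ∀ t → weight (lookup σ′ t) < weight (lookup σ t) → potential σ′ < potential σ
potential-strict (_ Vec.∷ σ) (_ Vec.∷ σ′) h zero lt = ℕ.+-mono-<-≤ lt (potential-mono σ σ′ (h ∘ suc))
potential-strict (_ Vec.∷ σ) (_ Vec.∷ σ′) h (suc t) lt =
  ℕ.+-mono-≤-< (h zero) (potential-strict σ σ′ (h ∘ suc) t lt)

potential-update : ∀ {r} (σ : Vec Status r) t {s s′} → lookup σ t ≡ s → weight s′ < weight s →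
  potential (σ [ t ]≔ s′) < potential σ
potential-update σ t {s} {s′} e lt = potential-strict σ (σ [ t ]≔ s′) below t at
  where
  at : weight (lookup (σ [ t ]≔ s′) t) < weight (lookup σ t)
  at rewrite Vec.lookup∘update t σ s′ | e = lt
  below : ∀ u → weight (lookup (σ [ t ]≔ s′) u) ≤ weight (lookup σ u)
  below u with u Fin.≟ t
  ... | yes refl = ℕ.<⇒≤ at
  ... | no ne = ℕ.≤-reflexive (cong weight (Vec.lookup∘update′ ne σ s′))

Distribute-weight : ∀ {s s₁ s₂} → Distribute s s₁ s₂ → weight s₁ ≤ weight s
Distribute-weight left = ℕ.≤-refl
Distribute-weight right = z≤n
Distribute-weight current = ℕ.≤-refl
Distribute-weight outside = ℕ.≤-refl

Distribute-weight-< : ∀ {s s₁ s₂} → Distribute s s₁ s₂ → s₂ ≡ new → weight s₁ < weight s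
Distribute-weight-< right refl = s≤s z≤n

module _ {V V′ : Set} (_≟_ : DecidableEquality V) (_≟′_ : DecidableEquality V′)
  {E : V → V → Set} {E′ : V′ → V′ → Set} (E-sym : Symmetric E) (e : V′ → V) (e⁻ : V → Maybe V′)
  (e⁻∘e : ∀ u → e⁻ (e u) ≡ just u) (e∘e⁻ : ∀ v u → e⁻ v ≡ just u → v ≡ e u)
  (hom : ∀ {u u′} → E′ u u′ → E (e u) (e u′)) where

  good-restrict : ∀ {c st m m′} → Good E c st m → Separation E st → Count st m →
    Count (st ∘ e) m′ → Good E′ c (st ∘ e) m′
  good-restrict {st = st} g sep n n′ = good-minor _≟_ _≟′_ E-sym M g sep n R n′
    where
    M : MinorModel E E′
    M = record
      { φ = e⁻
      ; center = just ∘ e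
      ; connected = λ S u _ a b p q → cong S (trans (e∘e⁻ a u p) (sym (e∘e⁻ b u q)))
      ; edge = λ x → _ , _ , e⁻∘e _ , e⁻∘e _ , hom x }
    R : Over _≟_ _≟′_ E-sym M st (st ∘ e)
    R = record
      { center-new = λ u p → e u , refl , e⁻∘e u
      ; fibre-new = λ u v p q → trans (cong st (e∘e⁻ v u q)) p
      ; fibre-cur = λ u p → e u , e⁻∘e u , p }

count-local : ∀ {A B : Set} {τ : A ⊎ B → Status} {a s} →
  Count (τ ∘ inj₁) a → Count (τ ∘ inj₂) s → Count τ (a + s)
count-local {A} {B} {τ} (xs , u , refl , f , g) (ys , u′ , refl , f′ , g′) =
  map inj₁ xs ++ map inj₂ ys ,
  Unique.++⁺ (Unique.map⁺ Sum.inj₁-injective u) (Unique.map⁺ Sum.inj₂-injective u′)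
    (λ { (p , q) → disjoint p q }) ,
  trans (List.length-++ (map inj₁ xs)) (cong₂ _+_ (List.length-map inj₁ xs) (List.length-map inj₂ ys)) ,
  (λ { (inj₁ v) e → ∈.∈-++⁺ˡ (∈.∈-map⁺ inj₁ (f v e))
     ; (inj₂ v) e → ∈.∈-++⁺ʳ (map inj₁ xs) (∈.∈-map⁺ inj₂ (f′ v e)) }) ,
  back
  where
  disjoint : ∀ {v} → v ∈ map inj₁ xs → v ∈ map inj₂ ys → ⊥
  disjoint p q with ∈.∈-map⁻ inj₁ p | ∈.∈-map⁻ inj₂ q
  ... | _ , _ , refl | _ , _ , ()
  back : ∀ v → v ∈ map inj₁ xs ++ map inj₂ ys → τ v ≡ cur
  back v p with ∈.∈-++⁻ (map inj₁ xs) p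
  ... | inj₁ q with ∈.∈-map⁻ inj₁ q
  ...   | w , w∈ , refl = g w w∈
  back v p | inj₂ q with ∈.∈-map⁻ inj₂ q
  ...   | w , w∈ , refl = g′ w w∈

module _ {r : ℕ} (c : ℕ) (h₁ h₂ : Half r) where
  private
    G : GlueV h₁ h₂ → GlueV h₁ h₂ → Set
    G = glueE h₁ h₂

    _≟g_ : DecidableEquality (GlueV h₁ h₂)
    _≟g_ = Sum.≡-dec (_≟ᵢ_ h₁) (Sum.≡-dec (_≟ᵢ_ h₂) Fin._≟_)

    side₁ : Inner h₁ ⊎ Fin r → GlueV h₁ h₂
    side₁ (inj₁ u) = inj₁ u
    side₁ (inj₂ t) = inj₂ (inj₂ t)

    side₂ : Inner h₂ ⊎ Fin r → GlueV h₁ h₂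
    side₂ (inj₁ u) = inj₂ (inj₁ u)
    side₂ (inj₂ t) = inj₂ (inj₂ t)

    good-side₁ : ∀ {st m a s} → Good G c st m → Separation G st → Count st m →
      Count (st ∘ inj₁) a → Count (st ∘ inj₂ ∘ inj₂) s → Good (soloE h₁) c (st ∘ side₁) (a + s)
    good-side₁ g sep n n₁ nσ = good-restrict _≟g_ (Sum.≡-dec (_≟ᵢ_ h₁) Fin._≟_)
      (λ {u} {v} → glueE-sym h₁ h₂ {u} {v}) side₁
      (λ { (inj₁ u) → just (inj₁ u) ; (inj₂ (inj₁ v)) → nothing ; (inj₂ (inj₂ t)) → just (inj₂ t) })
      (λ { (inj₁ u) → refl ; (inj₂ t) → refl })
      (λ { (inj₁ u) _ refl → refl ; (inj₂ (inj₂ t)) _ refl → refl })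
      (λ { {inj₁ u} {inj₁ v} x → x ; {inj₁ u} {inj₂ t} x → x ; {inj₂ t} {inj₁ u} x → x
         ; {inj₂ t} {inj₂ t′} x → inj₁ x })
      g sep n (count-local n₁ nσ)

    good-side₂ : ∀ {st m b s} → Good G c st m → Separation G st → Count st m →
      Count (st ∘ inj₂ ∘ inj₁) b → Count (st ∘ inj₂ ∘ inj₂) s → Good (soloE h₂) c (st ∘ side₂) (b + s)
    good-side₂ g sep n n₁ nσ = good-restrict _≟g_ (Sum.≡-dec (_≟ᵢ_ h₂) Fin._≟_)
      (λ {u} {v} → glueE-sym h₁ h₂ {u} {v}) side₂
      (λ { (inj₁ u) → nothing ; (inj₂ (inj₁ v)) → just (inj₁ v) ; (inj₂ (inj₂ t)) → just (inj₂ t) })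
      (λ { (inj₁ u) → refl ; (inj₂ t) → refl })
      (λ { (inj₂ (inj₁ u)) _ refl → refl ; (inj₂ (inj₂ t)) _ refl → refl })
      (λ { {inj₁ u} {inj₁ v} x → x ; {inj₁ u} {inj₂ t} x → x ; {inj₂ t} {inj₁ u} x → x
         ; {inj₂ t} {inj₂ t′} x → inj₂ x })
      g sep n (count-local n₁ nσ)

    Path : Vec Status r → ℕ → JointState c h₁ h₂ → JointState c h₁ h₂ → Set
    Path σ s = Joint c h₁ h₂ σ s 0 0

  -- A derivation of the glued graph, cut at its boundary steps, with all private moves between two
  -- of them gathered in a `Path`. A `fork` must give both branches a `new` boundary vertex, so that
  -- the potential drops in each of them.
  data Tree : Vec Status r → ℕ → (Inner h₁ → Status) → ℕ → (Inner h₂ → Status) → ℕ → Set where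
    stop  : ∀ {σ s α a β b α′ a′ β′ b′} → Path σ s (joint α a β b) (joint α′ a′ β′ b′) →
            (∀ t → lookup σ t ≢ new) →
            Good (soloE h₁) c (local h₁ α′ σ) (a′ + s) → Good (soloE h₂) c (local h₂ β′ σ) (b′ + s) →
            Tree σ s α a β b
    enter : ∀ {σ s α a β b α′ a′ β′ b′} → Path σ s (joint α a β b) (joint α′ a′ β′ b′) →
            ∀ t → lookup σ t ≡ new → suc (a′ + b′ + s) ≤ c →
            Tree (σ [ t ]≔ cur) (suc s) α′ a′ β′ b′ → Tree σ s α a β b
    leave : ∀ {σ s α a β b α′ a′ β′ b′} → Path σ (suc s) (joint α a β b) (joint α′ a′ β′ b′) →
            ∀ t → lookup σ t ≡ cur →
            (∀ w → local h₁ α′ σ w ≡ new → ¬ soloE h₁ (inj₂ t) w) →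
            (∀ w → local h₂ β′ σ w ≡ new → ¬ soloE h₂ (inj₂ t) w) →
            Tree (σ [ t ]≔ old) s α′ a′ β′ b′ → Tree σ (suc s) α a β b
    fork  : ∀ {σ s α a β b α′ a′ β′ b′ σ₁ σ₂ α₁ α₂ β₁ β₂} →
            Path σ s (joint α a β b) (joint α′ a′ β′ b′) →
            (∃ λ t → lookup σ₁ t ≡ new) → (∃ λ t → lookup σ₂ t ≡ new) →
            (∀ w → Distribute (local h₁ α′ σ w) (local h₁ α₁ σ₁ w) (local h₁ α₂ σ₂ w)) →
            (∀ u w → local h₁ α₁ σ₁ u ≡ new → local h₁ α₂ σ₂ w ≡ new → ¬ soloE h₁ u w) →
            (∀ w → Distribute (local h₂ β′ σ w) (local h₂ β₁ σ₁ w) (local h₂ β₂ σ₂ w)) →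
            (∀ u w → local h₂ β₁ σ₁ u ≡ new → local h₂ β₂ σ₂ w ≡ new → ¬ soloE h₂ u w) →
            Tree σ₁ s α₁ a′ β₁ b′ → Tree σ₂ s α₂ a′ β₂ b′ → Tree σ s α a β b

  private
    tree-prefix : ∀ {σ s α a β b α′ a′ β′ b′} → Path σ s (joint α a β b) (joint α′ a′ β′ b′) →
      Tree σ s α′ a′ β′ b′ → Tree σ s α a β b
    tree-prefix j (stop k p g₁ g₂) = stop (joint-trans c h₁ h₂ j k) p g₁ g₂
    tree-prefix j (enter k t e le T) = enter (joint-trans c h₁ h₂ j k) t e le T
    tree-prefix j (leave k t e p q T) = leave (joint-trans c h₁ h₂ j k) t e p q T
    tree-prefix j (fork k p q d₁ x₁ d₂ x₂ T₁ T₂) = fork (joint-trans c h₁ h₂ j k) p q d₁ x₁ d₂ x₂ T₁ T₂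

    rest : ∀ {σ s α a β b α′ β′} → a + b + s ≤ c → α ≗ α′ → β ≗ β′ →
      Path σ s (joint α a β b) (joint α′ a β′ b)
    rest = done z≤n z≤n

    shares₁ : ∀ (st : GlueV h₁ h₂ → Status) (σ : Vec Status r) → (∀ t → st (inj₂ (inj₂ t)) ≡ lookup σ t) →
      ∀ w → st (side₁ w) ≡ local h₁ (st ∘ inj₁) σ w
    shares₁ st σ e (inj₁ u) = refl
    shares₁ st σ e (inj₂ t) = e t

    shares₂ : ∀ (st : GlueV h₁ h₂ → Status) (σ : Vec Status r) → (∀ t → st (inj₂ (inj₂ t)) ≡ lookup σ t) →
      ∀ w → st (side₂ w) ≡ local h₂ (st ∘ inj₂ ∘ inj₁) σ w
    shares₂ st σ e (inj₁ u) = refl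
    shares₂ st σ e (inj₂ t) = e t

    sep-side₁ : ∀ {st₁ st₂ : GlueV h₁ h₂ → Status} →
      (∀ u v → st₁ u ≡ new → st₂ v ≡ new → ¬ G u v) →
      ∀ u w → st₁ (side₁ u) ≡ new → st₂ (side₁ w) ≡ new → ¬ soloE h₁ u w
    sep-side₁ h (inj₁ u) (inj₁ w) p q x = h _ _ p q x
    sep-side₁ h (inj₁ u) (inj₂ w) p q x = h _ _ p q x
    sep-side₁ h (inj₂ u) (inj₁ w) p q x = h _ _ p q x
    sep-side₁ h (inj₂ u) (inj₂ w) p q x = h _ _ p q (inj₁ x)

    sep-side₂ : ∀ {st₁ st₂ : GlueV h₁ h₂ → Status} →
      (∀ u v → st₁ u ≡ new → st₂ v ≡ new → ¬ G u v) →
      ∀ u w → st₁ (side₂ u) ≡ new → st₂ (side₂ w) ≡ new → ¬ soloE h₂ u w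
    sep-side₂ h (inj₁ u) (inj₁ w) p q x = h _ _ p q x
    sep-side₂ h (inj₁ u) (inj₂ w) p q x = h _ _ p q x
    sep-side₂ h (inj₂ u) (inj₁ w) p q x = h _ _ p q x
    sep-side₂ h (inj₂ u) (inj₂ w) p q x = h _ _ p q (inj₂ x)

    blocked₁ : ∀ {st : GlueV h₁ h₂ → Status} v → (∀ w → st w ≡ new → ¬ G (side₁ v) w) →
      ∀ w → st (side₁ w) ≡ new → ¬ soloE h₁ v w
    blocked₁ (inj₁ u) h (inj₁ w) p x = h _ p x
    blocked₁ (inj₁ u) h (inj₂ w) p x = h _ p x
    blocked₁ (inj₂ u) h (inj₁ w) p x = h _ p x
    blocked₁ (inj₂ u) h (inj₂ w) p x = h _ p (inj₁ x)

    blocked₂ : ∀ {st : GlueV h₁ h₂ → Status} v → (∀ w → st w ≡ new → ¬ G (side₂ v) w) →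
      ∀ w → st (side₂ w) ≡ new → ¬ soloE h₂ v w
    blocked₂ (inj₁ u) h (inj₁ w) p x = h _ p x
    blocked₂ (inj₁ u) h (inj₂ w) p x = h _ p x
    blocked₂ (inj₂ u) h (inj₁ w) p x = h _ p x
    blocked₂ (inj₂ u) h (inj₂ w) p x = h _ p (inj₂ x)

    σ-step : ∀ {st st′ : GlueV h₁ h₂ → Status} {s} (σ : Vec Status r) t →
      (∀ t → st (inj₂ (inj₂ t)) ≡ lookup σ t) → Update st (inj₂ (inj₂ t)) s st′ →
      ∀ u → st′ (inj₂ (inj₂ u)) ≡ lookup (σ [ t ]≔ s) u
    σ-step {s = s} σ t e (p , q) u with u Fin.≟ t
    ... | yes refl = trans p (sym (Vec.lookup∘update t σ s))
    ... | no ne = trans (q _ λ { refl → ne refl }) (trans (e u) (sym (Vec.lookup∘update′ ne σ s)))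

    Distribute-resp : ∀ {a a′ b b′ d d′} → a ≡ a′ → b ≡ b′ → d ≡ d′ → Distribute a b d → Distribute a′ b′ d′
    Distribute-resp refl refl refl x = x

    Distribute-keep : ∀ {s s₁ s₂} → Distribute s s₁ s₂ → s₁ ≢ new → s₂ ≡ s
    Distribute-keep left ne = ⊥-elim (ne refl)
    Distribute-keep right ne = refl
    Distribute-keep current ne = refl
    Distribute-keep outside ne = refl

  private
    -- A branch without new boundary vertices decomposes the two sides independently.
    one-sided : ∀ {st st₁ st₂ : GlueV h₁ h₂ → Status} {s a b} (σ : Vec Status r) →
      (∀ v → Distribute (st v) (st₁ v) (st₂ v)) → (∀ u v → st₁ u ≡ new → st₂ v ≡ new → ¬ G u v) →
      (∀ t → st (inj₂ (inj₂ t)) ≡ lookup σ t) → (∀ t → st₁ (inj₂ (inj₂ t)) ≢ new) → a + b + s ≤ c →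
      Good G c st₁ (a + b + s) → Separation G st →
      Count (st ∘ inj₁) a → Count (st ∘ inj₂ ∘ inj₁) b → Count (lookup σ) s →
      Path σ s (joint (st ∘ inj₁) a (st ∘ inj₂ ∘ inj₁) b) (joint (st₂ ∘ inj₁) a (st₂ ∘ inj₂ ∘ inj₁) b)
    one-sided {st} {st₁} {st₂} {s} {a} {b} σ d h e nn le g sep n₁ n₂ nσ =
      step₁ z≤n z≤n le
        (discharge (st₁ ∘ side₁)
          (λ w → Distribute-resp (shares₁ st σ e w) (shares₁ st₂ σ e₂ w) refl (d̃ (side₁ w)))
          (λ u w p → sep-side₁ h̃ u w (trans (shares₁ st₂ σ e₂ u) p))
          (good-side₁ g sep₁ count₁ (count-split (d ∘ inj₁) n₁) countσ))
        (step₂ z≤n z≤n le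
          (discharge (st₁ ∘ side₂)
            (λ w → Distribute-resp (shares₂ st σ e w) (shares₂ st₂ σ e₂ w) refl (d̃ (side₂ w)))
            (λ u w p → sep-side₂ h̃ u w (trans (shares₂ st₂ σ e₂ u) p))
            (good-side₂ g sep₁ count₁ (count-split (λ v → d (inj₂ (inj₁ v))) n₂) countσ))
          (rest le (λ _ → refl) (λ _ → refl)))
      where
      d̃ = λ v → Distribute-sym (d v)
      h̃ : ∀ u v → st₂ u ≡ new → st₁ v ≡ new → ¬ G u v
      h̃ u v p q x = h v u q p (glueE-sym h₁ h₂ {u} {v} x)
      e₂ : ∀ t → st₂ (inj₂ (inj₂ t)) ≡ lookup σ t
      e₂ t = trans (Distribute-keep (d (inj₂ (inj₂ t))) (nn t)) (e t)
      nσ₀ : Count (st ∘ inj₂ ∘ inj₂) s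
      nσ₀ = count-resp (λ t → trans (e t)) (λ t → trans (sym (e t))) nσ
      countσ : Count (st₁ ∘ inj₂ ∘ inj₂) s
      countσ = count-split (λ t → d (inj₂ (inj₂ t))) nσ₀
      count₁ : Count st₁ (a + b + s)
      count₁ = count-split d (subst (Count st) (sym (ℕ.+-assoc a b s)) (count-local n₁ (count-local n₂ nσ₀)))
      sep₁ : Separation G st₁
      sep₁ = separation-split d h̃ sep

  to-tree : ∀ {st m σ s a b} → Good G c st m → (∀ t → st (inj₂ (inj₂ t)) ≡ lookup σ t) →
    m ≡ a + b + s → m ≤ c → Separation G st →
    Count (st ∘ inj₁) a → Count (st ∘ inj₂ ∘ inj₁) b → Count (lookup σ) s →
    Tree σ s (st ∘ inj₁) a (st ∘ inj₂ ∘ inj₁) b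
  to-tree {st} {σ = σ} (leaf h) e refl le sep n₁ n₂ nσ =
    stop (rest le (λ _ → refl) (λ _ → refl)) (λ t p → h _ (trans (e t) p))
      (leaf λ w p → h _ (trans (shares₁ st σ e w) p))
      (leaf λ w p → h _ (trans (shares₂ st σ e w) p))
  to-tree {σ = σ} {s} {a} {b} (intro (inj₁ v) p le′ up g) e refl le sep n₁ n₂ nσ =
    tree-prefix
      (step₁ z≤n z≤n le (intro v p up₁)
        (rest le′ (λ _ → refl) (λ w → sym (proj₂ up (inj₂ (inj₁ w)) λ ()))))
      (to-tree g (λ t → trans (proj₂ up (inj₂ (inj₂ t)) λ ()) (e t)) refl le′
        (separation-intro _≟g_ up sep) (count-intro (_≟ᵢ_ h₁) n₁ p up₁)
        (count-resp (λ w → trans (proj₂ up (inj₂ (inj₁ w)) λ ())) (λ w → trans (sym (proj₂ up (inj₂ (inj₁ w)) λ ()))) n₂) nσ)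
    where up₁ = proj₁ up , λ u ne → proj₂ up (inj₁ u) λ { refl → ne refl }
  to-tree {σ = σ} {s} {a} {b} (intro (inj₂ (inj₁ v)) p le′ up g) e refl le sep n₁ n₂ nσ =
    tree-prefix
      (step₂ z≤n z≤n le (intro v p up₂)
        (rest le″ (λ w → sym (proj₂ up (inj₁ w) λ ())) (λ _ → refl)))
      (to-tree g (λ t → trans (proj₂ up (inj₂ (inj₂ t)) λ ()) (e t)) (sym eq) le′
        (separation-intro _≟g_ up sep)
        (count-resp (λ w → trans (proj₂ up (inj₁ w) λ ())) (λ w → trans (sym (proj₂ up (inj₁ w) λ ()))) n₁)
        (count-intro (_≟ᵢ_ h₂) n₂ p up₂) nσ)
    where
    up₂ = proj₁ up , λ u ne → proj₂ up (inj₂ (inj₁ u)) λ { refl → ne refl }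
    eq : a + suc b + s ≡ suc (a + b + s)
    eq = cong (_+ s) (ℕ.+-suc a b)
    le″ : a + suc b + s ≤ c
    le″ = ℕ.≤-trans (ℕ.≤-reflexive eq) le′
  to-tree {σ = σ} {s} {a} {b} (intro (inj₂ (inj₂ t)) p le′ up g) e refl le sep n₁ n₂ nσ =
    enter (rest le (λ w → sym (proj₂ up (inj₁ w) λ ())) (λ w → sym (proj₂ up (inj₂ (inj₁ w)) λ ())))
      t p′ le′
      (to-tree g (σ-step σ t e up) (sym (ℕ.+-suc (a + b) s)) le′ (separation-intro _≟g_ up sep)
        (count-resp (λ w → trans (proj₂ up (inj₁ w) λ ())) (λ w → trans (sym (proj₂ up (inj₁ w) λ ()))) n₁)
        (count-resp (λ w → trans (proj₂ up (inj₂ (inj₁ w)) λ ())) (λ w → trans (sym (proj₂ up (inj₂ (inj₁ w)) λ ()))) n₂)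
        (count-intro Fin._≟_ nσ p′ (lookup-Update σ t cur)))
    where p′ = trans (sym (e t)) p
  to-tree {st} {σ = σ} {s} {a} {b} (forget (inj₁ v) p h up g) e eq le sep n₁ n₂ nσ = result
    where
    up₁ = proj₁ up , λ u ne → proj₂ up (inj₁ u) λ { refl → ne refl }
    result : Tree σ s _ a _ b
    result with count-forget (_≟ᵢ_ h₁) n₁ p up₁
    ... | a₁ , refl , n₁′ = tree-prefix
      (step₁ z≤n z≤n (subst (_≤ c) eq le)
        (forget v p (λ w q → blocked₁ (inj₁ v) h w (trans (shares₁ st σ e w) q)) up₁)
        (rest (ℕ.≤-trans (ℕ.≤-reflexive (sym (ℕ.suc-injective eq))) (ℕ.<⇒≤ le))
          (λ _ → refl) (λ w → sym (proj₂ up (inj₂ (inj₁ w)) λ ()))))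
      (to-tree g (λ t → trans (proj₂ up (inj₂ (inj₂ t)) λ ()) (e t)) (ℕ.suc-injective eq) (ℕ.<⇒≤ le)
        (separation-forget _≟g_ up h sep) n₁′
        (count-resp (λ w → trans (proj₂ up (inj₂ (inj₁ w)) λ ())) (λ w → trans (sym (proj₂ up (inj₂ (inj₁ w)) λ ()))) n₂) nσ)
  to-tree {st} {σ = σ} {s} {a} {b} (forget (inj₂ (inj₁ v)) p h up g) e eq le sep n₁ n₂ nσ = result
    where
    up₂ = proj₁ up , λ u ne → proj₂ up (inj₂ (inj₁ u)) λ { refl → ne refl }
    result : Tree σ s _ a _ b
    result with count-forget (_≟ᵢ_ h₂) n₂ p up₂
    ... | b₁ , refl , n₂′ = tree-prefix
      (step₂ z≤n z≤n (subst (_≤ c) eq le)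
        (forget v p (λ w q → blocked₂ (inj₁ v) h w (trans (shares₂ st σ e w) q)) up₂)
        (rest (ℕ.≤-trans (ℕ.≤-reflexive (sym eq′)) (ℕ.<⇒≤ le))
          (λ w → sym (proj₂ up (inj₁ w) λ ())) (λ _ → refl)))
      (to-tree g (λ t → trans (proj₂ up (inj₂ (inj₂ t)) λ ()) (e t)) eq′ (ℕ.<⇒≤ le)
        (separation-forget _≟g_ up h sep)
        (count-resp (λ w → trans (proj₂ up (inj₁ w) λ ())) (λ w → trans (sym (proj₂ up (inj₁ w) λ ()))) n₁)
        n₂′ nσ)
      where eq′ = ℕ.suc-injective (trans eq (cong (_+ s) (ℕ.+-suc a b₁)))
  to-tree {σ = σ} {s} {a} {b} (forget (inj₂ (inj₂ t)) p h up g) e eq le sep n₁ n₂ nσ = result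
    where
    p′ = trans (sym (e t)) p
    result : Tree σ s _ a _ b
    result with count-forget Fin._≟_ nσ p′ (lookup-Update σ t old)
    ... | s₁ , refl , nσ′ = leave
      (rest (subst (_≤ c) eq le) (λ w → sym (proj₂ up (inj₁ w) λ ())) (λ w → sym (proj₂ up (inj₂ (inj₁ w)) λ ())))
      t p′
      (λ w q → blocked₁ (inj₂ t) h w (trans (same₁ w) q))
      (λ w q → blocked₂ (inj₂ t) h w (trans (same₂ w) q))
      (to-tree g (σ-step σ t e up) (ℕ.suc-injective (trans eq (ℕ.+-suc (a + b) s₁))) (ℕ.<⇒≤ le)
        (separation-forget _≟g_ up h sep)
        (count-resp (λ w → trans (proj₂ up (inj₁ w) λ ())) (λ w → trans (sym (proj₂ up (inj₁ w) λ ()))) n₁)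
        (count-resp (λ w → trans (proj₂ up (inj₂ (inj₁ w)) λ ())) (λ w → trans (sym (proj₂ up (inj₂ (inj₁ w)) λ ()))) n₂)
        nσ′)
      where
      same₁ : ∀ w → _ ≡ local h₁ _ σ w
      same₁ (inj₁ w) = sym (proj₂ up (inj₁ w) λ ())
      same₁ (inj₂ t) = e t
      same₂ : ∀ w → _ ≡ local h₂ _ σ w
      same₂ (inj₁ w) = sym (proj₂ up (inj₂ (inj₁ w)) λ ())
      same₂ (inj₂ t) = e t
  to-tree {st = st} {m} {σ = σ} {s} {a} {b} (split {st₁ = st₁} {st₂} d h g₁ g₂) e refl le sep n₁ n₂ nσ
    -- Only a split that distributes `new` boundary vertices to both branches has to show up in the
    -- protocol; any other one is absorbed into the path.
    with Fin.any? (λ t → st₁ (inj₂ (inj₂ t)) ≟ₛ new) | Fin.any? (λ t → st₂ (inj₂ (inj₂ t)) ≟ₛ new)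
  ... | yes (t₁ , p₁) | yes (t₂ , p₂) =
    fork {σ₁ = σ₁} {σ₂} (rest le (λ _ → refl) (λ _ → refl)) (t₁ , trans (sym (e₁ t₁)) p₁) (t₂ , trans (sym (e₂ t₂)) p₂)
      (λ w → Distribute-resp (shares₁ st σ e w) (shares₁ st₁ σ₁ e₁ w) (shares₁ st₂ σ₂ e₂ w) (d (side₁ w)))
      (λ u w p q → sep-side₁ h u w (trans (shares₁ st₁ σ₁ e₁ u) p) (trans (shares₁ st₂ σ₂ e₂ w) q))
      (λ w → Distribute-resp (shares₂ st σ e w) (shares₂ st₁ σ₁ e₁ w) (shares₂ st₂ σ₂ e₂ w) (d (side₂ w)))
      (λ u w p q → sep-side₂ h u w (trans (shares₂ st₁ σ₁ e₁ u) p) (trans (shares₂ st₂ σ₂ e₂ w) q))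
      (to-tree g₁ e₁ refl le (separation-split d h̃ sep) (count-split (d ∘ inj₁) n₁)
        (count-split (λ v → d (inj₂ (inj₁ v))) n₂) (count-split dσ nσ))
      (to-tree g₂ e₂ refl le (separation-split d̃ h sep) (count-split (d̃ ∘ inj₁) n₁)
        (count-split (λ v → d̃ (inj₂ (inj₁ v))) n₂) (count-split (Distribute-sym ∘ dσ) nσ))
    where
    d̃ = λ v → Distribute-sym (d v)
    h̃ : ∀ u v → st₂ u ≡ new → st₁ v ≡ new → ¬ G u v
    h̃ u v p q x = h v u q p (glueE-sym h₁ h₂ {u} {v} x)
    σ₁ = Vec.tabulate (λ t → st₁ (inj₂ (inj₂ t)))
    σ₂ = Vec.tabulate (λ t → st₂ (inj₂ (inj₂ t)))
    e₁ : ∀ t → st₁ (inj₂ (inj₂ t)) ≡ lookup σ₁ t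
    e₁ t = sym (Vec.lookup∘tabulate _ t)
    e₂ : ∀ t → st₂ (inj₂ (inj₂ t)) ≡ lookup σ₂ t
    e₂ t = sym (Vec.lookup∘tabulate _ t)
    dσ : ∀ t → Distribute (lookup σ t) (lookup σ₁ t) (lookup σ₂ t)
    dσ t = Distribute-resp (e t) (e₁ t) (e₂ t) (d (inj₂ (inj₂ t)))
  ... | no none | _ = tree-prefix (one-sided σ d h e (λ t p → none (t , p)) le g₁ sep n₁ n₂ nσ)
          (to-tree g₂ (λ t → trans (Distribute-keep (d (inj₂ (inj₂ t))) λ p → none (t , p)) (e t)) refl le
            (separation-split d̃ h sep) (count-split (d̃ ∘ inj₁) n₁)
            (count-split (λ v → d̃ (inj₂ (inj₁ v))) n₂) nσ)
    where d̃ = λ v → Distribute-sym (d v)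
  ... | yes _ | no none = tree-prefix (one-sided σ d̃ h̃ e (λ t p → none (t , p)) le g₂ sep n₁ n₂ nσ)
          (to-tree g₁ (λ t → trans (Distribute-keep (d̃ (inj₂ (inj₂ t))) λ p → none (t , p)) (e t)) refl le
            (separation-split d h̃ sep) (count-split (d ∘ inj₁) n₁)
            (count-split (λ v → d (inj₂ (inj₁ v))) n₂) nσ)
    where
    d̃ = λ v → Distribute-sym (d v)
    h̃ : ∀ u v → st₂ u ≡ new → st₁ v ≡ new → ¬ G u v
    h̃ u v p q x = h v u q p (glueE-sym h₁ h₂ {u} {v} x)

-- At most μ boundary steps follow one another. Each costs one constructor and is preceded by at
-- most `segment c` runs; a last segment and `stop` remain.
protoDepth : ℕ → ℕ → ℕ
protoDepth c zero = segment c + 1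
protoDepth c (suc μ) = segment c + suc (protoDepth c μ)

protoDepth-positive : ∀ c μ → segment c + 1 ≤ protoDepth c μ
protoDepth-positive c zero = ℕ.≤-refl
protoDepth-positive c (suc μ) = ℕ.+-monoʳ-≤ (segment c) (s≤s z≤n)

potential-max : ∀ {r} (σ : Vec Status r) → potential σ ≤ r * 2
potential-max Vec.[] = z≤n
potential-max (s Vec.∷ σ) = ℕ.+-mono-≤ (le s) (potential-max σ)
  where
  le : ∀ s → weight s ≤ 2
  le new = ℕ.≤-refl
  le cur = s≤s z≤n
  le old = z≤n

protocols : ∀ r → ℕ → List (Proto r)
protocols r c = protos r c (protoDepth c (r * 2))

allNew : ∀ r → Vec Status r
allNew r = Vec.replicate r new

lookup-allNew : ∀ {r} t → lookup (allNew r) t ≡ new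
lookup-allNew t = Vec.lookup-replicate t new

module _ {r : ℕ} (c : ℕ) (h₁ h₂ : Half r) where
  private
    Common : ℕ → Vec Status r → ℕ → (Inner h₁ → Status) → ℕ → (Inner h₂ → Status) → ℕ → Set
    Common d σ s α a β b = Σ (Proto r) λ p → Bounded c d p ×
      Impl c h₁ true p σ s α a b × Impl c h₂ false p σ s β b a

    decrease : ∀ {x y μ} → x < y → y ≤ μ → Σ ℕ λ μ′ → (μ ≡ suc μ′) × (x ≤ μ′)
    decrease {μ = suc μ′} lt (s≤s le) = μ′ , refl , ℕ.≤-pred (ℕ.≤-trans lt (s≤s le))
    decrease {μ = zero} lt z≤n = case lt of λ ()

    tree-proto : ∀ {σ s α a β b} μ → potential σ ≤ μ → Tree c h₁ h₂ σ s α a β b →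
      Common (protoDepth c μ) σ s α a β b
    tree-proto μ le (stop j nσ g₁ g₂) with dealternate-all c h₁ h₂ j (stop {d = 0}) (stop nσ g₁) (stop nσ g₂)
    ... | p , bd , i₁ , i₂ = p , bounded-mono (protoDepth-positive c μ) bd , i₁ , i₂
    tree-proto {σ = σ} μ le (enter {a′ = a′} {b′ = b′} j t e cap T)
      with decrease (potential-update σ t {s′ = cur} e (s≤s (s≤s z≤n))) le
    ... | μ′ , refl , le′ with tree-proto μ′ le′ T
    ... | p , bd , i₁ , i₂ = dealternate-all c h₁ h₂ j (enter bd) (enter t e cap i₁)
      (enter t e (ℕ.≤-trans (ℕ.≤-reflexive (cong suc (+-swap₁₂ b′ a′ _))) cap) i₂)
    tree-proto {σ = σ} μ le (leave j t e x y T) with decrease (potential-update σ t {s′ = old} e (s≤s z≤n)) le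
    ... | μ′ , refl , le′ with tree-proto μ′ le′ T
    ... | p , bd , i₁ , i₂ = dealternate-all c h₁ h₂ j (leave bd) (leave t e x i₁) (leave t e y i₂)
    tree-proto {σ = σ} μ le (fork {σ₁ = σ₁} {σ₂} j (t₁ , p₁) (t₂ , p₂) d₁ x₁ d₂ x₂ T₁ T₂)
      with decrease (potential-strict σ σ₁ (λ t → Distribute-weight (d₁ (inj₂ t))) t₂
             (Distribute-weight-< (d₁ (inj₂ t₂)) p₂)) le
         | decrease (potential-strict σ σ₂ (λ t → Distribute-weight (Distribute-sym (d₁ (inj₂ t)))) t₁
             (Distribute-weight-< (Distribute-sym (d₁ (inj₂ t₁))) p₁)) le
    ... | μ′ , refl , le₁ | .μ′ , refl , le₂ with tree-proto μ′ le₁ T₁ | tree-proto μ′ le₂ T₂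
    ... | p , bp , i₁ , i₂ | q , bq , k₁ , k₂ =
      dealternate-all c h₁ h₂ j (fork bp bq) (fork d₁ x₁ i₁ k₁) (fork d₂ x₂ i₂ k₂)

  impl-complete : ∀ {α β} → (∀ v → α v ≢ cur) → (∀ v → β v ≢ cur) →
    Separation (glueE h₁ h₂) (glued h₁ h₂ α β (lookup (allNew r))) →
    Good (glueE h₁ h₂) c (glued h₁ h₂ α β (lookup (allNew r))) 0 →
    Σ (Proto r) λ p → (p ∈ protocols r c) ×
      Impl c h₁ true p (allNew r) 0 α 0 0 × Impl c h₂ false p (allNew r) 0 β 0 0
  impl-complete nα nβ sep g with tree-proto (r * 2) (potential-max (allNew r))
    (to-tree c h₁ h₂ g (λ _ → refl) refl z≤n sep (count-empty nα) (count-empty nβ)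
      (count-empty λ t e → case trans (sym (lookup-allNew t)) e of λ ()))
  ... | p , bd , i₁ , i₂ = p , ∈-protos bd , i₁ , i₂

-- Separations and a form of Menger's theorem

-- The order in which a status advances along a branch, `new` before `cur` before `old`. Pointwise
-- it is the nesting of separations.
data _⊑ₛ_ : Status → Status → Set where
  new⊑ : ∀ {s} → new ⊑ₛ s
  cur⊑cur : cur ⊑ₛ cur
  cur⊑old : cur ⊑ₛ old
  old⊑old : old ⊑ₛ old

⊑ₛ-refl : ∀ {s} → s ⊑ₛ s
⊑ₛ-refl {new} = new⊑
⊑ₛ-refl {cur} = cur⊑cur
⊑ₛ-refl {old} = old⊑old

⊑ₛ-trans : ∀ {s t u} → s ⊑ₛ t → t ⊑ₛ u → s ⊑ₛ u
⊑ₛ-trans new⊑ _ = new⊑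
⊑ₛ-trans cur⊑cur q = q
⊑ₛ-trans cur⊑old old⊑old = cur⊑old
⊑ₛ-trans old⊑old q = q

⊑ₛ-new : ∀ {s t} → s ⊑ₛ t → t ≡ new → s ≡ new
⊑ₛ-new new⊑ refl = refl

⊑ₛ-old : ∀ {s t} → s ⊑ₛ t → s ≡ old → t ≡ old
⊑ₛ-old old⊑old refl = refl

⊑cur : ∀ {s} → s ≢ old → s ⊑ₛ cur
⊑cur {new} ne = new⊑
⊑cur {cur} ne = cur⊑cur
⊑cur {old} ne = ⊥-elim (ne refl)

cur⊑ : ∀ {s} → s ≢ new → cur ⊑ₛ s
cur⊑ {new} ne = ⊥-elim (ne refl)
cur⊑ {cur} ne = cur⊑cur
cur⊑ {old} ne = cur⊑old

Distribute-⊑ : ∀ {s s₁ s₂} → Distribute s s₁ s₂ → s ⊑ₛ s₁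
Distribute-⊑ left = new⊑
Distribute-⊑ right = new⊑
Distribute-⊑ current = cur⊑cur
Distribute-⊑ outside = old⊑old

tally : ∀ {A : Set} {P : A → Set} → (∀ x → Dec (P x)) → List A → ℕ
tally P? xs = length (filter P? xs)

tally-mono : ∀ {A : Set} {P Q : A → Set} (P? : ∀ x → Dec (P x)) (Q? : ∀ x → Dec (Q x)) →
  (∀ x → P x → Q x) → ∀ xs → tally P? xs ≤ tally Q? xs
tally-mono P? Q? h [] = z≤n
tally-mono P? Q? h (x ∷ xs) with P? x | Q? x
... | yes p | yes q = s≤s (tally-mono P? Q? h xs)
... | yes p | no q  = ⊥-elim (q (h x p))
... | no p  | yes q = ℕ.m≤n⇒m≤1+n (tally-mono P? Q? h xs)
... | no p  | no q  = tally-mono P? Q? h xs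

tally-strict : ∀ {A : Set} {P Q : A → Set} (P? : ∀ x → Dec (P x)) (Q? : ∀ x → Dec (Q x)) →
  (∀ x → P x → Q x) → ∀ {xs x} → x ∈ xs → ¬ P x → Q x → tally P? xs < tally Q? xs
tally-strict P? Q? h {x ∷ xs} (here refl) np q with P? x | Q? x
... | yes p | _ = ⊥-elim (np p)
... | no _ | no nq = ⊥-elim (nq q)
... | no _ | yes _ = s≤s (tally-mono P? Q? h xs)
tally-strict P? Q? h {x ∷ xs} (there x∈) np q with P? x | Q? x
... | yes p | yes q′ = s≤s (tally-strict P? Q? h x∈ np q)
... | yes p | no q′  = ⊥-elim (q′ (h x p))
... | no p  | yes q′ = ℕ.m≤n⇒m≤1+n (tally-strict P? Q? h x∈ np q)
... | no p  | no q′  = tally-strict P? Q? h x∈ np q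

module _ {N : ℕ} where
  St : Set
  St = Fin N → Status

  Rel : Set
  Rel = Fin N → Fin N → Bool

  ⟦_⟧ : Rel → Fin N → Fin N → Set
  ⟦ E ⟧ u v = E u v ≡ true

  _⊑_ : St → St → Set
  st ⊑ st′ = ∀ v → st v ⊑ₛ st′ v

  members : Status → St → List (Fin N)
  members s st = filter (λ v → st v ≟ₛ s) (allFin N)

  size : Status → St → ℕ
  size s st = length (members s st)

  ∈-members⁺ : ∀ {s} st v → st v ≡ s → v ∈ members s st
  ∈-members⁺ {s} st v e = ∈.∈-filter⁺ (λ v → st v ≟ₛ s) (∈.∈-allFin v) e

  ∈-members⁻ : ∀ {s} st v → v ∈ members s st → st v ≡ s
  ∈-members⁻ {s} st v v∈ = proj₂ (∈.∈-filter⁻ (λ v → st v ≟ₛ s) {xs = allFin N} v∈)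

  members-unique : ∀ s st → Unique (members s st)
  members-unique s st = Unique.filter⁺ (λ v → st v ≟ₛ s) (Unique.allFin⁺ N)

  size-insert : ∀ {s} st st′ v → (∀ u → st′ u ≡ s → u ≢ v → st u ≡ s) → size s st′ ≤ suc (size s st)
  size-insert {s} st st′ v h = unique-⊆-length (members-unique s st′) sub
    where
    sub : ∀ u → u ∈ members s st′ → u ∈ v ∷ members s st
    sub u u∈ with u Fin.≟ v
    ... | yes e = here e
    ... | no ne = there (∈-members⁺ st u (h u (∈-members⁻ st′ u u∈) ne))

  size-full : ∀ {s} st st′ → size s st′ ≤ size s st → (∀ v → st v ≡ s → st′ v ≡ s) →
    ∀ v → st′ v ≡ s → st v ≡ s
  size-full {s} st st′ le h v e with st v ≟ₛ s
  ... | yes e′ = e′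
  ... | no ne = ⊥-elim (ℕ.<-irrefl refl (ℕ.≤-trans
    (tally-strict (λ v → st v ≟ₛ s) (λ v → st′ v ≟ₛ s) h (∈.∈-allFin v) ne e) le))

  -- A system of disjoint paths, swept from st to st′: the bag marks the current ends of the paths.
  data Link (E : Rel) : St → St → Set where
    stop  : ∀ {st st′} → st ≗ st′ → Link E st st′
    token : ∀ {st st₁ st₂ st′} x y → ⟦ E ⟧ x y → st x ≡ cur → st y ≡ new →
            Update st x old st₁ → Update st₁ y cur st₂ → Link E st₂ st′ → Link E st st′
    drop  : ∀ {st st₁ st′} v → st v ≡ new → Update st v old st₁ → Link E st₁ st′ → Link E st st′

  link-resp : ∀ {E st st₀ st′} → st ≗ st₀ → Link E st st′ → Link E st₀ st′
  link-resp e (stop e′) = stop λ v → trans (sym (e v)) (e′ v)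
  link-resp e (token x y xy p q u₁ u₂ L) =
    token x y xy (trans (sym (e x)) p) (trans (sym (e y)) q) (Update-resp e u₁) u₂ L
  link-resp e (drop v p u L) = drop v (trans (sym (e v)) p) (Update-resp e u) L

  link-trans : ∀ {E st st₁ st₂} → Link E st st₁ → Link E st₁ st₂ → Link E st st₂
  link-trans (stop e) K = link-resp (sym ∘ e) K
  link-trans (token x y xy p q u₁ u₂ L) K = token x y xy p q u₁ u₂ (link-trans L K)
  link-trans (drop v p u L) K = drop v p u (link-trans L K)

  link-mono : ∀ {E E′ st st′} → (∀ {u v} → ⟦ E ⟧ u v → ⟦ E′ ⟧ u v) → Link E st st′ → Link E′ st st′
  link-mono h (stop e) = stop e
  link-mono h (token x y xy p q u₁ u₂ L) = token x y (h xy) p q u₁ u₂ (link-mono h L)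
  link-mono h (drop v p u L) = drop v p u (link-mono h L)

  link-drops : ∀ {E} st st′ vs → (∀ v → st v ≡ st′ v ⊎ (st v ≡ new × st′ v ≡ old × v ∈ vs)) → Link E st st′
  link-drops st st′ [] h = stop λ v → case h v of λ { (inj₁ e) → e ; (inj₂ (_ , _ , ())) }
  link-drops st st′ (v ∷ vs) h with h v
  ... | inj₁ e = link-drops st st′ vs λ u → case h u of λ
    { (inj₁ e) → inj₁ e
    ; (inj₂ (p , q , here refl)) → inj₁ e
    ; (inj₂ (p , q , there u∈)) → inj₂ (p , q , u∈) }
  ... | inj₂ (p , q , _) = drop v p up (link-drops st₁ st′ vs rest)
    where
    st₁ = update Fin._≟_ st v old
    up = update-Update Fin._≟_ st v old
    rest : ∀ u → st₁ u ≡ st′ u ⊎ (st₁ u ≡ new × st′ u ≡ old × u ∈ vs)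
    rest u with u Fin.≟ v
    ... | yes refl = inj₁ (sym q)
    ... | no ne with h u
    ...   | inj₁ e = inj₁ e
    ...   | inj₂ (p′ , q′ , here e) = ⊥-elim (ne e)
    ...   | inj₂ (p′ , q′ , there u∈) = inj₂ (p′ , q′ , u∈)

  isEdge : Fin N → Fin N → Rel
  isEdge x y u v = (⌊ u Fin.≟ x ⌋ ∧ ⌊ v Fin.≟ y ⌋) ∨ (⌊ u Fin.≟ y ⌋ ∧ ⌊ v Fin.≟ x ⌋)

  delete : Rel → Fin N → Fin N → Rel
  delete E x y u v = E u v ∧ not (isEdge x y u v)

  delete-⊆ : ∀ E x y {u v} → ⟦ delete E x y ⟧ u v → ⟦ E ⟧ u v
  delete-⊆ E x y {u} {v} e with E u v
  ... | true = refl

  delete-old : ∀ E x y → delete E x y x y ≢ true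
  delete-old E x y e with x Fin.≟ x | y Fin.≟ y
  ... | no ne | _ = ne refl
  ... | yes _ | no ne = ne refl
  delete-old E x y e | yes _ | yes _ with E x y
  delete-old E x y () | yes _ | yes _ | true
  delete-old E x y () | yes _ | yes _ | false

  delete-flipped : ∀ E x y → delete E x y y x ≢ true
  delete-flipped E x y e with x Fin.≟ x | y Fin.≟ y
  ... | no ne | _ = ne refl
  ... | yes _ | no ne = ne refl
  delete-flipped E x y e | yes _ | yes _ with E y x | ⌊ y Fin.≟ x ⌋ ∧ ⌊ x Fin.≟ y ⌋
  delete-flipped E x y () | yes _ | yes _ | true | true
  delete-flipped E x y () | yes _ | yes _ | true | false
  delete-flipped E x y () | yes _ | yes _ | false | _

  delete-other : ∀ E x y {u v} → ⟦ E ⟧ u v → ⟦ delete E x y ⟧ u v ⊎ (u ≡ x × v ≡ y) ⊎ (u ≡ y × v ≡ x)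
  delete-other E x y {u} {v} e rewrite e with u Fin.≟ x | v Fin.≟ y
  ... | yes p | yes q = inj₂ (inj₁ (p , q))
  ... | yes p | no q with u Fin.≟ y | v Fin.≟ x
  ...   | yes p′ | yes q′ = inj₂ (inj₂ (p′ , q′))
  ...   | yes _ | no _ = inj₁ refl
  ...   | no _ | _ = inj₁ refl
  delete-other E x y {u} {v} e | no p | _ with u Fin.≟ y | v Fin.≟ x
  ...   | yes p′ | yes q′ = inj₂ (inj₂ (p′ , q′))
  ...   | yes _ | no _ = inj₁ refl
  ...   | no _ | _ = inj₁ refl

  delete-sym : ∀ {E} x y → Symmetric ⟦ E ⟧ → Symmetric ⟦ delete E x y ⟧
  delete-sym {E} x y E-sym {u} {v} e with delete-other E x y (E-sym (delete-⊆ E x y {u} {v} e))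
  ... | inj₁ e′ = e′
  ... | inj₂ (inj₁ (refl , refl)) = ⊥-elim (delete-flipped E v u e)
  ... | inj₂ (inj₂ (refl , refl)) = ⊥-elim (delete-old E u v e)

  Region : St → St → Fin N → Set
  Region st₀ st₁ v = st₀ v ≢ old × st₁ v ≢ new

  RegionEdge : Rel → St → St → Fin N × Fin N → Set
  RegionEdge E st₀ st₁ (x , y) = ⟦ E ⟧ x y × Region st₀ st₁ x × Region st₀ st₁ y

  regionEdge? : ∀ E st₀ st₁ p → Dec (RegionEdge E st₀ st₁ p)
  regionEdge? E st₀ st₁ (x , y) = (E x y Bool.≟ true) ×-dec region? x ×-dec region? y
    where
    region? : ∀ v → Dec (Region st₀ st₁ v)
    region? v = ¬? (st₀ v ≟ₛ old) ×-dec ¬? (st₁ v ≟ₛ new)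

  pairs : List (Fin N × Fin N)
  pairs = List.cartesianProduct (allFin N) (allFin N)

  ∈-pairs : ∀ x y → (x , y) ∈ pairs
  ∈-pairs x y = ∈.∈-cartesianProduct⁺ (∈.∈-allFin x) (∈.∈-allFin y)

  Tight : Rel → ℕ → St → St → Set
  Tight E r st₀ st₁ = ∀ st → Separation ⟦ E ⟧ st → st₀ ⊑ st → st ⊑ st₁ → r ≤ size cur st

  module _ {r : ℕ} where
    -- Induction on the edges between st₀ and st₁: if deleting xy creates a smaller separation,
    -- then adding x or y to it gives two separations of order r, and the token moves along xy.
    menger : ∀ k {E st₀ st₁} → Symmetric ⟦ E ⟧ → tally (regionEdge? E st₀ st₁) pairs < k →
      Separation ⟦ E ⟧ st₀ → Separation ⟦ E ⟧ st₁ → st₀ ⊑ st₁ → size cur st₀ ≡ r → size cur st₁ ≡ r →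
      Tight E r st₀ st₁ → DN (Link E st₀ st₁)
    menger (suc k) {E} {st₀} {st₁} E-sym (s≤s lt) sep₀ sep₁ le n₀ n₁ tight
      with Any.any? (regionEdge? E st₀ st₁) pairs
    ... | no none = pure (link-drops st₀ st₁ (allFin N) λ v → compare v)
      where
      noEdge : ∀ {x y} → ⟦ E ⟧ x y → Region st₀ st₁ x → Region st₀ st₁ y → ⊥
      noEdge {x} {y} e p q = none (lose (∈-pairs x y) (e , p , q))
      cur-stays : ∀ v → st₀ v ≡ cur → st₁ v ≡ cur
      cur-stays v e with st₁ v in e₁
      ... | cur = refl
      ... | new = case trans (sym e) (⊑ₛ-new (le v) e₁) of λ ()
      -- Otherwise making v alone `old` in `st₀` would give a separation of order below r: an edge
      -- from v to a vertex w that is `new` in `st₀` either lies in the region or contradicts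
      -- `sep₁`.
      ... | old = ⊥-elim (ℕ.<-irrefl refl (ℕ.≤-trans
            (tally-strict (λ u → st u ≟ₛ cur) (λ u → st₀ u ≟ₛ cur) cur⁻ (∈.∈-allFin v)
              (λ p → case trans (sym (proj₁ up)) p of λ ()) e)
            (ℕ.≤-trans (ℕ.≤-reflexive n₀) (tight st sep (λ u → above u) (λ u → below u)))))
        where
        st = update Fin._≟_ st₀ v old
        up = update-Update Fin._≟_ st₀ v old
        cur⁻ : ∀ u → st u ≡ cur → st₀ u ≡ cur
        cur⁻ u p with u Fin.≟ v
        ... | no _ = p
        above : st₀ ⊑ st
        above u with u Fin.≟ v
        ... | yes refl rewrite e = cur⊑old
        ... | no _ = ⊑ₛ-refl
        below : st ⊑ st₁
        below u with u Fin.≟ v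
        ... | yes refl rewrite e₁ = old⊑old
        ... | no _ = le u
        sep : Separation ⟦ E ⟧ st
        sep = separation-forget Fin._≟_ up (λ w ew vw → noEdge vw
          ((λ p → case trans (sym e) p of λ ()) , (λ p → case trans (sym e₁) p of λ ()))
          ((λ p → case trans (sym ew) p of λ ()) , (λ p → sep₁ v w e₁ p vw))) sep₀
      cur-came : ∀ v → st₁ v ≡ cur → st₀ v ≡ cur
      cur-came = size-full st₀ st₁ (ℕ.≤-reflexive (trans n₁ (sym n₀))) cur-stays
      compare : ∀ v → st₀ v ≡ st₁ v ⊎ (st₀ v ≡ new × st₁ v ≡ old × v ∈ allFin N)
      compare v with st₀ v in e₀ | st₁ v in e₁ | le v
      ... | new | new | _ = inj₁ refl
      ... | new | cur | _ = case trans (sym e₀) (cur-came v e₁) of λ ()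
      ... | new | old | _ = inj₂ (refl , refl , ∈.∈-allFin v)
      ... | cur | cur | _ = inj₁ refl
      ... | cur | old | _ = case trans (sym e₁) (cur-stays v e₀) of λ ()
      ... | old | old | _ = inj₁ refl
    ... | yes some with find some
    ...   | (x , y) , _ , xy , rx , ry = do
      yes (st , sep , above , below , small) ← lem (Σ St λ st →
            Separation ⟦ delete E x y ⟧ st × st₀ ⊑ st × st ⊑ st₁ × size cur st < r)
        where no none → do
                L ← menger k {delete E x y} (delete-sym {E} x y E-sym)
                      (ℕ.≤-trans (tally-strict (regionEdge? (delete E x y) st₀ st₁) (regionEdge? E st₀ st₁)
                        (λ { (u , v) (e , p) → delete-⊆ E x y {u} {v} e , p }) (∈-pairs x y)
                        (λ { (e , _) → delete-old E x y e }) (xy , rx , ry)) lt)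
                      (λ u v p q e → sep₀ u v p q (delete-⊆ E x y {u} {v} e))
                      (λ u v p q e → sep₁ u v p q (delete-⊆ E x y {u} {v} e)) le n₀ n₁
                      (λ st sep p q → ℕ.≮⇒≥ λ l → none (st , sep , p , q , l))
                pure (link-mono (λ {u} {v} → delete-⊆ E x y {u} {v}) L)
      between st sep above below small (crossing st sep above below small)
      where
      crossing : ∀ st → Separation ⟦ delete E x y ⟧ st → st₀ ⊑ st → st ⊑ st₁ → size cur st < r →
        (st x ≡ old × st y ≡ new) ⊎ (st y ≡ old × st x ≡ new)
      crossing st sep above below small with (st x ≟ₛ old) ×-dec (st y ≟ₛ new) | (st y ≟ₛ old) ×-dec (st x ≟ₛ new)
      ... | yes p | _ = inj₁ p
      ... | no _ | yes q = inj₂ q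
      ... | no p | no q = ⊥-elim (ℕ.<⇒≱ small (tight st sepE above below))
        where
        sepE : Separation ⟦ E ⟧ st
        sepE u v eu ev uv with delete-other E x y uv
        ... | inj₁ e = sep u v eu ev e
        ... | inj₂ (inj₁ (refl , refl)) = p (eu , ev)
        ... | inj₂ (inj₂ (refl , refl)) = q (eu , ev)
      via : ∀ st → Separation ⟦ delete E x y ⟧ st → st₀ ⊑ st → st ⊑ st₁ → size cur st < r →
        ∀ a b → ⟦ E ⟧ a b → Region st₀ st₁ a → Region st₀ st₁ b →
        (∀ {u v} → ⟦ E ⟧ u v → ⟦ delete E x y ⟧ u v ⊎ (u ≡ a × v ≡ b) ⊎ (u ≡ b × v ≡ a)) →
        st a ≡ old → st b ≡ new → DN (Link E st₀ st₁)
      via st sep above below small a b ab ra rb cross ea eb = do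
        -- The edge ab lies in neither smaller region, since b is `new` in `sta` and a is `old` in
        -- `stb`; this pays for both recursive calls.
        L ← menger k E-sym (ℕ.≤-trans (tally-strict (regionEdge? E st₀ sta) (regionEdge? E st₀ st₁)
              (λ { (u , v) (e , (p , q) , p′ , q′) → e , (p , λ z → q (⊑ₛ-new (sta⊑st₁ u) z)) ,
                   p′ , λ z → q′ (⊑ₛ-new (sta⊑st₁ v) z) }) (∈-pairs a b)
              (λ { (_ , _ , _ , q) → q (trans (proj₂ upa b b≢a) eb) }) (ab , ra , rb)) lt)
              sep₀ sepa st₀⊑sta n₀ na (λ st′ s p q → tight st′ s p λ v → ⊑ₛ-trans (q v) (sta⊑st₁ v))
        K ← menger k E-sym (ℕ.≤-trans (tally-strict (regionEdge? E stb st₁) (regionEdge? E st₀ st₁)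
              (λ { (u , v) (e , (p , q) , p′ , q′) → e , ((λ z → p (⊑ₛ-old (st₀⊑stb u) z)) , q) ,
                   (λ z → p′ (⊑ₛ-old (st₀⊑stb v) z)) , q′ }) (∈-pairs a b)
              (λ { (_ , (p , _) , _) → p (trans (proj₂ upb a (b≢a ∘ sym)) ea) }) (ab , ra , rb)) lt)
              sepb sep₁ stb⊑st₁ nb n₁ (λ st′ s p q → tight st′ s (λ v → ⊑ₛ-trans (st₀⊑stb v) (p v)) q)
        pure (link-trans L (token a b ab (proj₁ upa) (trans (proj₂ upa b b≢a) eb) upm upm′ K))
        where
        sta = update Fin._≟_ st a cur
        stb = update Fin._≟_ st b cur
        upa = update-Update Fin._≟_ st a cur
        upb = update-Update Fin._≟_ st b cur
        stm = update Fin._≟_ sta a old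
        upm = update-Update Fin._≟_ sta a old
        b≢a : b ≢ a
        b≢a refl = case trans (sym ea) eb of λ ()
        stm≗st : ∀ u → stm u ≡ st u
        stm≗st u with u Fin.≟ a
        ... | yes refl = sym ea
        ... | no ne = proj₂ upa u ne
        upm′ : Update stm b cur stb
        upm′ = proj₁ upb , λ u ne → trans (proj₂ upb u ne) (sym (stm≗st u))
        sta⊑st : sta ⊑ st
        sta⊑st u with u Fin.≟ a
        ... | yes refl rewrite ea = cur⊑old
        ... | no _ = ⊑ₛ-refl
        sta⊑st₁ : sta ⊑ st₁
        sta⊑st₁ u = ⊑ₛ-trans (sta⊑st u) (below u)
        st₀⊑sta : st₀ ⊑ sta
        st₀⊑sta u with u Fin.≟ a
        ... | yes refl = ⊑cur (proj₁ ra)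
        ... | no _ = above u
        st⊑stb : st ⊑ stb
        st⊑stb u with u Fin.≟ b
        ... | yes refl rewrite eb = new⊑
        ... | no _ = ⊑ₛ-refl
        st₀⊑stb : st₀ ⊑ stb
        st₀⊑stb u = ⊑ₛ-trans (above u) (st⊑stb u)
        stb⊑st₁ : stb ⊑ st₁
        stb⊑st₁ u with u Fin.≟ b
        ... | yes refl = cur⊑ (proj₂ rb)
        ... | no _ = below u
        sepa : Separation ⟦ E ⟧ sta
        sepa u v eu ev uv with u Fin.≟ a | v Fin.≟ a
        ... | yes refl | _ = case eu of λ ()
        ... | no _ | yes _ = case ev of λ ()
        ... | no nu | no nv with cross uv
        ...   | inj₁ e = sep u v eu ev e
        ...   | inj₂ (inj₁ (p , _)) = nu p
        ...   | inj₂ (inj₂ (_ , p)) = nv p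
        sepb : Separation ⟦ E ⟧ stb
        sepb u v eu ev uv with u Fin.≟ b | v Fin.≟ b
        ... | yes refl | _ = case eu of λ ()
        ... | no _ | yes _ = case ev of λ ()
        ... | no nu | no nv with cross uv
        ...   | inj₁ e = sep u v eu ev e
        ...   | inj₂ (inj₁ (_ , p)) = nv p
        ...   | inj₂ (inj₂ (p , _)) = nu p
        na : size cur sta ≡ r
        na = ℕ.≤-antisym (ℕ.≤-trans (size-insert st sta a λ u p ne → trans (sym (proj₂ upa u ne)) p) small)
               (tight sta sepa st₀⊑sta sta⊑st₁)
        nb : size cur stb ≡ r
        nb = ℕ.≤-antisym (ℕ.≤-trans (size-insert st stb b λ u p ne → trans (sym (proj₂ upb u ne)) p) small)
               (tight stb sepb st₀⊑stb stb⊑st₁)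
      between : ∀ st → Separation ⟦ delete E x y ⟧ st → st₀ ⊑ st → st ⊑ st₁ → size cur st < r →
        (st x ≡ old × st y ≡ new) ⊎ (st y ≡ old × st x ≡ new) → DN (Link E st₀ st₁)
      between st sep above below small (inj₁ (p , q)) =
        via st sep above below small x y xy rx ry (delete-other E x y) p q
      between st sep above below small (inj₂ (p , q)) =
        via st sep above below small y x (E-sym {x} {y} xy) ry rx
          (λ e → case delete-other E x y e of λ
            { (inj₁ z) → inj₁ z ; (inj₂ (inj₁ z)) → inj₂ (inj₂ z) ; (inj₂ (inj₂ z)) → inj₂ (inj₁ z) }) p q

-- Contracting a linkage

module _ {N : ℕ} where
  record Labels {r : ℕ} (st : St {N}) (ℓ : Fin r → Fin N) : Set where
    field
      injective : ∀ {t t′} → ℓ t ≡ ℓ t′ → t ≡ t′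
      at-cur    : ∀ t → st (ℓ t) ≡ cur
      onto      : ∀ v → st v ≡ cur → Σ (Fin r) λ t → ℓ t ≡ v

  labelling : ∀ st → Σ (Fin (size cur st) → Fin N) (Labels st)
  labelling st = List.lookup (members cur st) , record
    { injective = unique-lookup-injective (members-unique cur st)
    ; at-cur = λ t → ∈-members⁻ st _ (∈.∈-lookup {xs = members cur st} t)
    ; onto = λ v e → let v∈ = ∈-members⁺ st v e in Any.index v∈ , sym (Any.lookup-index v∈) }

  -- Protocols name boundary vertices by `Fin r`. The labels travel with the tokens, so the two ends
  -- of a path bear the same name at both separations.
  data LabelledLink {r : ℕ} (E : Rel {N}) : St {N} → (Fin r → Fin N) → St {N} → (Fin r → Fin N) → Set where
    stop  : ∀ {st ℓ st′ ℓ′} → st ≗ st′ → ℓ ≗ ℓ′ → LabelledLink E st ℓ st′ ℓ′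
    token : ∀ {st ℓ st₁ st₂ ℓ₁ st′ ℓ′} t y → ⟦ E ⟧ (ℓ t) y → st y ≡ new →
            Update st (ℓ t) old st₁ → Update st₁ y cur st₂ → Labels st₂ ℓ₁ →
            ℓ₁ t ≡ y → (∀ t′ → t′ ≢ t → ℓ₁ t′ ≡ ℓ t′) →
            LabelledLink E st₂ ℓ₁ st′ ℓ′ → LabelledLink E st ℓ st′ ℓ′
    drop  : ∀ {st ℓ st₁ st′ ℓ′} v → st v ≡ new → Update st v old st₁ → Labels st₁ ℓ →
            LabelledLink E st₁ ℓ st′ ℓ′ → LabelledLink E st ℓ st′ ℓ′

  labels-resp : ∀ {r} {st st′} {ℓ ℓ′ : Fin r → Fin N} → st ≗ st′ → ℓ ≗ ℓ′ → Labels st ℓ → Labels st′ ℓ′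
  labels-resp {st′ = st′} e f L = record
    { injective = λ {t} {t′} p → Labels.injective L (trans (f t) (trans p (sym (f t′))))
    ; at-cur = λ t → trans (cong st′ (sym (f t))) (trans (sym (e _)) (Labels.at-cur L t))
    ; onto = λ v p → let t , q = Labels.onto L v (trans (e v) p) in t , trans (sym (f t)) q }

  label-link : ∀ {r E st st′} {ℓ : Fin r → Fin N} → Labels st ℓ → Link E st st′ →
    Σ (Fin r → Fin N) λ ℓ′ → Labels st′ ℓ′ × LabelledLink E st ℓ st′ ℓ′
  label-link {ℓ = ℓ} L (stop e) = ℓ , labels-resp e (λ _ → refl) L , stop e λ _ → refl
  label-link {r} {E} {st} {ℓ = ℓ} L (token {st₁ = st₁} {st₂} x y xy ex ey u₁ u₂ K) with Labels.onto L x ex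
  ... | t , refl = let ℓ′ , L′ , K′ = label-link L₁ K in ℓ′ , L′ , token t y xy ey u₁ u₂ L₁ here₁ away₁ K′
    where
    ℓ₁ : Fin r → Fin N
    ℓ₁ t′ with t′ Fin.≟ t
    ... | yes _ = y
    ... | no _ = ℓ t′
    here₁ : ℓ₁ t ≡ y
    here₁ with t Fin.≟ t
    ... | yes _ = refl
    ... | no ne = ⊥-elim (ne refl)
    away₁ : ∀ t′ → t′ ≢ t → ℓ₁ t′ ≡ ℓ t′
    away₁ t′ ne with t′ Fin.≟ t
    ... | yes e = ⊥-elim (ne e)
    ... | no _ = refl
    y≢ : ∀ t → y ≢ ℓ t
    y≢ t refl = case trans (sym ey) (Labels.at-cur L t) of λ ()
    status : ∀ u → u ≢ y → u ≢ ℓ t → st₂ u ≡ st u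
    status u p q = trans (proj₂ u₂ u p) (proj₂ u₁ u q)
    L₁ : Labels st₂ ℓ₁
    L₁ = record { injective = inj ; at-cur = at ; onto = on }
      where
      inj : ∀ {a b} → ℓ₁ a ≡ ℓ₁ b → a ≡ b
      inj {a} {b} p with a Fin.≟ t | b Fin.≟ t
      ... | yes refl | yes refl = refl
      ... | yes _ | no _ = ⊥-elim (y≢ b p)
      ... | no _ | yes _ = ⊥-elim (y≢ a (sym p))
      ... | no _ | no _ = Labels.injective L p
      at : ∀ a → st₂ (ℓ₁ a) ≡ cur
      at a with a Fin.≟ t
      ... | yes _ = proj₁ u₂
      ... | no ne = trans (status (ℓ a) (λ p → y≢ a (sym p)) λ p → ne (Labels.injective L p)) (Labels.at-cur L a)
      on : ∀ v → st₂ v ≡ cur → Σ (Fin r) λ t → ℓ₁ t ≡ v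
      on v e with v Fin.≟ y
      ... | yes refl = t , here₁
      ... | no ny with v Fin.≟ ℓ t
      ...   | yes refl = case trans (sym (trans (proj₂ u₂ v ny) (proj₁ u₁))) e of λ ()
      ...   | no nx with Labels.onto L v (trans (sym (status v ny nx)) e)
      ...     | t′ , refl = t′ , away₁ t′ λ { refl → nx refl }
  label-link {r} {E} {st} {ℓ = ℓ} L (drop {st₁ = st₁} v ev u K) =
    let ℓ′ , L′ , K′ = label-link L₁ K in ℓ′ , L′ , drop v ev u L₁ K′
    where
    L₁ : Labels st₁ ℓ
    L₁ = record
      { injective = Labels.injective L
      ; at-cur = λ t → trans (proj₂ u (ℓ t) λ { refl → case trans (sym ev) (Labels.at-cur L t) of λ () }) (Labels.at-cur L t)
      ; onto = λ w p → Labels.onto L w (trans (sym (proj₂ u w λ { refl → case trans (sym (proj₁ u)) p of λ () })) p) }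

  labelled-resp : ∀ {r E st st₀ st′} {ℓ ℓ₀ ℓ′ : Fin r → Fin N} → st ≗ st₀ → ℓ ≗ ℓ₀ →
    LabelledLink E st ℓ st′ ℓ′ → LabelledLink E st₀ ℓ₀ st′ ℓ′
  labelled-resp e f (stop e′ f′) = stop (λ v → trans (sym (e v)) (e′ v)) λ t → trans (sym (f t)) (f′ t)
  labelled-resp {E = E} e f (token t y ty ey u₁ u₂ L p q K) with f t
  ... | ft = token t y (subst (λ x → ⟦ E ⟧ x y) ft ty) (trans (sym (e y)) ey)
    (subst (λ x → Update _ x old _) ft (Update-resp e u₁)) u₂ L p (λ t′ ne → trans (q t′ ne) (f t′)) K
  labelled-resp e f (drop v ev u L K) =
    drop v (trans (sym (e v)) ev) (Update-resp e u) (labels-resp (λ _ → refl) f L)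
      (labelled-resp (λ _ → refl) f K)

  labelled-trans : ∀ {r E st st₁ st₂} {ℓ ℓ₁ ℓ₂ : Fin r → Fin N} →
    LabelledLink E st ℓ st₁ ℓ₁ → LabelledLink E st₁ ℓ₁ st₂ ℓ₂ → LabelledLink E st ℓ st₂ ℓ₂
  labelled-trans (stop e f) K = labelled-resp (sym ∘ e) (sym ∘ f) K
  labelled-trans (token t y ty ey u₁ u₂ L p q J) K = token t y ty ey u₁ u₂ L p q (labelled-trans J K)
  labelled-trans (drop v ev u L J) K = drop v ev u L (labelled-trans J K)

  Irreflexive : Rel {N} → Set
  Irreflexive E = ∀ v → ¬ ⟦ E ⟧ v v

  -- Topological minors: deletions, and replacing a path x v y by the edge x y.
  data _≼_ : Rel {N} → Rel {N} → Set where
    sub  : ∀ {E′ E} → (∀ {u v} → ⟦ E′ ⟧ u v → ⟦ E ⟧ u v) → E′ ≼ E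
    lift : ∀ {E′ E₁ E} x y v → x ≢ y → x ≢ v → y ≢ v →
           ⟦ E ⟧ x v × ⟦ E ⟧ v x → ⟦ E ⟧ y v × ⟦ E ⟧ v y →
           (∀ {u w} → ⟦ E₁ ⟧ u w →
             (⟦ E ⟧ u w × u ≢ v × w ≢ v) ⊎ (u ≡ x × w ≡ y) ⊎ (u ≡ y × w ≡ x)) →
           E′ ≼ E₁ → E′ ≼ E

  ≼-sub : ∀ {E₂ E₁ E} → E₂ ≼ E₁ → (∀ {u v} → ⟦ E₁ ⟧ u v → ⟦ E ⟧ u v) → E₂ ≼ E
  ≼-sub (sub h) k = sub (k ∘ h)
  ≼-sub (lift x y v ne nx ny (p , p′) (q , q′) h R) k = lift x y v ne nx ny (k p , k p′) (k q , k q′)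
    (λ e → case h e of λ { (inj₁ (a , b)) → inj₁ (k a , b) ; (inj₂ z) → inj₂ z }) R

  remove : Rel {N} → Fin N → Rel {N}
  remove E v u w = E u w ∧ (not ⌊ u Fin.≟ v ⌋ ∧ not ⌊ w Fin.≟ v ⌋)

  remove⁻ : ∀ E v {u w} → ⟦ remove E v ⟧ u w → ⟦ E ⟧ u w × u ≢ v × w ≢ v
  remove⁻ E v {u} {w} e with E u w | u Fin.≟ v | w Fin.≟ v
  ... | true | no p | no q = refl , p , q
  remove⁻ E v {u} {w} () | true | no _ | yes _
  remove⁻ E v {u} {w} () | true | yes _ | _

  remove⁺ : ∀ E v {u w} → ⟦ E ⟧ u w → u ≢ v → w ≢ v → ⟦ remove E v ⟧ u w
  remove⁺ E v {u} {w} e p q rewrite e with u Fin.≟ v | w Fin.≟ v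
  ... | yes p′ | _ = ⊥-elim (p p′)
  ... | no _ | yes q′ = ⊥-elim (q q′)
  ... | no _ | no _ = refl

  lifted : Rel {N} → Fin N → Fin N → Fin N → Rel {N}
  lifted E x y v u w = remove E v u w ∨ isEdge x y u w

  isEdge⁻ : ∀ (x y : Fin N) {u w} → isEdge x y u w ≡ true → (u ≡ x × w ≡ y) ⊎ (u ≡ y × w ≡ x)
  isEdge⁻ x y {u} {w} e with u Fin.≟ x | w Fin.≟ y | u Fin.≟ y | w Fin.≟ x
  ... | yes p | yes q | _ | _ = inj₁ (p , q)
  ... | _ | _ | yes p | yes q = inj₂ (p , q)
  isEdge⁻ x y {u} {w} () | yes _ | no _ | yes _ | no _
  isEdge⁻ x y {u} {w} () | yes _ | no _ | no _ | _
  isEdge⁻ x y {u} {w} () | no _ | _ | yes _ | no _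
  isEdge⁻ x y {u} {w} () | no _ | _ | no _ | _

  lifted⁻ : ∀ E x y v {u w} → ⟦ lifted E x y v ⟧ u w →
    (⟦ E ⟧ u w × u ≢ v × w ≢ v) ⊎ (u ≡ x × w ≡ y) ⊎ (u ≡ y × w ≡ x)
  lifted⁻ E x y v {u} {w} e with remove E v u w in p
  ... | true = inj₁ (remove⁻ E v p)
  ... | false = inj₂ (isEdge⁻ x y e)

  lifted-keep : ∀ E x y v {u w} → ⟦ E ⟧ u w → u ≢ v → w ≢ v → ⟦ lifted E x y v ⟧ u w
  lifted-keep E x y v e p q rewrite remove⁺ E v e p q = refl

  lifted-edge : ∀ E x y v → ⟦ lifted E x y v ⟧ x y
  lifted-edge E x y v with remove E v x y | x Fin.≟ x | y Fin.≟ y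
  ... | true | _ | _ = refl
  ... | false | yes _ | yes _ = refl
  ... | false | no ne | _ = ⊥-elim (ne refl)
  ... | false | yes _ | no ne = ⊥-elim (ne refl)

  lifted-flipped : ∀ E x y v → ⟦ lifted E x y v ⟧ y x
  lifted-flipped E x y v with remove E v y x | x Fin.≟ x | y Fin.≟ y
  ... | true | _ | _ = refl
  ... | false | yes _ | yes _ = Bool.∨-zeroʳ _
  ... | false | no ne | _ = ⊥-elim (ne refl)
  ... | false | yes _ | no ne = ⊥-elim (ne refl)

  lifted-sym : ∀ {E} x y v → Symmetric ⟦ E ⟧ → Symmetric ⟦ lifted E x y v ⟧
  lifted-sym {E} x y v E-sym {u} {w} e with lifted⁻ E x y v {u} {w} e
  ... | inj₁ (p , a , b) = lifted-keep E x y v (E-sym p) b a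
  ... | inj₂ (inj₁ (refl , refl)) = lifted-flipped E u w v
  ... | inj₂ (inj₂ (refl , refl)) = lifted-edge E w u v

  remove-sym : ∀ {E} v → Symmetric ⟦ E ⟧ → Symmetric ⟦ remove E v ⟧
  remove-sym {E} v E-sym {u} {w} e with remove⁻ E v e
  ... | p , a , b = remove⁺ E v (E-sym p) b a

  module _ {r : ℕ} {E : Rel {N}} {st₀ : St {N}} {ℓ₀ : Fin r → Fin N} (L₀ : Labels st₀ ℓ₀) where

    Alive : St {N} → Fin N → Set
    Alive st u = ¬ (st₀ u ≡ new × st u ≡ old)

    -- What is left of E when the part swept between st₀ and st has been contracted onto ℓ₀.
    record Contracted (st : St {N}) (ℓ : Fin r → Fin N) (F : Rel {N}) : Set where
      field
        F-sym    : Symmetric ⟦ F ⟧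
        F-irr    : Irreflexive F
        F-keep   : ∀ {u w} → ⟦ E ⟧ u w → Alive st u → Alive st w → ⟦ F ⟧ u w
        F-alive  : ∀ {u w} → ⟦ F ⟧ u w → Alive st u × Σ (Fin N) (⟦ E ⟧ u)
        F-link   : ∀ t → ℓ t ≡ ℓ₀ t ⊎ ⟦ F ⟧ (ℓ₀ t) (ℓ t)
        unmoved  : ∀ t → st₀ (ℓ t) ≢ new → ℓ t ≡ ℓ₀ t

    ℓ₀≢new : ∀ {v} t → st₀ v ≡ new → ℓ₀ t ≢ v
    ℓ₀≢new t e refl = case trans (sym e) (Labels.at-cur L₀ t) of λ ()

    -- A path that has left `ℓ₀ t` is kept as a single edge from `ℓ₀ t` to its current end. When the
    -- token advances, the previous end is an inner vertex of the path and is suppressed by one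
    -- `lift`. Dropped vertices are deleted.
    contract : ∀ {st : St {N}} {ℓ st′ ℓ′ F} → Symmetric ⟦ E ⟧ → st₀ ⊑ st → Labels st ℓ → Contracted st ℓ F →
      LabelledLink E st ℓ st′ ℓ′ → Σ (Rel {N}) λ F′ → F′ ≼ F × Contracted st′ ℓ′ F′
    contract {st} {st′ = st′} {F = F} E-sym le L C (stop e f) = F , sub id , record
      { F-sym = F-sym ; F-irr = F-irr
      ; F-keep = λ p a b → F-keep p (back a) (back b)
      ; F-alive = λ {u} p → (λ { (q , q′) → proj₁ (F-alive p) (q , trans (e u) q′) }) , proj₂ (F-alive p)
      ; F-link = λ t → subst (λ x → x ≡ ℓ₀ t ⊎ ⟦ F ⟧ (ℓ₀ t) x) (f t) (F-link t)
      ; unmoved = λ t → subst (λ x → st₀ x ≢ new → x ≡ ℓ₀ t) (f t) (unmoved t) }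
      where
      open Contracted C
      back : ∀ {u} → Alive st′ u → Alive st u
      back {u} a (p , q) = a (p , trans (sym (e u)) q)
    contract {st} {ℓ} {F = F} E-sym le L C (drop {st₁ = st₁} v ev up L₁ K) =
      let F′ , R , C′ = contract E-sym le₁ L₁ C₁ K in
      F′ , ≼-sub R (λ e → proj₁ (remove⁻ F v e)) , C′
      where
      open Contracted C
      v-new : st₀ v ≡ new
      v-new = ⊑ₛ-new (le v) ev
      le₁ : st₀ ⊑ st₁
      le₁ u with u Fin.≟ v
      ... | yes refl rewrite v-new = new⊑
      ... | no ne = subst (st₀ u ⊑ₛ_) (sym (proj₂ up u ne)) (le u)
      alive⁻ : ∀ {u} → Alive st₁ u → Alive st u × u ≢ v
      alive⁻ {u} a = (λ { (p , q) → a (p , trans (proj₂ up u λ { refl → case trans (sym ev) q of λ () }) q) }) ,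
        λ { refl → a (v-new , proj₁ up) }
      alive⁺ : ∀ {u} → u ≢ v → Alive st u → Alive st₁ u
      alive⁺ {u} ne a (p , q) = a (p , trans (sym (proj₂ up u ne)) q)
      C₁ : Contracted st₁ ℓ (remove F v)
      C₁ = record
        { F-sym = remove-sym {F} v F-sym
        ; F-irr = λ u e → F-irr u (proj₁ (remove⁻ F v e))
        ; F-keep = λ e a b → let a′ , na = alive⁻ a ; b′ , nb = alive⁻ b in
            remove⁺ F v (F-keep e a′ b′) na nb
        ; F-alive = λ e → let p , na , _ = remove⁻ F v e ; a , w = F-alive p in alive⁺ na a , w
        ; F-link = link
        ; unmoved = unmoved }
        where
        link : ∀ t → ℓ t ≡ ℓ₀ t ⊎ ⟦ remove F v ⟧ (ℓ₀ t) (ℓ t)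
        link t with F-link t
        ... | inj₁ e = inj₁ e
        ... | inj₂ e = inj₂ (remove⁺ F v e (ℓ₀≢new t v-new)
                (λ { refl → case trans (sym ev) (Labels.at-cur L t) of λ () }))
    contract {st} {ℓ} {F = F} E-sym le L C (token {st₁ = st₁} {st₂} {ℓ₁} t y ty ey u₁ u₂ L₂ p q K) = result
      where
      open Contracted C
      x = ℓ t
      ex : st x ≡ cur
      ex = Labels.at-cur L t
      y≢x : y ≢ x
      y≢x e = case trans (sym ey) (trans (cong st e) ex) of λ ()
      y-new : st₀ y ≡ new
      y-new = ⊑ₛ-new (le y) ey
      same : ∀ u → u ≢ y → u ≢ x → st₂ u ≡ st u
      same u ny nx = trans (proj₂ u₂ u ny) (proj₂ u₁ u nx)
      x-old : st₂ x ≡ old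
      x-old = trans (proj₂ u₂ x (y≢x ∘ sym)) (proj₁ u₁)
      le₂ : st₀ ⊑ st₂
      le₂ u with u Fin.≟ y | u Fin.≟ x
      ... | yes refl | _ rewrite y-new = new⊑
      ... | no ny | yes refl = subst (st₀ u ⊑ₛ_) (sym x-old) (⊑ₛ-trans (le u) (subst (_⊑ₛ old) (sym ex) cur⊑old))
      ... | no ny | no nx = subst (st₀ u ⊑ₛ_) (sym (same u ny nx)) (le u)
      alive⁻ : ∀ {u} → Alive st₂ u → Alive st u
      alive⁻ {u} a (p , q) = a (p , trans (same u (λ { refl → case trans (sym ey) q of λ () })
        (λ { refl → case trans (sym ex) q of λ () })) q)
      alive⁺ : ∀ {u} → (st₀ x ≡ new → u ≢ x) → Alive st u → Alive st₂ u
      alive⁺ {u} nx a (p , q) with u Fin.≟ y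
      ... | yes refl = case trans (sym (proj₁ u₂)) q of λ ()
      ... | no ny with u Fin.≟ x
      ...   | yes refl = nx p refl
      ...   | no nx′ = a (p , trans (sym (same u ny nx′)) q)
      xyF : ⟦ F ⟧ x y
      xyF = F-keep ty (λ { (_ , z) → case trans (sym ex) z of λ () }) (λ { (_ , z) → case trans (sym ey) z of λ () })
      unmoved₁ : ∀ t′ → st₀ (ℓ₁ t′) ≢ new → ℓ₁ t′ ≡ ℓ₀ t′
      unmoved₁ t′ ne with t′ Fin.≟ t
      ... | yes refl = ⊥-elim (ne (trans (cong st₀ p) y-new))
      ... | no nt rewrite q t′ nt = unmoved t′ ne
      result : Σ (Rel {N}) λ F′ → F′ ≼ F × Contracted _ _ F′
      result with st₀ x ≟ₛ new
      -- Here x is still `ℓ₀ t`, and the edge xy itself becomes the link.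
      ... | no moved = contract E-sym le₂ L₂ C₂ K
        where
        C₂ : Contracted st₂ ℓ₁ F
        C₂ = record
          { F-sym = F-sym ; F-irr = F-irr
          ; F-keep = λ e a b → F-keep e (alive⁻ a) (alive⁻ b)
          ; F-alive = λ e → alive⁺ (λ z → ⊥-elim (moved z)) (proj₁ (F-alive e)) , proj₂ (F-alive e)
          ; F-link = link
          ; unmoved = unmoved₁ }
          where
          link : ∀ t′ → ℓ₁ t′ ≡ ℓ₀ t′ ⊎ ⟦ F ⟧ (ℓ₀ t′) (ℓ₁ t′)
          link t′ with t′ Fin.≟ t
          ... | yes refl = inj₂ (subst₂ ⟦ F ⟧ (unmoved t moved) (sym p) xyF)
          ... | no nt rewrite q t′ nt = F-link t′
      ... | yes x-new =
        let F′ , R , C′ = contract E-sym le₂ L₂ C₂ K in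
        F′ , lift z y x z≢y (ℓ₀≢new t x-new) y≢x (zx , F-sym zx) (F-sym xyF , xyF) (lifted⁻ F z y x) R , C′
        where
        z = ℓ₀ t
        F₁ = lifted F z y x
        z≢y : z ≢ y
        z≢y = ℓ₀≢new t y-new
        zx : ⟦ F ⟧ z x
        zx with F-link t
        ... | inj₁ e = ⊥-elim (ℓ₀≢new t x-new (sym e))
        ... | inj₂ e = e
        z-alive : Alive st₂ z
        z-alive (a , _) = ℓ₀≢new t a refl
        y-alive : Alive st₂ y
        y-alive (_ , b) = case trans (sym (proj₁ u₂)) b of λ ()
        C₂ : Contracted st₂ ℓ₁ F₁
        C₂ = record
          { F-sym = lifted-sym {F} z y x F-sym
          ; F-irr = λ u e → case lifted⁻ F z y x {u} {u} e of λ
              { (inj₁ (e′ , _)) → F-irr u e′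
              ; (inj₂ (inj₁ (a , b))) → z≢y (trans (sym a) b)
              ; (inj₂ (inj₂ (a , b))) → z≢y (trans (sym b) a) }
          ; F-keep = λ e a b → lifted-keep F z y x (F-keep e (alive⁻ a) (alive⁻ b))
              (λ { refl → a (x-new , x-old) }) (λ { refl → b (x-new , x-old) })
          ; F-alive = alive
          ; F-link = link
          ; unmoved = unmoved₁ }
          where
          alive : ∀ {u w} → ⟦ F₁ ⟧ u w → Alive st₂ u × Σ (Fin N) (⟦ E ⟧ u)
          alive {u} {w} e with lifted⁻ F z y x {u} {w} e
          ... | inj₁ (e′ , na , _) = alive⁺ (λ _ → na) (proj₁ (F-alive e′)) , proj₂ (F-alive e′)
          ... | inj₂ (inj₁ (refl , refl)) = z-alive , proj₂ (F-alive zx)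
          ... | inj₂ (inj₂ (refl , refl)) = y-alive , x , E-sym ty
          link : ∀ t′ → ℓ₁ t′ ≡ ℓ₀ t′ ⊎ ⟦ F₁ ⟧ (ℓ₀ t′) (ℓ₁ t′)
          link t′ with t′ Fin.≟ t
          ... | yes refl = inj₂ (subst (⟦ F₁ ⟧ z) (sym p) (lifted-edge F z y x))
          ... | no nt rewrite q t′ nt with F-link t′
          ...   | inj₁ e = inj₁ e
          ...   | inj₂ e = inj₂ (lifted-keep F z y x e (ℓ₀≢new t′ x-new) λ e′ → nt (Labels.injective L e′))

-- Exchanging one side of a separation

module _ {N r : ℕ} (E : Rel {N}) (E-sym : Symmetric ⟦ E ⟧) where

  -- All of `Fin N` serves as `Inner`, which avoids a subtype: vertices of another status have no
  -- edges here, and `start` marks them `old`.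
  half : Status → St {N} → (Fin r → Fin N) → Half r
  half s st ℓ = record
    { Inner = Fin N
    ; _≟ᵢ_ = Fin._≟_
    ; inner = λ u v → ⟦ E ⟧ u v × st u ≡ s × st v ≡ s
    ; attach = λ u t → ⟦ E ⟧ u (ℓ t) × st u ≡ s
    ; border = λ t t′ → ⟦ E ⟧ (ℓ t) (ℓ t′)
    ; inner-sym = λ { (e , p , q) → E-sym e , q , p }
    ; border-sym = λ e → E-sym e }

  start : Status → St {N} → Fin N → Status
  start s st u with st u ≟ₛ s
  ... | yes _ = new
  ... | no _  = old

  start-new : ∀ s st u → start s st u ≡ new → st u ≡ s
  start-new s st u e with st u ≟ₛ s
  ... | yes p = p

  start-cur : ∀ s st u → start s st u ≢ cur
  start-cur s st u e with st u ≟ₛ s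
  start-cur s st u () | yes _
  start-cur s st u () | no _

  start-old : ∀ s st u → start s st u ≡ old → st u ≢ s
  start-old s st u e with st u ≟ₛ s
  ... | no ne = ne

  Glue : St {N} → (Fin r → Fin N) → St {N} → (Fin r → Fin N) → Set
  Glue st₀ ℓ₀ st₁ ℓ₁ = GlueV (half old st₀ ℓ₀) (half new st₁ ℓ₁)

  glueStart : ∀ st₀ ℓ₀ st₁ ℓ₁ → Glue st₀ ℓ₀ st₁ ℓ₁ → Status
  glueStart st₀ ℓ₀ st₁ ℓ₁ = glued (half old st₀ ℓ₀) (half new st₁ ℓ₁) (start old st₀) (start new st₁) (lookup (allNew r))

  GoodGlue : ℕ → St {N} → (Fin r → Fin N) → St {N} → (Fin r → Fin N) → Set
  GoodGlue c st₀ ℓ₀ st₁ ℓ₁ =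
    Good (glueE (half old st₀ ℓ₀) (half new st₁ ℓ₁)) c (glueStart st₀ ℓ₀ st₁ ℓ₁) 0

  glueStart-separation : ∀ st₀ ℓ₀ st₁ ℓ₁ →
    Separation (glueE (half old st₀ ℓ₀) (half new st₁ ℓ₁)) (glueStart st₀ ℓ₀ st₁ ℓ₁)
  glueStart-separation st₀ ℓ₀ st₁ ℓ₁ (inj₂ (inj₂ t)) v e _ = case trans (sym e) (lookup-allNew t) of λ ()
  glueStart-separation st₀ ℓ₀ st₁ ℓ₁ (inj₁ u) (inj₁ v) e _ (_ , p , _) = start-old old st₀ u e p
  glueStart-separation st₀ ℓ₀ st₁ ℓ₁ (inj₁ u) (inj₂ (inj₂ t)) e _ (_ , p) = start-old old st₀ u e p
  glueStart-separation st₀ ℓ₀ st₁ ℓ₁ (inj₂ (inj₁ u)) (inj₂ (inj₁ v)) e _ (_ , p , _) = start-old new st₁ u e p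
  glueStart-separation st₀ ℓ₀ st₁ ℓ₁ (inj₂ (inj₁ u)) (inj₂ (inj₂ t)) e _ (_ , p) = start-old new st₁ u e p

  glueStart-cur : ∀ st₀ ℓ₀ st₁ ℓ₁ v → glueStart st₀ ℓ₀ st₁ ℓ₁ v ≢ cur
  glueStart-cur st₀ ℓ₀ st₁ ℓ₁ (inj₁ u) = start-cur old st₀ u
  glueStart-cur st₀ ℓ₀ st₁ ℓ₁ (inj₂ (inj₁ u)) = start-cur new st₁ u
  glueStart-cur st₀ ℓ₀ st₁ ℓ₁ (inj₂ (inj₂ t)) e = case trans (sym e) (lookup-allNew t) of λ ()

  glue-≟ : ∀ st₀ ℓ₀ st₁ ℓ₁ → DecidableEquality (Glue st₀ ℓ₀ st₁ ℓ₁)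
  glue-≟ _ _ _ _ = Sum.≡-dec Fin._≟_ (Sum.≡-dec Fin._≟_ Fin._≟_)

  unglue : ∀ {c st ℓ} → Labels st ℓ → Separation ⟦ E ⟧ st → GoodGlue c st ℓ st ℓ → Good ⟦ E ⟧ c (λ _ → new) 0
  unglue {c} {st} {ℓ} L sep g = good-minor (glue-≟ st ℓ st ℓ) Fin._≟_
    (λ {u} {v} → glueE-sym (half old st ℓ) (half new st ℓ) {u} {v}) M g
    (glueStart-separation st ℓ st ℓ) (count-empty (glueStart-cur st ℓ st ℓ))
    (record { center-new = λ u _ → place u , refl , φ-placeAt u (st u) refl
            ; fibre-new = λ u v _ → φ-new v u
            ; fibre-cur = λ u () })
    (count-empty λ _ ())
    where
    φ : Glue st ℓ st ℓ → Maybe (Fin N)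
    φ (inj₁ u) with st u ≟ₛ old
    ... | yes _ = just u
    ... | no _  = nothing
    φ (inj₂ (inj₁ u)) with st u ≟ₛ new
    ... | yes _ = just u
    ... | no _  = nothing
    φ (inj₂ (inj₂ t)) = just (ℓ t)
    φ-new : ∀ v u → φ v ≡ just u → glueStart st ℓ st ℓ v ≡ new
    φ-new (inj₁ v) u e with st v ≟ₛ old
    ... | yes _ = refl
    φ-new (inj₂ (inj₁ v)) u e with st v ≟ₛ new
    ... | yes _ = refl
    φ-new (inj₂ (inj₂ t)) u e = lookup-allNew t
    placeAt : ∀ u s → st u ≡ s → Glue st ℓ st ℓ
    placeAt u old e = inj₁ u
    placeAt u new e = inj₂ (inj₁ u)
    placeAt u cur e = inj₂ (inj₂ (proj₁ (Labels.onto L u e)))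
    place : Fin N → Glue st ℓ st ℓ
    place u = placeAt u (st u) refl
    φ-old : ∀ u → st u ≡ old → φ (inj₁ u) ≡ just u
    φ-old u e with st u ≟ₛ old
    ... | yes _ = refl
    ... | no ne = ⊥-elim (ne e)
    φ-below : ∀ u → st u ≡ new → φ (inj₂ (inj₁ u)) ≡ just u
    φ-below u e with st u ≟ₛ new
    ... | yes _ = refl
    ... | no ne = ⊥-elim (ne e)
    φ-placeAt : ∀ u s e → φ (placeAt u s e) ≡ just u
    φ-placeAt u old e = φ-old u e
    φ-placeAt u new e = φ-below u e
    φ-placeAt u cur e = cong just (proj₂ (Labels.onto L u e))
    placeAt-unique : ∀ u s e v → φ v ≡ just u → v ≡ placeAt u s e
    placeAt-unique u s e (inj₁ v) q with st v ≟ₛ old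
    placeAt-unique v old e (inj₁ .v) refl | yes p = refl
    placeAt-unique v new e (inj₁ .v) refl | yes p = case trans (sym e) p of λ ()
    placeAt-unique v cur e (inj₁ .v) refl | yes p = case trans (sym e) p of λ ()
    placeAt-unique u s e (inj₂ (inj₁ v)) q with st v ≟ₛ new
    placeAt-unique v old e (inj₂ (inj₁ .v)) refl | yes p = case trans (sym e) p of λ ()
    placeAt-unique v new e (inj₂ (inj₁ .v)) refl | yes p = refl
    placeAt-unique v cur e (inj₂ (inj₁ .v)) refl | yes p = case trans (sym e) p of λ ()
    placeAt-unique .(ℓ t) old e (inj₂ (inj₂ t)) refl = case trans (sym e) (Labels.at-cur L t) of λ ()
    placeAt-unique .(ℓ t) new e (inj₂ (inj₂ t)) refl = case trans (sym e) (Labels.at-cur L t) of λ ()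
    placeAt-unique .(ℓ t) cur e (inj₂ (inj₂ t)) refl =
      cong (inj₂ ∘ inj₂) (Labels.injective L (sym (proj₂ (Labels.onto L (ℓ t) e))))
    label : ∀ {u} (e : st u ≡ cur) → u ≡ ℓ (proj₁ (Labels.onto L u e))
    label e = sym (proj₂ (Labels.onto L _ e))
    place-edge : ∀ u v s s′ (e : st u ≡ s) (e′ : st v ≡ s′) → ⟦ E ⟧ u v →
      glueE (half old st ℓ) (half new st ℓ) (placeAt u s e) (placeAt v s′ e′)
    place-edge u v old old eu ev uv = uv , eu , ev
    place-edge u v old new eu ev uv = sep u v eu ev uv
    place-edge u v old cur eu ev uv = subst (⟦ E ⟧ u) (label ev) uv , eu
    place-edge u v new old eu ev uv = sep v u ev eu (E-sym uv)
    place-edge u v new new eu ev uv = uv , eu , ev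
    place-edge u v new cur eu ev uv = subst (⟦ E ⟧ u) (label ev) uv , eu
    place-edge u v cur old eu ev uv = subst (⟦ E ⟧ v) (label eu) (E-sym uv) , ev
    place-edge u v cur new eu ev uv = subst (⟦ E ⟧ v) (label eu) (E-sym uv) , ev
    place-edge u v cur cur eu ev uv = inj₁ (subst₂ ⟦ E ⟧ (label eu) (label ev) uv)
    M : MinorModel (glueE (half old st ℓ) (half new st ℓ)) ⟦ E ⟧
    M = record
      { φ = φ
      ; center = just ∘ place
      ; connected = λ S u _ a b p q → cong S
          (trans (placeAt-unique u (st u) refl a p) (sym (placeAt-unique u (st u) refl b q)))
      ; edge = λ {u} {v} uv → place u , place v ,
          φ-placeAt u (st u) refl , φ-placeAt v (st v) refl , place-edge u v (st u) (st v) refl refl uv }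

  module _ {st₀ st₁ : St {N}} {ℓ₀ ℓ₁ : Fin r → Fin N} {F : Rel {N}}
    (L₀ : Labels st₀ ℓ₀) (L₁ : Labels st₁ ℓ₁) (le : st₀ ⊑ st₁)
    (C : Contracted {E = E} L₀ st₁ ℓ₁ F) where
    open Contracted C

    private
      A B : Half r
      A = half old st₀ ℓ₀
      B = half new st₁ ℓ₁

      -- The statuses are separate arguments with equations, so that they can be matched while the
      -- link to `st₀` and `st₁` is kept. Vertices swept between the two separations other than the
      -- final labels have no image.
      φAt : ∀ u s₀ s₁ → st₀ u ≡ s₀ → st₁ u ≡ s₁ → Maybe (GlueV A B)
      φAt u old _   e₀ e₁ = just (inj₁ u)
      φAt u cur _   e₀ e₁ = just (inj₂ (inj₂ (proj₁ (Labels.onto L₀ u e₀))))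
      φAt u new new e₀ e₁ = just (inj₂ (inj₁ u))
      φAt u new cur e₀ e₁ = just (inj₂ (inj₂ (proj₁ (Labels.onto L₁ u e₁))))
      φAt u new old e₀ e₁ = nothing

      φ : Fin N → Maybe (GlueV A B)
      φ u = φAt u (st₀ u) (st₁ u) refl refl

      φAt-A : ∀ u s₀ s₁ e₀ e₁ → s₀ ≡ old → φAt u s₀ s₁ e₀ e₁ ≡ just (inj₁ u)
      φAt-A u .old s₁ e₀ e₁ refl = refl

      φ-A : ∀ u → st₀ u ≡ old → φ u ≡ just (inj₁ u)
      φ-A u = φAt-A u (st₀ u) (st₁ u) refl refl

      φAt-B : ∀ u s₀ s₁ e₀ e₁ → s₀ ≡ new → s₁ ≡ new → φAt u s₀ s₁ e₀ e₁ ≡ just (inj₂ (inj₁ u))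
      φAt-B u .new .new e₀ e₁ refl refl = refl

      φ-B : ∀ u → st₁ u ≡ new → φ u ≡ just (inj₂ (inj₁ u))
      φ-B u e = φAt-B u (st₀ u) (st₁ u) refl refl (⊑ₛ-new (le u) e) e

      φAt-ℓ₀ : ∀ t s₀ s₁ e₀ e₁ → s₀ ≡ cur → φAt (ℓ₀ t) s₀ s₁ e₀ e₁ ≡ just (inj₂ (inj₂ t))
      φAt-ℓ₀ t .cur s₁ e₀ e₁ refl =
        cong (just ∘ inj₂ ∘ inj₂) (Labels.injective L₀ (proj₂ (Labels.onto L₀ (ℓ₀ t) e₀)))

      φ-ℓ₀ : ∀ t → φ (ℓ₀ t) ≡ just (inj₂ (inj₂ t))
      φ-ℓ₀ t = φAt-ℓ₀ t (st₀ (ℓ₀ t)) (st₁ (ℓ₀ t)) refl refl (Labels.at-cur L₀ t)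

      φAt-ℓ₁ : ∀ t s₀ s₁ e₀ e₁ → s₀ ≡ new → s₁ ≡ cur → φAt (ℓ₁ t) s₀ s₁ e₀ e₁ ≡ just (inj₂ (inj₂ t))
      φAt-ℓ₁ t .new .cur e₀ e₁ refl refl =
        cong (just ∘ inj₂ ∘ inj₂) (Labels.injective L₁ (proj₂ (Labels.onto L₁ (ℓ₁ t) e₁)))

      φ-ℓ₁ : ∀ t → φ (ℓ₁ t) ≡ just (inj₂ (inj₂ t))
      φ-ℓ₁ t with st₀ (ℓ₁ t) ≟ₛ new
      ... | no ne = subst (λ v → φ v ≡ just (inj₂ (inj₂ t))) (sym (unmoved t ne)) (φ-ℓ₀ t)
      ... | yes e = φAt-ℓ₁ t (st₀ (ℓ₁ t)) (st₁ (ℓ₁ t)) refl refl e (Labels.at-cur L₁ t)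

      Fibre : GlueV A B → Fin N → Set
      Fibre (inj₁ u) a = a ≡ u
      Fibre (inj₂ (inj₁ u)) a = a ≡ u
      Fibre (inj₂ (inj₂ t)) a = a ≡ ℓ₀ t ⊎ a ≡ ℓ₁ t

      φAt-fibre : ∀ x a s₀ s₁ e₀ e₁ → φAt a s₀ s₁ e₀ e₁ ≡ just x → Fibre x a
      φAt-fibre _ a old s₁  e₀ e₁ refl = refl
      φAt-fibre _ a cur s₁  e₀ e₁ refl = inj₁ (sym (proj₂ (Labels.onto L₀ a e₀)))
      φAt-fibre _ a new new e₀ e₁ refl = refl
      φAt-fibre _ a new cur e₀ e₁ refl = inj₂ (sym (proj₂ (Labels.onto L₁ a e₁)))

      φ-fibre : ∀ x a → φ a ≡ just x → Fibre x a
      φ-fibre x a = φAt-fibre x a (st₀ a) (st₁ a) refl refl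

      M : MinorModel ⟦ F ⟧ (glueE A B)
      M = record
        { φ = φ
        ; center = λ { (inj₁ u) → just u ; (inj₂ (inj₁ u)) → just u ; (inj₂ (inj₂ t)) → just (ℓ₀ t) }
        ; connected = conn
        ; edge = λ {x} {y} → edge x y }
        where
        conn : ∀ (S : Fin N → Bool) x →
          (∀ a b → φ a ≡ just x → φ b ≡ just x → ⟦ F ⟧ a b → S a ≡ S b) →
          ∀ a b → φ a ≡ just x → φ b ≡ just x → S a ≡ S b
        conn S (inj₁ u) h a b p q = cong S (trans (φ-fibre (inj₁ u) a p) (sym (φ-fibre (inj₁ u) b q)))
        conn S (inj₂ (inj₁ u)) h a b p q =
          cong S (trans (φ-fibre (inj₂ (inj₁ u)) a p) (sym (φ-fibre (inj₂ (inj₁ u)) b q)))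
        conn S (inj₂ (inj₂ t)) h a b p q = trans (same a (φ-fibre _ a p)) (sym (same b (φ-fibre _ b q)))
          where
          same : ∀ a → a ≡ ℓ₀ t ⊎ a ≡ ℓ₁ t → S a ≡ S (ℓ₀ t)
          same a (inj₁ refl) = refl
          same a (inj₂ refl) with F-link t
          ... | inj₁ e = cong S e
          ... | inj₂ e = sym (h (ℓ₀ t) (ℓ₁ t) (φ-ℓ₀ t) (φ-ℓ₁ t) e)
        above : ∀ {u} → st₀ u ≢ new → Alive {E = E} L₀ st₁ u
        above ne (p , _) = ne p
        below : ∀ {u} → st₁ u ≢ old → Alive {E = E} L₀ st₁ u
        below ne (_ , q) = ne q
        old≢new : ∀ {s} → s ≡ old → s ≢ new
        old≢new refl ()
        new≢old : ∀ {s} → s ≡ new → s ≢ old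
        new≢old refl ()
        cur≢new : ∀ {s} → s ≡ cur → s ≢ new
        cur≢new refl ()
        cur≢old : ∀ {s} → s ≡ cur → s ≢ old
        cur≢old refl ()
        a₀ : ∀ t → Alive {E = E} L₀ st₁ (ℓ₀ t)
        a₀ t = above (cur≢new (Labels.at-cur L₀ t))
        a₁ : ∀ t → Alive {E = E} L₀ st₁ (ℓ₁ t)
        a₁ t = below (cur≢old (Labels.at-cur L₁ t))
        edge : ∀ x y → glueE A B x y → Σ (Fin N) λ a → Σ (Fin N) λ b →
          φ a ≡ just x × φ b ≡ just y × ⟦ F ⟧ a b
        edge (inj₁ u) (inj₁ v) (e , p , q) =
          u , v , φ-A u p , φ-A v q , F-keep e (above (old≢new p)) (above (old≢new q))
        edge (inj₁ u) (inj₂ (inj₂ t)) (e , p) =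
          u , ℓ₀ t , φ-A u p , φ-ℓ₀ t , F-keep e (above (old≢new p)) (a₀ t)
        edge (inj₂ (inj₁ u)) (inj₂ (inj₁ v)) (e , p , q) =
          u , v , φ-B u p , φ-B v q , F-keep e (below (new≢old p)) (below (new≢old q))
        edge (inj₂ (inj₁ u)) (inj₂ (inj₂ t)) (e , p) =
          u , ℓ₁ t , φ-B u p , φ-ℓ₁ t , F-keep e (below (new≢old p)) (a₁ t)
        edge (inj₂ (inj₂ t)) (inj₁ u) (e , p) =
          ℓ₀ t , u , φ-ℓ₀ t , φ-A u p , F-sym (F-keep e (above (old≢new p)) (a₀ t))
        edge (inj₂ (inj₂ t)) (inj₂ (inj₁ u)) (e , p) =
          ℓ₁ t , u , φ-ℓ₁ t , φ-B u p , F-sym (F-keep e (below (new≢old p)) (a₁ t))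
        edge (inj₂ (inj₂ t)) (inj₂ (inj₂ t′)) (inj₁ e) =
          ℓ₀ t , ℓ₀ t′ , φ-ℓ₀ t , φ-ℓ₀ t′ , F-keep e (a₀ t) (a₀ t′)
        edge (inj₂ (inj₂ t)) (inj₂ (inj₂ t′)) (inj₂ e) =
          ℓ₁ t , ℓ₁ t′ , φ-ℓ₁ t , φ-ℓ₁ t′ , F-keep e (a₁ t) (a₁ t′)

    -- F has the glued graph as a minor: the branch set of the boundary vertex t consists of `ℓ₀ t`
    -- and `ℓ₁ t`, which coincide or are joined in F by the contracted path.
    glue-contracted : ∀ {c} → Good ⟦ F ⟧ c (λ _ → new) 0 → GoodGlue c st₀ ℓ₀ st₁ ℓ₁
    glue-contracted g = good-minor Fin._≟_ (glue-≟ st₀ ℓ₀ st₁ ℓ₁) F-sym M g (λ _ _ ()) (count-empty λ _ ())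
      (record { center-new = λ
                 { (inj₁ u) e → u , refl , φ-A u (start-new old st₀ u e)
                 ; (inj₂ (inj₁ u)) e → u , refl , φ-B u (start-new new st₁ u e)
                 ; (inj₂ (inj₂ t)) e → ℓ₀ t , refl , φ-ℓ₀ t }
              ; fibre-new = λ _ _ _ _ → refl
              ; fibre-cur = λ x e → ⊥-elim (glueStart-cur st₀ ℓ₀ st₁ ℓ₁ x e) })
      (count-empty (glueStart-cur st₀ ℓ₀ st₁ ℓ₁))

    -- A derivation of F yields a protocol shared by the `old` side at `st₀` and the `new` side at
    -- `st₁`. Its first implementation is replaced by one for the `old` side at `st₁`, and the two
    -- halves at `st₁` give E back.
    good-exchange : ∀ {c} → Separation ⟦ E ⟧ st₁ →
      (∀ p → p ∈ protocols r c → Impl c A true p (allNew r) 0 (start old st₀) 0 0 →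
        Impl c (half old st₁ ℓ₁) true p (allNew r) 0 (start old st₁) 0 0) →
      Good ⟦ F ⟧ c (λ _ → new) 0 → Good ⟦ E ⟧ c (λ _ → new) 0
    good-exchange {c} sep exchange g with impl-complete c A B (start-cur old st₀) (start-cur new st₁)
      (glueStart-separation st₀ ℓ₀ st₁ ℓ₁) (glue-contracted g)
    ... | p , p∈ , i , j = unglue L₁ sep (impl-sound c (half old st₁ ℓ₁) B (exchange p p∈ i) j
      (count-empty (start-cur old st₁)) (count-empty (start-cur new st₁)))

-- Long linked chains of separations of equal order

-- A chain of orders at most `suc w` is cut into `chainLength w m` blocks of `suc m` steps; one of
-- them is linked, unless every block supplies a member of a chain of orders at most w. In a block
-- one step reaches the first separation and m steps are links.
chainLength : ℕ → ℕ → ℕ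
chainLength zero m = suc m
chainLength (suc w) m = chainLength w m * suc m

-- `descend` stops at a state with at most twice the next threshold of `new` vertices and at most w
-- current ones. The surplus `suc w` forces some `new` vertex to have become `old`, which makes the
-- step of the chain strict.
chainThreshold : ℕ → ℕ → ℕ
chainThreshold w zero = 0
chainThreshold w (suc q) = (chainThreshold w q + chainThreshold w q) + suc w

module _ {N : ℕ} (E : Rel {N}) where

  ⊑-refl : {st : St {N}} → st ⊑ st
  ⊑-refl v = ⊑ₛ-refl

  ⊑-trans : {st st₁ st₂ : St {N}} → st ⊑ st₁ → st₁ ⊑ st₂ → st ⊑ st₂
  ⊑-trans p q v = ⊑ₛ-trans (p v) (q v)

  infix 4 _≪_
  -- Strictness is demanded in the form of a vertex swept between the two separations: contraction
  -- isolates it, and so the minor has fewer live vertices.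
  _≪_ : St {N} → St {N} → Set
  st ≪ st′ = st ⊑ st′ × Σ (Fin N) λ v → st v ≡ new × st′ v ≡ old

  ⊑-≪ : ∀ {st st₁ st₂} → st ⊑ st₁ → st₁ ≪ st₂ → st ≪ st₂
  ⊑-≪ p (q , v , a , b) = ⊑-trans p q , v , ⊑ₛ-new (p v) a , b

  ≪-⊑ : ∀ {st st₁ st₂} → st ≪ st₁ → st₁ ⊑ st₂ → st ≪ st₂
  ≪-⊑ (p , v , a , b) q = ⊑-trans p q , v , a , ⊑ₛ-old (q v) b

  data Chain (w : ℕ) : ℕ → St {N} → St {N} → Set where
    []  : ∀ {st} → Chain w 0 st st
    _∷_ : ∀ {m st st₁ st₂} → (st ≪ st₁ × Separation ⟦ E ⟧ st₁ × size cur st₁ ≤ w) →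
          Chain w m st₁ st₂ → Chain w (suc m) st st₂

  chain-⊑ : ∀ {w m st st′} → Chain w m st st′ → st ⊑ st′
  chain-⊑ [] = ⊑-refl
  chain-⊑ ((lt , _) ∷ C) = ⊑-trans (proj₁ lt) (chain-⊑ C)

  chain-split : ∀ {w} m {k st st′} → Chain w (m + k) st st′ →
    Σ (St {N}) λ st₁ → Chain w m st st₁ × Chain w k st₁ st′
  chain-split zero C = _ , [] , C
  chain-split (suc m) (p ∷ C) = let st₁ , C₁ , C₂ = chain-split m C in st₁ , (p ∷ C₁) , C₂

  record Node (w : ℕ) (st : St {N}) : Set where
    constructor node
    field
      {bag}  : ℕ
      deriv  : Good ⟦ E ⟧ w st bag
      sep    : Separation ⟦ E ⟧ st
      count  : Count st bag
      bag≤w  : bag ≤ w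

  node-order : ∀ {w st} → Node w st → size cur st ≤ w
  node-order {st = st} (node _ _ (xs , _ , refl , f , _) le) =
    ℕ.≤-trans (unique-⊆-length (members-unique cur st) λ v v∈ → f v (∈-members⁻ st v v∈)) le

  size-new-split : ∀ {st st₁ st₂ : St {N}} → (∀ v → st v ≡ new → st₁ v ≡ new ⊎ st₂ v ≡ new) →
    size new st ≤ size new st₁ + size new st₂
  size-new-split {st} {st₁} {st₂} h = ℕ.≤-trans
    (unique-⊆-length (members-unique new st) λ v v∈ →
      [ (λ e → ∈.∈-++⁺ˡ (∈-members⁺ st₁ v e)) , (λ e → ∈.∈-++⁺ʳ (members new st₁) (∈-members⁺ st₂ v e)) ]′
        (h v (∈-members⁻ st v v∈)))
    (ℕ.≤-reflexive (List.length-++ (members new st₁)))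

  size-new-cur : ∀ {st st′ : St {N}} → (∀ v → st v ≡ new → st′ v ≡ new ⊎ st′ v ≡ cur) →
    size new st ≤ size new st′ + size cur st′
  size-new-cur {st} {st′} h = ℕ.≤-trans
    (unique-⊆-length (members-unique new st) λ v v∈ →
      [ (λ e → ∈.∈-++⁺ˡ (∈-members⁺ st′ v e)) , (λ e → ∈.∈-++⁺ʳ (members new st′) (∈-members⁺ st′ v e)) ]′
        (h v (∈-members⁻ st v v∈)))
    (ℕ.≤-reflexive (List.length-++ (members new st′)))

  size-positive : ∀ {s} (st : St {N}) → 0 < size s st → Σ (Fin N) λ v → st v ≡ s
  size-positive {s} st lt with members s st in e
  ... | v ∷ vs = v , ∈-members⁻ st v (subst (v ∈_) (sym e) (here refl))

  -- A split leaves at least half of the `new` vertices on one side, so the first state on the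
  -- heavy branch with fewer than 2q of them still has q.
  descend : ∀ {w} q {st} → Symmetric ⟦ E ⟧ → (ν : Node w st) → q + q ≤ size new st →
    Σ (St {N}) λ st′ → Node w st′ × st ⊑ st′ × q ≤ size new st′ × size new st′ ≤ q + q
  descend {w} q E-sym (node g₀ sep₀ n₀ le₀) = go g₀ sep₀ n₀ le₀
    where
    Found : St {N} → Set
    Found st = Σ (St {N}) λ st′ → Node w st′ × st ⊑ st′ × q ≤ size new st′ × size new st′ ≤ q + q

    via : ∀ {st st₁} → st ⊑ st₁ → Found st₁ → Found st
    via le (st′ , ν , le′ , p) = st′ , ν , ⊑-trans le le′ , p

    go : ∀ {st m} → Good ⟦ E ⟧ w st m → Separation ⟦ E ⟧ st → Count st m → m ≤ w →
      q + q ≤ size new st → Found st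
    branch : ∀ {st st₁ m} → st ⊑ st₁ → Good ⟦ E ⟧ w st₁ m → Separation ⟦ E ⟧ st₁ → Count st₁ m → m ≤ w →
      q ≤ size new st₁ → Found st

    go {st} g sep n le big with size new st ≤? q + q
    go {st} g sep n le big | yes small = st , node g sep n le , ⊑-refl , ℕ.≤-trans (ℕ.m≤m+n q q) big , small
    go {st} (leaf h) sep n le big | no large =
      let v , e = size-positive {new} st (ℕ.≤-trans (s≤s z≤n) (ℕ.≰⇒> large)) in ⊥-elim (h v e)
    go {st} (intro {st′ = st₁} v e cap up g) sep n le big | no large =
      via le₁ (go g (separation-intro Fin._≟_ up sep) (count-intro Fin._≟_ n e up) cap
        (ℕ.≤-pred (ℕ.≤-trans (ℕ.≰⇒> large) (size-insert st₁ st v λ u p ne → trans (proj₂ up u ne) p))))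
      where
      le₁ : st ⊑ st₁
      le₁ u with u Fin.≟ v
      ... | yes refl = subst (_⊑ₛ st₁ u) (sym e) new⊑
      ... | no ne = subst (st u ⊑ₛ_) (sym (proj₂ up u ne)) ⊑ₛ-refl
    go {st} (forget {st′ = st₁} v e h up g) sep n le big | no large with count-forget Fin._≟_ n e up
    ... | _ , refl , n₁ = via le₁ (go g (separation-forget Fin._≟_ up h sep) n₁ (ℕ.<⇒≤ le)
        (ℕ.≤-trans big (tally-mono (λ u → st u ≟ₛ new) (λ u → st₁ u ≟ₛ new)
          (λ u p → trans (proj₂ up u λ { refl → case trans (sym e) p of λ () }) p) (allFin N))))
      where
      le₁ : st ⊑ st₁
      le₁ u with u Fin.≟ v
      ... | yes refl = subst₂ _⊑ₛ_ (sym e) (sym (proj₁ up)) cur⊑old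
      ... | no ne = subst (st u ⊑ₛ_) (sym (proj₂ up u ne)) ⊑ₛ-refl
    go {st} (split {st₁ = st₁} {st₂} d h g₁ g₂) sep n le big | no large
      with q ≤? size new st₁ | q ≤? size new st₂
    ... | yes p | _ = branch (λ v → Distribute-⊑ (d v)) g₁ (separation-split d h̃ sep) (count-split d n) le p
      where
      h̃ : ∀ u v → st₂ u ≡ new → st₁ v ≡ new → ¬ ⟦ E ⟧ u v
      h̃ u v a b uv = h v u b a (E-sym uv)
    ... | no _ | yes p = branch (λ v → Distribute-⊑ (Distribute-sym (d v))) g₂ (separation-split (Distribute-sym ∘ d) h sep)
        (count-split (Distribute-sym ∘ d) n) le p
    ... | no p₁ | no p₂ = ⊥-elim (large (ℕ.≤-trans
        (size-new-split {st} {st₁} {st₂} λ v e → [ inj₁ ∘ proj₁ , inj₂ ∘ proj₂ ]′ (Distribute-choose (d v) e))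
        (ℕ.+-mono-≤ (ℕ.<⇒≤ (ℕ.≰⇒> p₁)) (ℕ.<⇒≤ (ℕ.≰⇒> p₂)))))
    branch {st} {st₁} le₁ g sep n le p with q + q ≤? size new st₁
    ... | yes big = via le₁ (go g sep n le big)
    ... | no small = st₁ , node g sep n le , le₁ , p , ℕ.<⇒≤ (ℕ.≰⇒> small)

  node-chain : ∀ {w} q {st} → Symmetric ⟦ E ⟧ → Node w st → chainThreshold w q ≤ size new st →
    Σ (St {N}) (Chain w q st)
  node-chain zero {st} E-sym ν le = st , []
  node-chain {w} (suc q) {st} E-sym ν le
    with descend (chainThreshold w q) E-sym ν (ℕ.≤-trans (ℕ.m≤m+n _ (suc w)) le)
  ... | st₁ , ν₁ , le₁ , lower , upper with Fin.any? (λ v → (st v ≟ₛ new) ×-dec (st₁ v ≟ₛ old))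
  ...   | yes lost = let st₂ , C = node-chain q E-sym ν₁ lower in
          st₂ , (((le₁ , lost) , Node.sep ν₁ , node-order ν₁) ∷ C)
  ...   | no none = ⊥-elim (ℕ.<⇒≱ (ℕ.≤-trans
          (ℕ.≤-trans (s≤s (ℕ.+-mono-≤ upper (node-order ν₁))) (ℕ.≤-reflexive (sym (ℕ.+-suc _ w)))) le)
          (size-new-cur {st} {st₁} stays))
    where
    stays : ∀ v → st v ≡ new → st₁ v ≡ new ⊎ st₁ v ≡ cur
    stays v e with st₁ v in e₁
    ... | new = inj₁ refl
    ... | cur = inj₂ refl
    ... | old = ⊥-elim (none (v , e , e₁))

  data Linked (r : ℕ) : ℕ → St {N} → Set where
    [_]      : ∀ {st} → Separation ⟦ E ⟧ st × size cur st ≡ r → Linked r 0 st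
    _∷⟨_,_⟩_ : ∀ {m st st₁} → Separation ⟦ E ⟧ st × size cur st ≡ r → st ≪ st₁ → Link E st st₁ →
               Linked r m st₁ → Linked r (suc m) st

  module _ (E-sym : Symmetric ⟦ E ⟧) where

    tight-linked : ∀ {w m st st′} → Chain w m st st′ → Separation ⟦ E ⟧ st → size cur st ≤ w →
      Tight E w st st′ → DN (Linked w m st)
    tight-linked {w} {st = st} [] sep le tight =
      pure [ sep , ℕ.≤-antisym le (tight st sep ⊑-refl ⊑-refl) ]
    tight-linked {w} {st = st} ((lt , sep₁ , le₁) ∷ C) sep le tight = do
      L ← menger _ E-sym ℕ.≤-refl sep sep₁ (proj₁ lt) order order₁
            (λ st sep p q → tight st sep p (⊑-trans q (chain-⊑ C)))
      K ← tight-linked C sep₁ le₁ (λ st sep p → tight st sep (⊑-trans (proj₁ lt) p))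
      pure ((sep , order) ∷⟨ lt , L ⟩ K)
      where
      order = ℕ.≤-antisym le (tight _ sep ⊑-refl (⊑-trans (proj₁ lt) (chain-⊑ C)))
      order₁ = ℕ.≤-antisym le₁ (tight _ sep₁ (proj₁ lt) (chain-⊑ C))

    LinkedAbove : ℕ → ℕ → St {N} → Set
    LinkedAbove w m st = Σ ℕ λ r → (r ≤ w) × Σ (St {N}) λ st′ → st ⊑ st′ × Linked r m st′

    above-⊑ : ∀ {w m st st₁} → st ⊑ st₁ → LinkedAbove w m st₁ → LinkedAbove w m st
    above-⊑ le (r , p , st′ , q , L) = r , p , st′ , ⊑-trans le q , L

    -- Cut the chain into blocks. A block without a smaller separation is linked by Menger's
    -- theorem; if every block contains one, these form a chain of smaller order.
    smaller-chain : ∀ {w m} q {st₀ st st′} → st₀ ⊑ st → Chain (suc w) (q * suc m) st st′ →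
      DN (LinkedAbove (suc w) m st₀ ⊎ Σ (St {N}) (Chain w q st₀))
    smaller-chain zero le C = pure (inj₂ (_ , []))
    smaller-chain {w} {m} (suc q) {st₀} {st} le (_∷_ {st₁ = st₁} (lt , sep₁ , le₁) C) with chain-split m C
    ... | st₂ , C₁ , C₂ = do
      yes (st₃ , sep₃ , le₃ , above , below) ← lem (Σ (St {N}) λ st₃ →
            Separation ⟦ E ⟧ st₃ × size cur st₃ ≤ w × st₁ ⊑ st₃ × st₃ ⊑ st₂)
        where no none → do
                L ← tight-linked C₁ sep₁ le₁ λ st₃ sep₃ p q → ℕ.≰⇒> λ le₃ → none (st₃ , sep₃ , le₃ , p , q)
                pure (inj₁ (suc w , ℕ.≤-refl , st₁ , ⊑-trans le (proj₁ lt) , L))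
      inj₂ (st₄ , C₃) ← smaller-chain {m = m} q below C₂
        where inj₁ found → pure (inj₁ (above-⊑ (⊑-trans le (⊑-trans (proj₁ lt) above)) found))
      pure (inj₂ (st₄ , ((≪-⊑ (⊑-≪ le lt) above , sep₃ , le₃) ∷ C₃)))

    linked-chain : ∀ w m {st st′} → Chain w (chainLength w m) st st′ → DN (LinkedAbove w m st)
    -- Order 0 cannot be undercut, so every chain of such separations is tight.
    linked-chain zero m (_∷_ {st₁ = st₁} (lt , sep₁ , le₁) C) = do
      L ← tight-linked C sep₁ le₁ λ _ _ _ _ → z≤n
      pure (0 , z≤n , st₁ , proj₁ lt , L)
    linked-chain (suc w) m C = do
      inj₂ (_ , C′) ← smaller-chain {m = m} (chainLength w m) ⊑-refl C
        where inj₁ found → pure found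
      r , p , rest ← linked-chain w m C′
      pure (r , ℕ.m≤n⇒m≤1+n p , rest)

-- Bounding minimal obstructions

-- The type of a cut is the set of protocols that its `old` side implements.
typeCount : ℕ → ℕ → ℕ
typeCount c r = 2 ^ length (protocols r c)

-- A sum over all orders up to the second argument, since the order of the linked chain is not known
-- in advance.
linkedLength : ℕ → ℕ → ℕ
linkedLength c zero = typeCount c zero
linkedLength c (suc r) = linkedLength c r + typeCount c (suc r)

typeCount-≤ : ∀ c {r w} → r ≤ w → typeCount c r ≤ linkedLength c w
typeCount-≤ c {w = zero} z≤n = ℕ.≤-refl
typeCount-≤ c {w = suc w} le with ℕ.m≤n⇒m<n∨m≡n le
... | inj₁ (s≤s lt) = ℕ.≤-trans (typeCount-≤ c lt) (ℕ.m≤m+n _ _)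
... | inj₂ refl = ℕ.m≤n+m (typeCount c (suc w)) (linkedLength c w)

-- The width is `suc c` because a graph that becomes good by deletion of one vertex has a derivation
-- with bags of that size.
obstructionBound : ℕ → ℕ
obstructionBound c = chainThreshold (suc c) (chainLength (suc c) (linkedLength c (suc c)))

module _ {N : ℕ} where

  ≼-trans : {E₂ E₁ E : Rel {N}} → E₂ ≼ E₁ → E₁ ≼ E → E₂ ≼ E
  ≼-trans R (sub h) = ≼-sub R h
  ≼-trans R (lift x y v ne nx ny p q h R′) = lift x y v ne nx ny p q h (≼-trans R R′)

  module _ {E : Rel {N}} {r : ℕ} where
    record Cut : Set where
      field
        st     : St {N}
        ℓ      : Fin r → Fin N
        labels : Labels st ℓ
        sep    : Separation ⟦ E ⟧ st

    Before : Cut → Cut → Set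
    Before p q = _≪_ E (Cut.st p) (Cut.st q) × LabelledLink E (Cut.st p) (Cut.ℓ p) (Cut.st q) (Cut.ℓ q)

    before-trans : ∀ {p q s} → Before p q → Before q s → Before p s
    before-trans (a , L) (b , K) = ≪-⊑ E a (proj₁ b) , labelled-trans L K

    cuts : ∀ {m st} → Linked E r m st → (ℓ : Fin r → Fin N) → Labels st ℓ →
      Σ (Fin (suc m) → Cut) λ f → (Cut.st (f zero) ≡ st) × (Cut.ℓ (f zero) ≡ ℓ) × (∀ i j → i Fin.< j → Before (f i) (f j))
    cuts [ sep , _ ] ℓ L = (λ _ → record { labels = L ; sep = sep }) , refl , refl , λ { zero zero () }
    cuts (_∷⟨_,_⟩_ {m} (sep , _) lt K C) ℓ L with label-link L K
    ... | ℓ₁ , L₁ , K₁ with cuts C ℓ₁ L₁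
    ... | f , refl , refl , ordered = g , refl , refl , ordered′
      where
      p : Cut
      p = record { labels = L ; sep = sep }
      g : Fin (suc (suc m)) → Cut
      g zero = p
      g (suc i) = f i
      first : ∀ j → Before p (f j)
      first zero = lt , K₁
      first (suc j) = before-trans {p} {f zero} {f (suc j)} (lt , K₁) (ordered zero (suc j) (s≤s z≤n))
      ordered′ : ∀ i j → i Fin.< j → Before (g i) (g j)
      ordered′ zero (suc j) _ = first j
      ordered′ (suc i) (suc j) (s≤s le) = ordered i j le

  linked-head : ∀ {E : Rel {N}} {r m} {st : St {N}} → Linked E r m st → Separation ⟦ E ⟧ st × size cur st ≡ r
  linked-head [ p ] = p
  linked-head (p ∷⟨ _ , _ ⟩ _) = p

  bit : ∀ {A : Set} → Dec A → Fin 2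
  bit (yes _) = suc zero
  bit (no _) = zero

  bit-transport : ∀ {A B : Set} (a : Dec A) (b : Dec B) → bit a ≡ bit b → A → B
  bit-transport (no na) b e x = ⊥-elim (na x)
  bit-transport (yes _) (yes y) e x = y

  -- `gone` pays for the recursion in `obstruction`, and `F-edge` keeps all edges of F on live
  -- vertices.
  record Smaller (c : ℕ) (E : Rel {N}) (st : St {N}) : Set where
    field
      F       : Rel {N}
      minor   : F ≼ E
      F-sym   : Symmetric ⟦ F ⟧
      F-irr   : Irreflexive F
      bad     : ¬ Good ⟦ F ⟧ c (λ _ → new) 0
      gone    : Fin N
      was-new : st gone ≡ new
      F-edge  : ∀ {u w} → ⟦ F ⟧ u w → u ≢ gone × Σ (Fin N) (⟦ E ⟧ u)

  -- There are more cuts than types, so two cuts have `old` sides of the same type. If contracting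
  -- the stretch between them gave a good graph, exchanging these sides would make E good.
  shrink : ∀ {c} {E : Rel {N}} {r m} {st : St {N}} → Symmetric ⟦ E ⟧ → Irreflexive E → Linked E r m st → typeCount c r ≤ m →
    ¬ Good ⟦ E ⟧ c (λ _ → new) 0 → DN (Smaller c E st)
  shrink {c} {E} {r} {m} {st} E-sym E-irr C enough bad with linked-head C
  ... | _ , refl with labelling st
  ... | ℓ , L with cuts C ℓ L
  ... | f , at-zero , _ , ordered = do
    -- Whether a protocol is implemented is not decided; for finitely many cuts and protocols the
    -- answers are available together under double negation.
    types ← DN-Fin λ i → DN-Fin λ k → lem (Implements (f i) k)
    let i , j , i<j , same = Fin.pigeonhole (s≤s enough) (λ i → Fin.funToFin (λ k → bit (types i k)))
        lt , K = ordered i j i<j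
        F , R , Con = contract (Cut.labels (f i)) E-sym ⊑ˢ (Cut.labels (f i)) (initial (f i)) K
        gone , g-new , g-old = proj₂ lt
        agree : ∀ k → bit (types i k) ≡ bit (types j k)
        agree k = trans (sym (Fin.finToFun-funToFin (λ k → bit (types i k)) k))
          (trans (cong (λ z → Fin.finToFun z k) same) (Fin.finToFun-funToFin (λ k → bit (types j k)) k))
    pure record
      { F = F ; minor = R ; F-sym = Contracted.F-sym Con ; F-irr = Contracted.F-irr Con
      ; bad = λ g → bad (good-exchange E E-sym (Cut.labels (f i)) (Cut.labels (f j)) (proj₁ lt) Con
          (Cut.sep (f j)) (exchange types agree) g)
      ; gone = gone
      ; was-new = first i gone g-new
      ; F-edge = λ e → let alive , x = Contracted.F-alive Con e in
          (λ { refl → alive (g-new , g-old) }) , x }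
    where
    ps = protocols r c
    Implements : Cut {E} {r} → Fin (length ps) → Set
    Implements p k = Impl c (half E E-sym old (Cut.st p) (Cut.ℓ p)) true (List.lookup ps k) (allNew r) 0
      (start {r = r} E E-sym old (Cut.st p)) 0 0
    ⊑ˢ : ∀ {s : St {N}} → s ⊑ s
    ⊑ˢ = ⊑-refl E
    initial : ∀ p → Contracted {E = E} (Cut.labels p) (Cut.st p) (Cut.ℓ p) E
    initial p = record
      { F-sym = E-sym ; F-irr = E-irr ; F-keep = λ e _ _ → e
      ; F-alive = λ {u} {w} e → (λ { (a , b) → case trans (sym a) b of λ () }) , w , e
      ; F-link = λ t → inj₁ refl ; unmoved = λ t _ → refl }
    first : ∀ i v → Cut.st (f i) v ≡ new → st v ≡ new
    first zero v e = trans (sym (cong (λ s → s v) at-zero)) e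
    first (suc i) v e = first zero v (⊑ₛ-new (proj₁ (proj₁ (ordered zero (suc i) (s≤s z≤n))) v) e)
    exchange : ∀ {i j} (types : ∀ i k → Dec (Implements (f i) k)) → (∀ k → bit (types i k) ≡ bit (types j k)) →
      ∀ p → p ∈ ps → Impl c (half E E-sym old (Cut.st (f i)) (Cut.ℓ (f i))) true p (allNew r) 0
        (start {r = r} E E-sym old (Cut.st (f i))) 0 0 →
      Impl c (half E E-sym old (Cut.st (f j)) (Cut.ℓ (f j))) true p (allNew r) 0
        (start {r = r} E E-sym old (Cut.st (f j))) 0 0
    exchange {i} {j} types agree p p∈ impl with Any.index p∈ | Any.lookup-index p∈
    ... | k | refl = bit-transport (types i k) (types j k) (agree k) impl

  -- The live vertices of L are those marked `new`; all others are isolated.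
  record Live (E : Rel {N}) (L : St {N}) : Set where
    field
      E-sym : Symmetric ⟦ E ⟧
      E-irr : Irreflexive E
      L-cur : ∀ u → L u ≢ cur
      edges : ∀ {u w} → ⟦ E ⟧ u w → L u ≡ new

  -- v stays in the bag to the end, so no condition on its edges ever arises; the price is one place
  -- in each bag.
  good-add-vertex : ∀ {E : Rel {N}} {c v} {st : St {N}} {m} {st′ : St {N}} → Good ⟦ remove E v ⟧ c st m → st v ≡ old → st′ v ≡ cur →
    (∀ u → u ≢ v → st′ u ≡ st u) → Good ⟦ E ⟧ (suc c) st′ (suc m)
  good-add-vertex {E} {c} {v} {st′ = st₀} (leaf h) ev ec same = leaf no-new
    where
    no-new : ∀ u → st₀ u ≢ new
    no-new u e with u Fin.≟ v
    ... | yes refl = case trans (sym ec) e of λ ()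
    ... | no ne = h u (trans (sym (same u ne)) e)
  good-add-vertex {E} {v = v} {st} {st′ = st₀} (intro {st′ = st₁} u eu le up g) ev ec same =
    intro u (trans (same u u≢v) eu) (s≤s le) (update-Update Fin._≟_ st₀ u cur)
      (good-add-vertex g (trans (proj₂ up v (u≢v ∘ sym)) ev) (trans (proj₂ up₀ v (u≢v ∘ sym)) ec) same₁)
    where
    up₀ = update-Update Fin._≟_ st₀ u cur
    u≢v : u ≢ v
    u≢v refl = case trans (sym ev) eu of λ ()
    same₁ : ∀ w → w ≢ v → update Fin._≟_ st₀ u cur w ≡ st₁ w
    same₁ w ne with w Fin.≟ u
    ... | yes refl = sym (proj₁ up)
    ... | no nu = trans (same w ne) (sym (proj₂ up w nu))
  good-add-vertex {E} {v = v} {st} {st′ = st₀} (forget {st′ = st₁} u eu h up g) ev ec same =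
    forget u (trans (same u u≢v) eu) blocked (update-Update Fin._≟_ st₀ u old)
      (good-add-vertex g (trans (proj₂ up v (u≢v ∘ sym)) ev) (trans (proj₂ up₀ v (u≢v ∘ sym)) ec) same₁)
    where
    up₀ = update-Update Fin._≟_ st₀ u old
    u≢v : u ≢ v
    u≢v refl = case trans (sym ev) eu of λ ()
    same₁ : ∀ w → w ≢ v → update Fin._≟_ st₀ u old w ≡ st₁ w
    same₁ w ne with w Fin.≟ u
    ... | yes refl = sym (proj₁ up)
    ... | no nu = trans (same w ne) (sym (proj₂ up w nu))
    blocked : ∀ w → st₀ w ≡ new → ¬ ⟦ E ⟧ u w
    blocked w ew uw with w Fin.≟ v
    ... | yes refl = case trans (sym ec) ew of λ ()
    ... | no ne = h w (trans (sym (same w ne)) ew) (remove⁺ E v uw u≢v ne)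
  good-add-vertex {E} {v = v} {st} {st′ = st₀} (split {st₁ = st₁} {st₂} d h g₁ g₂) ev ec same =
    split {st₁ = update Fin._≟_ st₁ v cur} {st₂ = update Fin._≟_ st₂ v cur} d′ separated
      (good-add-vertex g₁ (Distribute-old⁻ (d v) ev) (proj₁ up₁) (proj₂ up₁))
      (good-add-vertex g₂ (Distribute-old⁻ (Distribute-sym (d v)) ev) (proj₁ up₂) (proj₂ up₂))
    where
    up₁ = update-Update Fin._≟_ st₁ v cur
    up₂ = update-Update Fin._≟_ st₂ v cur
    d′ : ∀ w → Distribute (st₀ w) (update Fin._≟_ st₁ v cur w) (update Fin._≟_ st₂ v cur w)
    d′ w with w Fin.≟ v
    ... | yes refl rewrite ec = current
    ... | no ne rewrite same w ne = d w
    separated : ∀ u w → update Fin._≟_ st₁ v cur u ≡ new → update Fin._≟_ st₂ v cur w ≡ new → ¬ ⟦ E ⟧ u w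
    separated u w p q uw with u Fin.≟ v | w Fin.≟ v
    ... | yes _ | _ = case p of λ ()
    ... | no _ | yes _ = case q of λ ()
    ... | no nu | no nw = h u w p q (remove⁺ E v uw nu nw)

  good-shrink-state : ∀ {E : Rel {N}} {c st} → Symmetric ⟦ E ⟧ → (∀ v → st v ≢ cur) →
    Good ⟦ E ⟧ c (λ _ → new) 0 → Good ⟦ E ⟧ c st 0
  good-shrink-state {E} E-sym nc g = good-minor Fin._≟_ Fin._≟_ E-sym M g (λ _ _ ()) (count-empty λ _ ())
    (record { center-new = λ u _ → u , refl , refl ; fibre-new = λ _ _ _ _ → refl
            ; fibre-cur = λ u e → ⊥-elim (nc u e) })
    (count-empty nc)
    where
    M : MinorModel ⟦ E ⟧ ⟦ E ⟧
    M = record { φ = just ; center = just ; connected = λ { S u _ _ _ refl refl → refl }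
               ; edge = λ e → _ , _ , refl , refl , e }

  -- `neighbor` rules out isolated live vertices, because an `Embedding` reserves an edge at every
  -- point.
  record Obstruction (c : ℕ) (E : Rel {N}) : Set where
    field
      F        : Rel {N}
      L        : St {N}
      minor    : F ≼ E
      live     : Live F L
      neighbor : ∀ u → L u ≡ new → Σ (Fin N) (⟦ F ⟧ u)
      small    : size new L ≤ obstructionBound c
      bad      : ¬ Good ⟦ F ⟧ c (λ _ → new) 0

  obstruction-≼ : ∀ {c E₁ E} → E₁ ≼ E → Obstruction c E₁ → Obstruction c E
  obstruction-≼ R O = record
    { F = F ; L = L ; minor = ≼-trans minor R ; live = live ; neighbor = neighbor ; small = small ; bad = bad }
    where open Obstruction O

  module _ (L : St {N}) (v : Fin N) where
    kill : St {N}
    kill = update Fin._≟_ L v old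

    kill-cur : (∀ u → L u ≢ cur) → ∀ u → kill u ≢ cur
    kill-cur h u e with u Fin.≟ v
    ... | no _ = h u e

    kill-new : ∀ u → L u ≡ new → u ≢ v → kill u ≡ new
    kill-new u e ne = trans (proj₂ (update-Update Fin._≟_ L v old) u ne) e

    kill-size : L v ≡ new → size new kill < size new L
    kill-size e = tally-strict (λ u → kill u ≟ₛ new) (λ u → L u ≟ₛ new) kill-⊆ (∈.∈-allFin v)
      (λ p → case trans (sym (proj₁ (update-Update Fin._≟_ L v old))) p of λ ()) e
      where
      kill-⊆ : ∀ u → kill u ≡ new → L u ≡ new
      kill-⊆ u p with u Fin.≟ v
      ... | no _ = p

  -- Each recursive call kills a live vertex: an isolated one, one whose deletion leaves the graph
  -- bad, or one swept between two equivalent cuts. In the last case a vertex v whose deletion makes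
  -- the graph good provides the derivation with bags of size `suc c`.
  obstruction : ∀ {c} k {E L} → Live E L → size new L < k → ¬ Good ⟦ E ⟧ c (λ _ → new) 0 → DN (Obstruction c E)
  obstruction {c} (suc k) {E} {L} Λ (s≤s lt) bad
    with Fin.any? (λ u → (L u ≟ₛ new) ×-dec ¬? (Fin.any? (λ w → E u w Bool.≟ true)))
  ... | yes (v , ev , isolated) = obstruction k
          (record { E-sym = E-sym ; E-irr = E-irr ; L-cur = kill-cur L v L-cur
                  ; edges = λ {u} {w} e → kill-new L v u (edges e) λ { refl → isolated (w , e) } })
          (ℕ.≤-trans (kill-size L v ev) lt) bad
    where
    open Live Λ
  ... | no none with size new L ≤? obstructionBound c
  ...   | yes small = pure record
            { F = E ; L = L ; minor = sub id ; live = Λ ; neighbor = neighbor ; small = small ; bad = bad }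
    where
    neighbor : ∀ u → L u ≡ new → Σ (Fin N) (⟦ E ⟧ u)
    neighbor u e with Fin.any? (λ w → E u w Bool.≟ true)
    ... | yes p = p
    ... | no np = ⊥-elim (none (u , e , np))
  ...   | no large with size-positive E L (ℕ.≤-trans (s≤s z≤n) (ℕ.≰⇒> large))
  ...     | v , ev = do
    yes g ← lem (Good ⟦ remove E v ⟧ c (λ _ → new) 0)
      where no bad′ → do
              O ← obstruction k
                (record { E-sym = remove-sym {E = E} v E-sym ; E-irr = λ u e → E-irr u (proj₁ (remove⁻ E v e))
                        ; L-cur = kill-cur L v L-cur
                        ; edges = λ {u} e → let p , ne , _ = remove⁻ E v e in kill-new L v u (edges p) ne })
                (ℕ.≤-trans (kill-size L v ev) lt) bad′
              pure (obstruction-≼ (sub λ e → proj₁ (remove⁻ E v e)) O)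
    let g₀ = good-shrink-state {E = remove E v} (remove-sym {E = E} v E-sym) (kill-cur L v L-cur) g
        up = update-Update Fin._≟_ L v cur
        upo = update-Update Fin._≟_ L v old
        -- v is introduced at the root and kept in all bags.
        g₁ : Good ⟦ E ⟧ (suc c) L 0
        g₁ = intro v ev (s≤s z≤n) up (good-add-vertex g₀ (proj₁ upo) (proj₁ up)
               λ u ne → trans (proj₂ up u ne) (sym (proj₂ upo u ne)))
        _ , C = node-chain E (chainLength (suc c) (linkedLength c (suc c))) E-sym
                  (node g₁ (λ u w p q e → case trans (sym p) (edges e) of λ ()) (count-empty L-cur) z≤n)
                  (ℕ.<⇒≤ (ℕ.≰⇒> large))
    r , r≤ , st , above , K ← linked-chain E E-sym (suc c) (linkedLength c (suc c)) C
    S ← shrink E-sym E-irr K (typeCount-≤ c r≤) bad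
    let open Smaller S
    O ← obstruction k
          (record { E-sym = F-sym ; E-irr = F-irr ; L-cur = kill-cur L gone L-cur
                  ; edges = λ {u} e → let ne , w , p = F-edge e in kill-new L gone u (edges p) ne })
          (ℕ.≤-trans (kill-size L gone (⊑ₛ-new (above gone) was-new)) lt) (Smaller.bad S)
    pure (obstruction-≼ minor O)
    where
    open Live Λ

-- Graphs as patterns

true-ext : ∀ {a b : Bool} → (a ≡ true → b ≡ true) → (b ≡ true → a ≡ true) → a ≡ b
true-ext {true} {true} f g = refl
true-ext {false} {false} f g = refl
true-ext {true} {false} f g = sym (f refl)
true-ext {false} {true} f g = g refl

∧-true : ∀ {a b} → a ∧ b ≡ true → a ≡ true × b ≡ true
∧-true {true} {true} e = refl , refl

∧-true⁺ : ∀ {a b} → a ≡ true → b ≡ true → a ∧ b ≡ true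
∧-true⁺ refl refl = refl

⌊⌋-true : ∀ {A : Set} (d : Dec A) → ⌊ d ⌋ ≡ true → A
⌊⌋-true (yes a) _ = a

⌊⌋-true⁺ : ∀ {A : Set} (d : Dec A) → A → ⌊ d ⌋ ≡ true
⌊⌋-true⁺ (yes _) _ = refl
⌊⌋-true⁺ (no na) a = ⊥-elim (na a)

T⇒true : ∀ {b} → T b → b ≡ true
T⇒true {true} _ = refl

module _ {m : ℕ} where
  -- Symmetrised and freed of loops, so that every Boolean matrix gives a graph and the graphs on m
  -- vertices can be listed.
  graphOf : Vec (Vec Bool m) m → Rel {m}
  graphOf M u v = not ⌊ u Fin.≟ v ⌋ ∧ (lookup (lookup M u) v ∨ lookup (lookup M v) u)

  graphOf-sym : ∀ M → Symmetric ⟦ graphOf M ⟧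
  graphOf-sym M {u} {v} e = trans (cong₂ _∧_ (cong not (⌊⌋-sym Fin._≟_ v u)) (Bool.∨-comm (lookup (lookup M v) u) _)) e

  graphOf-irr : ∀ M → Irreflexive (graphOf M)
  graphOf-irr M v e with v Fin.≟ v
  ... | no ne = ne refl

  -- The part of u has one point (u , v) for each possible neighbour v, so that every point lies
  -- on at most one negative edge.
  patternNeg : Rel {m} → Fin m × Fin m → Fin m × Fin m → Bool
  patternNeg H (u , v) (u′ , v′) = (⌊ u′ Fin.≟ v ⌋ ∧ ⌊ v′ Fin.≟ u ⌋) ∧ H u v

  patternNeg⁻ : ∀ H x y → patternNeg H x y ≡ true → y ≡ (proj₂ x , proj₁ x) × ⟦ H ⟧ (proj₁ x) (proj₂ x)
  patternNeg⁻ H (u , v) (u′ , v′) e with ∧-true e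
  ... | p , h with ∧-true p
  ... | q , r = cong₂ _,_ (⌊⌋-true (u′ Fin.≟ v) q) (⌊⌋-true (v′ Fin.≟ u) r) , h

  patternNeg⁺ : ∀ H u v → ⟦ H ⟧ u v → patternNeg H (u , v) (v , u) ≡ true
  patternNeg⁺ H u v h = ∧-true⁺ (∧-true⁺ (⌊⌋-true⁺ (v Fin.≟ v) refl) (⌊⌋-true⁺ (u Fin.≟ u) refl)) h

  graphPattern : Vec (Vec Bool m) m → Pattern
  graphPattern M = record
    { Point = Fin m × Fin m ; Part = Fin m
    ; _≟pt_ = Product.≡-dec Fin._≟_ Fin._≟_ ; _≟pa_ = Fin._≟_
    ; part = proj₁ ; pos = λ _ _ → false ; neg = patternNeg H
    ; pos-sym = λ _ _ → refl
    ; neg-sym = λ x y → true-ext (flip x y) (flip y x)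
    ; pos-irr = λ _ _ ()
    ; neg-irr = λ x y e p → let q , h = patternNeg⁻ H x y e in
        graphOf-irr M (proj₁ x) (subst (⟦ H ⟧ (proj₁ x)) (trans (sym (cong proj₁ q)) (sym p)) h) }
    where
    H = graphOf M
    flip : ∀ x y → patternNeg H x y ≡ true → patternNeg H y x ≡ true
    flip (u , v) y e with patternNeg⁻ H (u , v) y e
    ... | refl , h = patternNeg⁺ H v u (graphOf-sym M h)

module _ {N : ℕ} where
  -- `target` is the other end of the edge reserved for a point, so that negative edges of Q can
  -- be realised independently of each other.
  record Embedding (Q : Pattern) (E : Rel {N}) : Set where
    field
      place  : Point Q → Fin N
      target : Point Q → Fin N
      same   : ∀ x y → part Q x ≡ part Q y → place x ≡ place y
      diff   : ∀ x y → part Q x ≢ part Q y → place x ≢ place y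
      edge   : ∀ x → ⟦ E ⟧ (place x) (target x)
      match  : ∀ x y → neg Q x y ≡ true → target x ≡ place y
      no-pos : ∀ x y → pos Q x y ≡ false

  module _ {Q : Pattern} {E₁ E : Rel {N}} (x y v : Fin N) (x≢y : x ≢ y) (x≢v : x ≢ v) (y≢v : y ≢ v)
    (xv : ⟦ E ⟧ x v × ⟦ E ⟧ v x) (yv : ⟦ E ⟧ y v × ⟦ E ⟧ v y)
    (h : ∀ {u w} → ⟦ E₁ ⟧ u w → (⟦ E ⟧ u w × u ≢ v × w ≢ v) ⊎ (u ≡ x × w ≡ y) ⊎ (u ≡ y × w ≡ x))
    (M : Embedding Q E₁) where
    open Embedding M
    private
      XY : Fin N → Fin N → Set
      XY a b = (a ≡ x × b ≡ y) ⊎ (a ≡ y × b ≡ x)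

      -- An edge reserved along xy is turned towards v, even if no negative edge runs along it,
      -- because xy may be missing from E.
      retarget : ∀ a b → ⟦ E₁ ⟧ a b → Σ (Fin N) λ w → ⟦ E ⟧ a w × ((w ≡ v × XY a b) ⊎ (w ≡ b × ¬ XY a b))
      retarget a b e with ((a Fin.≟ x) ×-dec (b Fin.≟ y)) ⊎-dec ((a Fin.≟ y) ×-dec (b Fin.≟ x))
      ... | yes p@(inj₁ (refl , _)) = v , proj₁ xv , inj₁ (refl , p)
      ... | yes p@(inj₂ (refl , _)) = v , proj₁ yv , inj₁ (refl , p)
      ... | no np with h e
      ...   | inj₁ (e′ , _) = b , e′ , inj₂ (refl , np)
      ...   | inj₂ p = ⊥-elim (np p)

      target′ : Point Q → Fin N
      target′ z = proj₁ (retarget (place z) (target z) (edge z))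

      target′-v : ∀ z → XY (place z) (target z) → target′ z ≡ v
      target′-v z p with retarget (place z) (target z) (edge z)
      ... | w , _ , inj₁ (e , _) = e
      ... | w , _ , inj₂ (_ , np) = ⊥-elim (np p)

      target′-keep : ∀ z → ¬ XY (place z) (target z) → target′ z ≡ target z
      target′-keep z np with retarget (place z) (target z) (edge z)
      ... | w , _ , inj₁ (_ , p) = ⊥-elim (np p)
      ... | w , _ , inj₂ (e , _) = e

      edge′ : ∀ z → ⟦ E ⟧ (place z) (target′ z)
      edge′ z = proj₁ (proj₂ (retarget (place z) (target z) (edge z)))

      avoid : ∀ z → place z ≢ v
      avoid z e with h (edge z)
      ... | inj₁ (_ , ne , _) = ne e
      ... | inj₂ (inj₁ (p , _)) = x≢v (trans (sym p) e)
      ... | inj₂ (inj₂ (p , _)) = y≢v (trans (sym p) e)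

      same-part : ∀ z z′ → place z ≡ place z′ → part Q z ≡ part Q z′
      same-part z z′ e with _≟pa_ Q (part Q z) (part Q z′)
      ... | yes p = p
      ... | no np = ⊥-elim (diff z z′ np e)

    -- If x or y carries no point, no negative edge runs along xy, and turning the reserved edges is
    -- enough.
    embedding-keep : ¬ (Σ (Point Q) λ p → Σ (Point Q) λ q → place p ≡ x × place q ≡ y) → Embedding Q E
    embedding-keep none = record
      { place = place ; target = target′ ; same = same ; diff = diff ; edge = edge′
      ; match = λ z z′ e → trans (target′-keep z λ
          { (inj₁ (a , b)) → none (z , z′ , a , trans (sym (match z z′ e)) b)
          ; (inj₂ (a , b)) → none (z′ , z , trans (sym (match z z′ e)) b , a) }) (match z z′ e)
      ; no-pos = no-pos }

    module _ (p q : Point Q) (px : place p ≡ x) (qy : place q ≡ y) where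
      private
        U V : Part Q
        U = part Q p
        V = part Q q
        open Subdiv Q U V using (UV; btw; PosE; NegE; SPoint; end; eq)
        Q′ = subdivide Q U V

        no-PosE : PosE → ⊥
        no-PosE ((a , b) , t) rewrite no-pos a b | Bool.∧-zeroʳ (UV a b) = t

        UV⁺ : ∀ {a b} → part Q a ≡ U → part Q b ≡ V → UV a b ≡ true
        UV⁺ e e′ = ∧-true⁺ (⌊⌋-true⁺ (_≟pa_ Q _ _) e) (⌊⌋-true⁺ (_≟pa_ Q _ _) e′)

        negE : (e : NegE) → let a , b = proj₁ e in place a ≡ x × place b ≡ y × neg Q a b ≡ true
        negE ((a , b) , t) with ∧-true (T⇒true t)
        ... | uv , ng with ∧-true uv
        ... | pa , pb = trans (same a p (⌊⌋-true (_≟pa_ Q _ _) pa)) px ,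
          trans (same b q (⌊⌋-true (_≟pa_ Q _ _) pb)) qy , ng

        place₂ target₂ : SPoint → Fin N
        place₂ (inj₁ z) = place z
        place₂ (inj₂ _) = v
        target₂ (inj₁ z) = target′ z
        target₂ (inj₂ (inj₁ e)) = v
        target₂ (inj₂ (inj₂ (((a , b) , _) , c))) = place (end c a b)

        match₂ : ∀ z z′ → neg Q′ z z′ ≡ true → target₂ z ≡ place₂ z′
        match₂ (inj₁ z) (inj₁ z′) e with ∧-true e
        ... | ng , outside-UV = trans (target′-keep z λ
              { (inj₁ (a , b)) → contra (∧-∨ˡ (UV⁺ (same-part z p (trans a (sym px)))
                                   (same-part z′ q (trans (sym (match z z′ ng)) (trans b (sym qy))))))
              ; (inj₂ (a , b)) → contra (∧-∨ʳ (UV⁺ (same-part z′ p (trans (sym (match z z′ ng)) (trans b (sym px))))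
                                   (same-part z q (trans a (sym qy))))) }) (match z z′ ng)
          where
          ∧-∨ˡ : UV z z′ ≡ true → btw z z′ ≡ true
          ∧-∨ˡ r rewrite r = refl
          ∧-∨ʳ : UV z′ z ≡ true → btw z z′ ≡ true
          ∧-∨ʳ r rewrite r = Bool.∨-zeroʳ (UV z z′)
          contra : btw z z′ ≡ true → ⊥
          contra r with trans (sym (cong not r)) outside-UV
          ... | ()
        match₂ (inj₁ z) (inj₂ (inj₂ (f@((a , b) , t) , false))) e with ⌊⌋-true (_≟pt_ Q z a) e | negE f
        ... | refl | ax , bY , ng = target′-v a (inj₁ (ax , trans (match a b ng) bY))
        match₂ (inj₁ z) (inj₂ (inj₂ (f@((a , b) , t) , true))) e with ⌊⌋-true (_≟pt_ Q z b) e | negE f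
        ... | refl | ax , bY , ng =
          target′-v b (inj₂ (bY , trans (match b a (trans (neg-sym Q b a) ng)) ax))
        match₂ (inj₂ (inj₂ (((a , b) , t) , c))) (inj₁ z) e = cong place (sym (⌊⌋-true (_≟pt_ Q z (end c a b)) e))
        match₂ (inj₂ (inj₁ _)) (inj₁ _) ()
        match₂ (inj₂ (inj₁ _)) (inj₂ _) ()
        match₂ (inj₂ (inj₂ _)) (inj₂ _) ()

        no-pos₂ : ∀ z z′ → pos Q′ z z′ ≡ false
        no-pos₂ (inj₁ z) (inj₁ z′) rewrite no-pos z z′ = refl
        no-pos₂ (inj₁ z) (inj₂ (inj₁ e)) = ⊥-elim (no-PosE e)
        no-pos₂ (inj₁ z) (inj₂ (inj₂ _)) = refl
        no-pos₂ (inj₂ (inj₁ e)) _ = ⊥-elim (no-PosE e)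
        no-pos₂ (inj₂ (inj₂ _)) (inj₁ _) = refl
        no-pos₂ (inj₂ (inj₂ _)) (inj₂ _) = refl

        edge₂ : ∀ z → ⟦ E ⟧ (place₂ z) (target₂ z)
        edge₂ (inj₁ z) = edge′ z
        edge₂ (inj₂ (inj₁ e)) = ⊥-elim (no-PosE e)
        edge₂ (inj₂ (inj₂ (f , false))) = subst (⟦ E ⟧ v) (sym (proj₁ (negE f))) (proj₂ xv)
        edge₂ (inj₂ (inj₂ (f , true))) = subst (⟦ E ⟧ v) (sym (proj₁ (proj₂ (negE f)))) (proj₂ yv)

        same₂ : ∀ z z′ → part Q′ z ≡ part Q′ z′ → place₂ z ≡ place₂ z′
        same₂ (inj₁ z) (inj₁ z′) e = same z z′ (just-injective e)
        same₂ (inj₂ _) (inj₂ _) e = refl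

        diff₂ : ∀ z z′ → part Q′ z ≢ part Q′ z′ → place₂ z ≢ place₂ z′
        diff₂ (inj₁ z) (inj₁ z′) ne = diff z z′ (ne ∘ cong just)
        diff₂ (inj₁ z) (inj₂ _) ne e = avoid z e
        diff₂ (inj₂ _) (inj₁ z) ne e = avoid z (sym e)
        diff₂ (inj₂ _) (inj₂ _) ne e = ne refl

      -- The path x, v, y realises the subdivision at the two parts: the new part is placed on v,
      -- and each of its points aims back at the end to which it is attached.
      embedding-subdivide : Embedding (subdivide Q (part Q p) (part Q q)) E
      embedding-subdivide = record
        { place = place₂ ; target = target₂ ; same = same₂ ; diff = diff₂ ; edge = edge₂
        ; match = match₂ ; no-pos = no-pos₂ }

  -- Every `lift` is answered by at most one subdivision. Whether both x and y carry a point is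
  -- settled under double negation, as the points of a pattern need not be enumerable.
  embedding-≼ : ∀ {P Q} {F E : Rel {N}} → IsSubdivisionOf P Q → Embedding Q F → F ≼ E →
    DN (Σ Pattern λ Q′ → IsSubdivisionOf P Q′ × Embedding Q′ E)
  embedding-≼ S M (sub h) = pure (_ , S , record { Embedding M ; edge = λ z → h (Embedding.edge M z) })
  embedding-≼ S M (lift x y v x≢y x≢v y≢v xv yv h R) = do
    Q , S′ , M′ ← embedding-≼ S M R
    yes (p , q , px , qy) ← lem (Σ (Point Q) λ p → Σ (Point Q) λ q →
          Embedding.place M′ p ≡ x × Embedding.place M′ q ≡ y)
      where no none → pure (Q , S′ , embedding-keep x y v x≢y x≢v y≢v xv yv h M′ none)
    pure (_ , step S′ (part Q p) (part Q q)
      (λ e → x≢y (trans (sym px) (trans (Embedding.same M′ p q e) qy))) ,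
      embedding-subdivide x y v x≢y x≢v y≢v xv yv h M′ p q px qy)

-- Deciding the existence of a tree decomposition

Distribute? : ∀ s s₁ s₂ → Dec (Distribute s s₁ s₂)
Distribute? new new new = no λ ()
Distribute? new new cur = no λ ()
Distribute? new new old = yes left
Distribute? new cur s₂ = no λ ()
Distribute? new old new = yes right
Distribute? new old cur = no λ ()
Distribute? new old old = no λ ()
Distribute? cur new s₂ = no λ ()
Distribute? cur cur new = no λ ()
Distribute? cur cur cur = yes current
Distribute? cur cur old = no λ ()
Distribute? cur old s₂ = no λ ()
Distribute? old new s₂ = no λ ()
Distribute? old cur s₂ = no λ ()
Distribute? old old new = no λ ()
Distribute? old old cur = no λ ()
Distribute? old old old = yes outside

Distribute-absorb : ∀ {s s₁ s₂} → Distribute s s₁ s₂ → s₂ ≢ new → s₁ ≡ s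
Distribute-absorb left _ = refl
Distribute-absorb right ne = ⊥-elim (ne refl)
Distribute-absorb current _ = refl
Distribute-absorb outside _ = refl

dec-Σ : ∀ {A B : Set} → Dec A → (A → Dec B) → Dec (A × B)
dec-Σ (no na) _ = no (na ∘ proj₁)
dec-Σ (yes a) f = map′ (a ,_) proj₂ (f a)

anyVec? : ∀ {n} {P : Vec Status n → Set} → (∀ σ → Dec (P σ)) → Dec (Σ (Vec Status n) P)
anyVec? {n} P? = map′ (λ p → let σ , _ , q = find p in σ , q) (λ { (σ , p) → lose (∈-allVec ∈-allStatus σ) p })
  (Any.any? P? (allVec allStatus n))

module _ {N : ℕ} (E : Rel {N}) (c : ℕ) where
  GoodVec : Vec Status N → ℕ → Set
  GoodVec σ = Good ⟦ E ⟧ c (lookup σ)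

  CanIntro CanForget CanSplit : Vec Status N → ℕ → Set
  CanIntro σ m = Σ (Fin N) λ v → lookup σ v ≡ new × (suc m ≤ c × GoodVec (σ [ v ]≔ cur) (suc m))
  CanForget σ m = Σ (Fin N) λ v → lookup σ v ≡ cur × ((∀ w → lookup σ w ≡ new → ¬ ⟦ E ⟧ v w) ×
    Σ ℕ λ m′ → m ≡ suc m′ × GoodVec (σ [ v ]≔ old) m′)

  -- Both branches get a `new` vertex, so the potential drops in each of them and the search can
  -- descend.
  ProperSplit : (σ σ₁ σ₂ : Vec Status N) → Set
  ProperSplit σ σ₁ σ₂ = (∀ v → Distribute (lookup σ v) (lookup σ₁ v) (lookup σ₂ v)) ×
    (∀ u v → lookup σ₁ u ≡ new → lookup σ₂ v ≡ new → ¬ ⟦ E ⟧ u v) ×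
    (Σ (Fin N) λ u → lookup σ₁ u ≡ new) × (Σ (Fin N) λ v → lookup σ₂ v ≡ new)

  CanSplit σ m = Σ (Vec Status N) λ σ₁ → Σ (Vec Status N) λ σ₂ →
    ProperSplit σ σ₁ σ₂ × (GoodVec σ₁ m × GoodVec σ₂ m)

  Final : Vec Status N → Set
  Final σ = ∀ v → lookup σ v ≢ new

  -- A split with a branch free of `new` vertices leaves the state unchanged in the other branch and
  -- can be skipped; the first step that is not of this kind is returned.
  progress : ∀ {st m} → Good ⟦ E ⟧ c st m → ∀ σ → st ≗ lookup σ →
    Final σ ⊎ CanIntro σ m ⊎ CanForget σ m ⊎ CanSplit σ m
  progress (leaf h) σ e = inj₁ λ v p → h v (trans (e v) p)
  progress (intro {st′ = st′} v p le (q , q′) g) σ e = inj₂ (inj₁ (v , trans (sym (e v)) p , le , Good-resp same g))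
    where
    same : st′ ≗ lookup (σ [ v ]≔ cur)
    same u with u Fin.≟ v
    ... | yes refl = trans q (sym (Vec.lookup∘update u σ cur))
    ... | no ne = trans (q′ u ne) (trans (e u) (sym (Vec.lookup∘update′ ne σ cur)))
  progress (forget {st′ = st′} v p h (q , q′) g) σ e = inj₂ (inj₂ (inj₁
    (v , trans (sym (e v)) p , (λ w r → h w (trans (e w) r)) , _ , refl , Good-resp same g)))
    where
    same : st′ ≗ lookup (σ [ v ]≔ old)
    same u with u Fin.≟ v
    ... | yes refl = trans q (sym (Vec.lookup∘update u σ old))
    ... | no ne = trans (q′ u ne) (trans (e u) (sym (Vec.lookup∘update′ ne σ old)))
  progress {m = m} (split {st₁ = st₁} {st₂} d h g₁ g₂) σ e
    with Fin.any? (λ v → st₁ v ≟ₛ new) | Fin.any? (λ v → st₂ v ≟ₛ new)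
  ... | no none | _ = progress g₂ σ λ v → trans (Distribute-absorb (Distribute-sym (d v)) λ p → none (v , p)) (e v)
  ... | yes _ | no none = progress g₁ σ λ v → trans (Distribute-absorb (d v) λ p → none (v , p)) (e v)
  ... | yes (a , ea) | yes (b , eb) = inj₂ (inj₂ (inj₂ (σ₁ , σ₂ ,
          (distribute ,
           (λ u v p q → h u v (trans (sym (look st₁ u)) p) (trans (sym (look st₂ v)) q)) ,
           (a , trans (look st₁ a) ea) , (b , trans (look st₂ b) eb)) ,
          Good-resp (λ v → sym (look st₁ v)) g₁ , Good-resp (λ v → sym (look st₂ v)) g₂)))
    where
    σ₁ = Vec.tabulate st₁
    σ₂ = Vec.tabulate st₂
    look : ∀ (st : St {N}) v → lookup (Vec.tabulate st) v ≡ st v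
    look st v = Vec.lookup∘tabulate st v
    distribute : ∀ v → Distribute (lookup σ v) (lookup σ₁ v) (lookup σ₂ v)
    distribute v rewrite look st₁ v | look st₂ v | sym (e v) = d v

  -- Exhaustive search over the steps named by `progress`; every one of them lowers the potential,
  -- which bounds the depth.
  good? : ∀ k σ m → potential σ < k → Dec (GoodVec σ m)
  good? (suc k) σ m (s≤s lt)
    with Fin.all? (λ v → ¬? (lookup σ v ≟ₛ new))
       ⊎-dec (intro? ⊎-dec (forget? m ⊎-dec split?))
    where
    next : ∀ v {s s′} → lookup σ v ≡ s → weight s′ < weight s → potential (σ [ v ]≔ s′) < k
    next v e le = ℕ.<-≤-trans (potential-update σ v e le) lt
    intro? : Dec (CanIntro σ m)
    intro? = Fin.any? λ v → dec-Σ (lookup σ v ≟ₛ new) λ e →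
      (suc m ≤? c) ×-dec good? k (σ [ v ]≔ cur) (suc m) (next v e (s≤s (s≤s z≤n)))
    forget? : ∀ m → Dec (CanForget σ m)
    forget? zero = no λ { (_ , _ , _ , _ , () , _) }
    forget? (suc m) = Fin.any? λ v → dec-Σ (lookup σ v ≟ₛ cur) λ e →
      Fin.all? (λ w → (lookup σ w ≟ₛ new) →-dec ¬? (E v w Bool.≟ true)) ×-dec
      map′ (λ g → m , refl , g) (λ { (_ , refl , g) → g }) (good? k (σ [ v ]≔ old) m (next v e (s≤s z≤n)))
    proper? : ∀ σ₁ σ₂ → Dec (ProperSplit σ σ₁ σ₂)
    proper? σ₁ σ₂ = Fin.all? (λ v → Distribute? (lookup σ v) (lookup σ₁ v) (lookup σ₂ v)) ×-dec
      (Fin.all? (λ u → Fin.all? λ v →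
        (lookup σ₁ u ≟ₛ new) →-dec ((lookup σ₂ v ≟ₛ new) →-dec ¬? (E u v Bool.≟ true))) ×-dec
      (Fin.any? (λ u → lookup σ₁ u ≟ₛ new) ×-dec Fin.any? (λ v → lookup σ₂ v ≟ₛ new)))
    split? : Dec (CanSplit σ m)
    split? = anyVec? λ σ₁ → anyVec? λ σ₂ → dec-Σ (proper? σ₁ σ₂)
      λ { (d , _ , (u , eu) , (v , ev)) →
        good? k σ₁ m (ℕ.<-≤-trans (potential-strict σ σ₁ (λ t → Distribute-weight (d t)) v (Distribute-weight-< (d v) ev)) lt)
        ×-dec
        good? k σ₂ m (ℕ.<-≤-trans (potential-strict σ σ₂ (λ t → Distribute-weight (Distribute-sym (d t))) u
          (Distribute-weight-< (Distribute-sym (d u)) eu)) lt) }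
  ... | no none = no λ g → none (progress g σ λ _ → refl)
  ... | yes (inj₁ fin) = yes (leaf fin)
  ... | yes (inj₂ (inj₁ (v , e , le , g))) = yes (intro v e le (lookup-Update σ v cur) g)
  ... | yes (inj₂ (inj₂ (inj₁ (v , e , h , m′ , refl , g)))) = yes (forget v e h (lookup-Update σ v old) g)
  ... | yes (inj₂ (inj₂ (inj₂ (σ₁ , σ₂ , (d , h , _) , g₁ , g₂)))) = yes (split d h g₁ g₂)

  decompose? : Dec (Good ⟦ E ⟧ c (λ _ → new) 0)
  decompose? = map′ (Good-resp lookup-allNew) (Good-resp (sym ∘ lookup-allNew))
    (good? _ (allNew N) 0 ℕ.≤-refl)

-- Numbered tree decompositions

module _ {N : ℕ} where
  -- The bag size is left to whatever number counts the bag, so states can be compared without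
  -- computing it.
  GoodFor : (Fin N → Fin N → Set) → ℕ → St {N} → Set
  GoodFor E c st = ∀ {m} → Count st m → Good E c st m

  AtMost : ℕ → (Fin N → Set) → Set
  AtMost c P = Σ (List (Fin N)) λ xs → length xs ≤ c × (∀ v → P v → v ∈ xs)

  count-AtMost : ∀ {st m c} {P : Fin N → Set} → Count st m → AtMost c P → (∀ v → st v ≡ cur → P v) → m ≤ c
  count-AtMost (ys , u , refl , _ , g) (xs , le , f) h =
    ℕ.≤-trans (unique-⊆-length u λ v v∈ → f v (h v (g v v∈))) le

  intro-all : ∀ {E c st′} → AtMost c (λ v → st′ v ≡ cur) → GoodFor E c st′ → ∀ {st} →
    (∀ v → st v ≡ st′ v ⊎ (st v ≡ new × st′ v ≡ cur)) → GoodFor E c st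
  intro-all {E} {c} {st′} bound good h = go (allFin N) h λ v ne → ⊥-elim (ne (∈.∈-allFin v))
    where
    go : ∀ xs {st} → (∀ v → st v ≡ st′ v ⊎ (st v ≡ new × st′ v ≡ cur)) →
      (∀ v → v ∉ xs → st v ≡ st′ v) → GoodFor E c st
    go [] {st} h e n = Good-resp (λ v → sym (e v λ ()))
      (good (count-resp (λ v → trans (sym (e v λ ()))) (λ v → trans (e v λ ())) n))
    go (x ∷ xs) {st} h e n with h x
    ... | inj₁ same = go xs h (λ v v∉ → case v Fin.≟ x of λ
            { (yes refl) → same ; (no ne) → e v λ { (here p) → ne p ; (there p) → v∉ p } }) n
    ... | inj₂ (p , q) = intro x p (count-AtMost n₁ bound cur-bound) up (go xs h₁ e₁ n₁)
      where
      st₁ = update Fin._≟_ st x cur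
      up = update-Update Fin._≟_ st x cur
      n₁ = count-intro Fin._≟_ n p up
      h₁ : ∀ v → st₁ v ≡ st′ v ⊎ (st₁ v ≡ new × st′ v ≡ cur)
      h₁ v with v Fin.≟ x
      ... | yes refl = inj₁ (sym q)
      ... | no ne = h v
      e₁ : ∀ v → v ∉ xs → st₁ v ≡ st′ v
      e₁ v v∉ with v Fin.≟ x
      ... | yes refl = sym q
      ... | no ne = e v λ { (here p) → ne p ; (there p) → v∉ p }
      cur-bound : ∀ v → st₁ v ≡ cur → st′ v ≡ cur
      cur-bound v r with h₁ v
      ... | inj₁ s = trans (sym s) r
      ... | inj₂ (_ , s) = s

  forget-all : ∀ {E c st′} → GoodFor E c st′ → ∀ {st} →
    (∀ v → st v ≡ st′ v ⊎ (st v ≡ cur × st′ v ≡ old)) →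
    (∀ v w → st v ≡ cur → st′ v ≡ old → st′ w ≡ new → ¬ E v w) → GoodFor E c st
  forget-all {E} {c} {st′} good h sep = go (allFin N) h sep λ v ne → ⊥-elim (ne (∈.∈-allFin v))
    where
    go : ∀ xs {st} → (∀ v → st v ≡ st′ v ⊎ (st v ≡ cur × st′ v ≡ old)) →
      (∀ v w → st v ≡ cur → st′ v ≡ old → st′ w ≡ new → ¬ E v w) →
      (∀ v → v ∉ xs → st v ≡ st′ v) → GoodFor E c st
    go [] {st} h sep e n = Good-resp (λ v → sym (e v λ ()))
      (good (count-resp (λ v → trans (sym (e v λ ()))) (λ v → trans (e v λ ())) n))
    go (x ∷ xs) {st} h sep e n with h x
    ... | inj₁ same = go xs h sep (λ v v∉ → case v Fin.≟ x of λ
            { (yes refl) → same ; (no ne) → e v λ { (here p) → ne p ; (there p) → v∉ p } }) n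
    ... | inj₂ (p , q) with count-forget Fin._≟_ n p (update-Update Fin._≟_ st x old)
    ...   | _ , refl , n₁ = forget x p (λ w r → sep x w p q (still-new w r)) up (go xs h₁ sep₁ e₁ n₁)
      where
      st₁ = update Fin._≟_ st x old
      up = update-Update Fin._≟_ st x old
      still-new : ∀ w → st w ≡ new → st′ w ≡ new
      still-new w r with h w
      ... | inj₁ s = trans (sym s) r
      ... | inj₂ (s , _) = case trans (sym s) r of λ ()
      h₁ : ∀ v → st₁ v ≡ st′ v ⊎ (st₁ v ≡ cur × st′ v ≡ old)
      h₁ v with v Fin.≟ x
      ... | yes refl = inj₁ (sym q)
      ... | no ne = h v
      sep₁ : ∀ v w → st₁ v ≡ cur → st′ v ≡ old → st′ w ≡ new → ¬ E v w
      sep₁ v w with v Fin.≟ x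
      ... | yes refl = λ ()
      ... | no ne = sep v w
      e₁ : ∀ v → v ∉ xs → st₁ v ≡ st′ v
      e₁ v v∉ with v Fin.≟ x
      ... | yes refl = sym q
      ... | no ne = e v λ { (here p) → ne p ; (there p) → v∉ p }

-- The arguments are the statuses at a parent and at a leaf to be pruned. `merge` is the status at
-- the parent once the leaf hangs below it, `rest` the one in the branch towards the leaf, and
-- `quit` the one after forgetting what is in the parent's bag but `old` at the leaf. Introducing
-- the bag of the leaf then leads to the leaf itself.
merge rest quit : Status → Status → Status
merge cur _ = cur
merge new _ = new
merge old old = old
merge old cur = new
merge old new = new
rest cur _ = cur
rest new _ = old
rest old old = old
rest old cur = new
rest old new = new
quit cur old = old
quit cur _ = cur
quit new _ = old
quit old old = old
quit old _ = new

merge-Distribute : ∀ a b → Distribute (merge a b) a (rest a b)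
merge-Distribute cur _ = current
merge-Distribute new _ = left
merge-Distribute old old = outside
merge-Distribute old cur = right
merge-Distribute old new = right

merge-cur : ∀ a b → merge a b ≡ cur → a ≡ cur
merge-cur cur _ _ = refl
merge-cur old old ()
merge-cur old cur ()
merge-cur old new ()

merge-new : ∀ a b → merge a b ≡ new → a ≡ new ⊎ (a ≡ old × b ≢ old)
merge-new new _ _ = inj₁ refl
merge-new old cur _ = inj₂ (refl , λ ())
merge-new old new _ = inj₂ (refl , λ ())

merge-old : ∀ a b → a ≢ old ⊎ b ≢ old → merge a b ≢ old
merge-old old old (inj₁ ne) _ = ne refl
merge-old old old (inj₂ ne) _ = ne refl

merge-old⁻ : ∀ a b → merge a b ≢ old → a ≢ old ⊎ b ≢ old
merge-old⁻ cur _ _ = inj₁ λ ()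
merge-old⁻ new _ _ = inj₁ λ ()
merge-old⁻ old cur _ = inj₂ λ ()
merge-old⁻ old new _ = inj₂ λ ()
merge-old⁻ old old ne = ⊥-elim (ne refl)

rest-new : ∀ a b → rest a b ≡ new → a ≡ old × b ≢ old
rest-new old cur _ = refl , λ ()
rest-new old new _ = refl , λ ()

rest-quit : ∀ a b → rest a b ≡ quit a b ⊎ (rest a b ≡ cur × quit a b ≡ old)
rest-quit cur new = inj₁ refl
rest-quit cur cur = inj₁ refl
rest-quit cur old = inj₂ (refl , refl)
rest-quit new new = inj₁ refl
rest-quit new cur = inj₁ refl
rest-quit new old = inj₁ refl
rest-quit old new = inj₁ refl
rest-quit old cur = inj₁ refl
rest-quit old old = inj₁ refl

forgotten : ∀ a b → rest a b ≡ cur → quit a b ≡ old → b ≡ old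
forgotten cur old _ _ = refl
forgotten old old () _
forgotten old cur () _
forgotten old new () _

quit-new : ∀ a b → quit a b ≡ new → a ≡ old × b ≢ old
quit-new old cur _ = refl , λ ()
quit-new old new _ = refl , λ ()
quit-new cur new ()
quit-new cur cur ()
quit-new cur old ()

quit-enter : ∀ a b → (b ≡ new → a ≡ old) → (a ≡ new → b ≡ old) → quit a b ≡ b ⊎ (quit a b ≡ new × b ≡ cur)
quit-enter cur new h _ = case h refl of λ ()
quit-enter cur cur _ _ = inj₁ refl
quit-enter cur old _ _ = inj₁ refl
quit-enter new new h _ = case h refl of λ ()
quit-enter new cur _ h = case h refl of λ ()
quit-enter new old _ _ = inj₁ refl
quit-enter old new _ _ = inj₁ refl
quit-enter old cur _ _ = inj₂ (refl , refl)
quit-enter old old _ _ = inj₁ refl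

not-old : ∀ s → s ≢ old → s ≡ new ⊎ s ≡ cur
not-old new _ = inj₁ refl
not-old cur _ = inj₂ refl
not-old old ne = ⊥-elim (ne refl)

module _ {N : ℕ} {E : Fin N → Fin N → Set} {c : ℕ} where
  -- A tree whose nodes 0, …, t carry a bag (`cur`) and a set of vertices hanging below it (`new`).
  -- `running` is the running intersection property.
  record Hanging (t : ℕ) (parent : ℕ → ℕ) (S : ℕ → St {N}) : Set where
    field
      parent-≤ : ∀ {i} → i < t → parent i ≤ i
      running  : ∀ {i y v} → i < t → y ≤ i → S (suc i) v ≡ cur → S y v ≡ cur → S (parent i) v ≡ cur
      small    : ∀ {x} → x ≤ t → AtMost c (λ v → S x v ≡ cur)
      cover    : ∀ v → Σ ℕ λ x → x ≤ t × S x v ≢ old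
      edge     : ∀ {u v} → E u v → Σ ℕ λ x → x ≤ t × S x u ≢ old × S x v ≢ old
      own      : ∀ {x y v} → x ≤ t → y ≤ t → S x v ≡ new → S y v ≢ old → y ≡ x
      good     : ∀ {x} → x ≤ t → GoodFor E c (S x)

  module _ {t : ℕ} {parent : ℕ → ℕ} {S : ℕ → St {N}} (H : Hanging (suc t) parent S) where
    open Hanging H
    private
      p ℓ : ℕ
      p = parent t
      ℓ = suc t
      p≤t : p ≤ t
      p≤t = parent-≤ ℕ.≤-refl
      p≤ : p ≤ ℓ
      p≤ = ℕ.m≤n⇒m≤1+n p≤t
      p≢ℓ : p ≢ ℓ
      p≢ℓ e = ℕ.<-irrefl e (s≤s p≤t)

      S′ : ℕ → St {N}
      S′ x v with x ℕ.≟ p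
      ... | yes _ = merge (S p v) (S ℓ v)
      ... | no _ = S x v

      own-ℓ : ∀ {v} → S ℓ v ≡ new → S p v ≡ old
      own-ℓ {v} e with S p v ≟ₛ old
      ... | yes q = q
      ... | no nq = ⊥-elim (p≢ℓ (own ℕ.≤-refl p≤ e nq))

      own-p : ∀ {v} → S p v ≡ new → S ℓ v ≡ old
      own-p {v} e with S ℓ v ≟ₛ old
      ... | yes q = q
      ... | no nq = ⊥-elim (p≢ℓ (sym (own p≤ ℕ.≤-refl e nq)))

      -- By `own`, a vertex that is not `old` at two different nodes lies in both bags; `running`
      -- then puts it into the bag of p.
      at-ℓ : ∀ {y v} → y ≤ t → S y v ≢ old → S ℓ v ≢ old → S p v ≢ old
      at-ℓ {y} {v} y≤ a b with not-old (S ℓ v) b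
      ... | inj₁ e = ⊥-elim (ℕ.<-irrefl (own ℕ.≤-refl (ℕ.m≤n⇒m≤1+n y≤) e a) (s≤s y≤))
      ... | inj₂ e with not-old (S y v) a
      ...   | inj₁ e′ = ⊥-elim (ℕ.<-irrefl (sym (own (ℕ.m≤n⇒m≤1+n y≤) ℕ.≤-refl e′ b)) (s≤s y≤))
      ...   | inj₂ e′ = λ q → case trans (sym (running ℕ.≤-refl y≤ e e′)) q of λ ()

      S′-cur : ∀ x {v} → S′ x v ≡ cur → S x v ≡ cur
      S′-cur x {v} e with x ℕ.≟ p
      ... | yes refl = merge-cur (S p v) (S ℓ v) e
      ... | no _ = e

      S′-cur⁺ : ∀ x {v} → S x v ≡ cur → S′ x v ≡ cur
      S′-cur⁺ x {v} e with x ℕ.≟ p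
      ... | yes refl rewrite e = refl
      ... | no _ = e

      S′-live : ∀ x {v} → S x v ≢ old → S′ x v ≢ old
      S′-live x {v} ne with x ℕ.≟ p
      ... | yes refl = merge-old (S p v) (S ℓ v) (inj₁ ne)
      ... | no _ = ne

      S′-ℓ : ∀ {v} → S ℓ v ≢ old → S′ p v ≢ old
      S′-ℓ {v} ne with p ℕ.≟ p
      ... | yes _ = merge-old (S p v) (S ℓ v) (inj₂ ne)
      ... | no np = ⊥-elim (np refl)

      S′-live⁻ : ∀ y {v} → S′ y v ≢ old → S y v ≢ old ⊎ (y ≡ p × S ℓ v ≢ old)
      S′-live⁻ y {v} ne with y ℕ.≟ p
      ... | no _ = inj₁ ne
      ... | yes refl with merge-old⁻ (S p v) (S ℓ v) ne
      ...   | inj₁ a = inj₁ a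
      ...   | inj₂ b = inj₂ (refl , b)

      own′ : ∀ {x y v} → x ≤ t → y ≤ t → S′ x v ≡ new → S′ y v ≢ old → y ≡ x
      own′ {x} {y} {v} x≤ y≤ e ne with S′-live⁻ y ne | x ℕ.≟ p
      ... | inj₁ a | no _ = own (ℕ.m≤n⇒m≤1+n x≤) (ℕ.m≤n⇒m≤1+n y≤) e a
      ... | inj₂ (_ , b) | no _ = ⊥-elim (ℕ.<-irrefl (sym (own (ℕ.m≤n⇒m≤1+n x≤) ℕ.≤-refl e b)) (s≤s x≤))
      ... | inj₂ (refl , _) | yes refl = refl
      ... | inj₁ a | yes refl with merge-new (S p v) (S ℓ v) e
      ...   | inj₁ e′ = own p≤ (ℕ.m≤n⇒m≤1+n y≤) e′ a
      ...   | inj₂ (o , b) = ⊥-elim (at-ℓ y≤ a b o)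

      R Q : St {N}
      R v = rest (S p v) (S ℓ v)
      Q v = quit (S p v) (S ℓ v)

      good-Q : GoodFor E c Q
      good-Q = intro-all (small ℕ.≤-refl) (good ℕ.≤-refl) λ v → quit-enter (S p v) (S ℓ v) own-ℓ own-p

      -- Some node would cover the edge. At the leaf v is `old`; at any other node w would not be
      -- `old`, and by `at-ℓ` neither would it be at p.
      forgotten-edge : ∀ v w → R v ≡ cur → Q v ≡ old → Q w ≡ new → ¬ E v w
      forgotten-edge v w a b e vw with quit-new (S p w) (S ℓ w) e | edge vw
      ... | o , live | y , y≤ , yv , yw with y ℕ.≟ ℓ
      ...   | yes refl = yv (forgotten (S p v) (S ℓ v) a b)
      ...   | no ne = at-ℓ (ℕ.≤-pred (ℕ.≤∧≢⇒< y≤ ne)) yw live o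

      good-merge : GoodFor E c (λ v → merge (S p v) (S ℓ v))
      good-merge n = split (λ v → merge-Distribute (S p v) (S ℓ v))
        -- u hangs below p, so the edge can be covered at p only, where v is `old`.
        (λ u v eu ev uv → let y , y≤ , yu , yv = edge uv
                              o , _ = rest-new (S p v) (S ℓ v) ev in
          yv (subst (λ y → S y v ≡ old) (sym (own p≤ y≤ eu yu)) o))
        (good p≤ (count-split (λ v → merge-Distribute (S p v) (S ℓ v)) n))
        (forget-all good-Q (λ v → rest-quit (S p v) (S ℓ v)) forgotten-edge
          (count-split (λ v → Distribute-sym (merge-Distribute (S p v) (S ℓ v))) n))

      good′ : ∀ {x} → x ≤ t → GoodFor E c (S′ x)
      good′ {x} x≤ with x ℕ.≟ p
      ... | yes refl = good-merge
      ... | no _ = good (ℕ.m≤n⇒m≤1+n x≤)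

      push : ∀ {x} → x ≤ ℓ → Σ ℕ λ x′ → x′ ≤ t × (∀ {v} → S x v ≢ old → S′ x′ v ≢ old)
      push {x} x≤ with x ℕ.≟ ℓ
      ... | yes refl = p , p≤t , S′-ℓ
      ... | no ne = x , ℕ.≤-pred (ℕ.≤∧≢⇒< x≤ ne) , S′-live x

    -- The node of largest number has no children, since a parent never has a larger number than its
    -- child; so it can be absorbed into its parent.
    hanging-prune : Hanging t parent S′
    hanging-prune = record
      { parent-≤ = λ lt → parent-≤ (ℕ.m≤n⇒m≤1+n lt)
      ; running = λ {i} {y} lt y≤ a b → S′-cur⁺ (parent i) (running (ℕ.m≤n⇒m≤1+n lt) y≤ (S′-cur (suc i) a) (S′-cur y b))
      ; small = λ {x} x≤ → let xs , le , f = small (ℕ.m≤n⇒m≤1+n x≤) in xs , le , λ v e → f v (S′-cur x e)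
      ; cover = λ v → let x , x≤ , a = cover v ; x′ , x′≤ , f = push x≤ in x′ , x′≤ , f a
      ; edge = λ uv → let x , x≤ , a , b = edge uv ; x′ , x′≤ , f = push x≤ in x′ , x′≤ , f a , f b
      ; own = own′
      ; good = good′ }

  hanging-good : ∀ t {parent S} → Hanging t parent S → Good E c (λ _ → new) 0
  hanging-good (suc t) H = hanging-good t (hanging-prune H)
  hanging-good zero {S = S} H = intro-all (small z≤n) (good z≤n) in-root (count-empty λ _ ())
    where
    open Hanging H
    in-root : ∀ v → new ≡ S 0 v ⊎ (new ≡ new × S 0 v ≡ cur)
    in-root v with cover v
    ... | zero , _ , ne with not-old (S 0 v) ne
    ...   | inj₁ e = inj₁ (sym e)
    ...   | inj₂ e = inj₂ (refl , e)

elements : ∀ {n} (p : Subset n) → Σ (List (Fin n)) λ xs → Unique xs × length xs ≡ Subset.∣ p ∣ ×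
  (∀ v → v Subset.∈ p → v ∈ xs) × (∀ v → v ∈ xs → v Subset.∈ p)
elements Vec.[] = [] , [] , refl , (λ { _ () }) , λ { _ () }
elements (b Vec.∷ p) with elements p
... | xs , u , l , f , g = add b
  where
  shift : Unique (map suc xs)
  shift = Unique.map⁺ Fin.suc-injective u
  shifted : ∀ {b} v → v ∈ map suc xs → v Subset.∈ (b Vec.∷ p)
  shifted v v∈ with ∈.∈-map⁻ suc v∈
  ... | w , w∈ , refl = Vec.there (g w w∈)
  add : ∀ b → Σ (List (Fin _)) λ ys → Unique ys × length ys ≡ Subset.∣ b Vec.∷ p ∣ ×
    (∀ v → v Subset.∈ (b Vec.∷ p) → v ∈ ys) × (∀ v → v ∈ ys → v Subset.∈ (b Vec.∷ p))
  add false = map suc xs , shift , trans (List.length-map suc xs) l ,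
    (λ { (suc v) (Vec.there v∈) → ∈.∈-map⁺ suc (f v v∈) }) ,
    shifted
  add true = zero ∷ map suc xs ,
    (All.tabulate (λ x∈ e → let _ , _ , e′ = ∈.∈-map⁻ suc x∈ in case trans e e′ of λ ()) ∷ shift) ,
    cong suc (trans (List.length-map suc xs) l) ,
    (λ { zero _ → here refl ; (suc v) (Vec.there v∈) → there (∈.∈-map⁺ suc (f v v∈)) }) ,
    λ { v (here refl) → Vec.here ; v (there v∈) → shifted v v∈ }

module _ {t : ℕ} (parent : Fin t → Fin (suc t)) (parent-< : ∀ i → Fin.toℕ (parent i) ≤ Fin.toℕ i) where
  data Below (i : Fin t) : Fin (suc t) → Set where
    apex  : Below i (suc i)
    under : ∀ {j} → Below i (parent j) → Below i (suc j)

  below-> : ∀ {i x} → Below i x → Fin.toℕ i < Fin.toℕ x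
  below-> apex = ℕ.≤-refl
  below-> (under {j} b) = ℕ.m≤n⇒m≤1+n (ℕ.<-≤-trans (below-> b) (parent-< j))

  path-start : ∀ {S x y} → PathIn parent S x y → S x
  path-start (here s) = s
  path-start (there s _ _) = s

  -- A step to a child stays below `suc i`; a step to a parent leaves that subtree only from `suc i`
  -- itself, and then reaches `parent i`. This turns connectedness by paths into the running
  -- intersection property.
  path-exit : ∀ {S x y i} → PathIn parent S x y → Below i x → ¬ Below i y → S (parent i)
  path-exit (here s) b nb = ⊥-elim (nb b)
  path-exit (there s (j , inj₁ (refl , refl)) π) apex nb = path-start π
  path-exit (there s (j , inj₁ (refl , refl)) π) (under b) nb = path-exit π b nb
  path-exit (there s (j , inj₂ (refl , refl)) π) b nb = path-exit π (under b) nb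

module _ {N : ℕ} {E : Fin N → Fin N → Set} {c : ℕ} where
  decomposition-good : (D : TreeDecomposition N E) → (∀ x → Subset.∣ TreeDecomposition.bag D x ∣ ≤ c) →
    Good E c (λ _ → new) 0
  decomposition-good D bounded = hanging-good t record
    { parent-≤ = parent-≤′
    ; running = λ {i} lt y≤ a b → running (in-bag (suc i) a) (in-bag _ b) lt y≤
    ; small = λ {x} _ → let xs , _ , l , f , _ = elements (bag (nodeAt x)) in
        xs , ℕ.≤-trans (ℕ.≤-reflexive l) (bounded (nodeAt x)) , λ v e → f v (in-bag x e)
    ; cover = λ v → let x , v∈ = cover-vert v in Fin.toℕ x , ℕ.≤-pred (Fin.toℕ<n x) , live x v∈
    ; edge = λ {u} {v} uv → let x , u∈ , v∈ = cover-edge u v uv in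
        Fin.toℕ x , ℕ.≤-pred (Fin.toℕ<n x) , live x u∈ , live x v∈
    ; own = λ {x} _ _ e → ⊥-elim (no-new x e)
    ; good = λ {x} _ _ → leaf λ v → no-new x }
    where
    open TreeDecomposition D
    nodeAt : ℕ → Fin (suc t)
    nodeAt x with x <? suc t
    ... | yes lt = Fin.fromℕ< lt
    -- A junk value: `Hanging` looks only at numbers up to t.
    ... | no _ = zero

    nodeAt-toℕ : ∀ x → nodeAt (Fin.toℕ x) ≡ x
    nodeAt-toℕ x with Fin.toℕ x <? suc t
    ... | yes lt = Fin.fromℕ<-toℕ x lt
    ... | no nlt = ⊥-elim (nlt (Fin.toℕ<n x))

    parent′ : ℕ → ℕ
    parent′ i with i <? t
    ... | yes lt = Fin.toℕ (parent (Fin.fromℕ< lt))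
    ... | no _ = 0

    parent′-toℕ : ∀ i → parent′ (Fin.toℕ i) ≡ Fin.toℕ (parent i)
    parent′-toℕ i with Fin.toℕ i <? t
    ... | yes lt = cong (Fin.toℕ ∘ parent) (Fin.fromℕ<-toℕ i lt)
    ... | no nlt = ⊥-elim (nlt (Fin.toℕ<n i))

    parent-≤′ : ∀ {i} → i < t → parent′ i ≤ i
    parent-≤′ {i} lt with i <? t
    ... | yes lt′ = ℕ.≤-trans (parent-< _) (ℕ.≤-reflexive (Fin.toℕ-fromℕ< lt′))
    ... | no _ = z≤n

    S : ℕ → St {N}
    S x v with v Subset.∈? bag (nodeAt x)
    ... | yes _ = cur
    ... | no _ = old

    in-bag : ∀ x {v} → S x v ≡ cur → v Subset.∈ bag (nodeAt x)
    in-bag x {v} e with v Subset.∈? bag (nodeAt x)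
    ... | yes p = p

    bag-cur : ∀ x {v} → v Subset.∈ bag (nodeAt x) → S x v ≡ cur
    bag-cur x {v} p with v Subset.∈? bag (nodeAt x)
    ... | yes _ = refl
    ... | no np = ⊥-elim (np p)

    no-new : ∀ x {v} → S x v ≢ new
    no-new x {v} e with v Subset.∈? bag (nodeAt x)
    no-new x () | yes _
    no-new x () | no _

    live : ∀ x {v} → v Subset.∈ bag x → S (Fin.toℕ x) v ≢ old
    live x v∈ e = case trans (sym (bag-cur (Fin.toℕ x) (subst (λ x → _ Subset.∈ bag x) (sym (nodeAt-toℕ x)) v∈))) e of λ ()

    running : ∀ {i y v} → v Subset.∈ bag (nodeAt (suc i)) → v Subset.∈ bag (nodeAt y) → i < t → y ≤ i → S (parent′ i) v ≡ cur
    running {i} {y} {v} a b lt y≤ = subst (λ i → S (parent′ i) v ≡ cur) (Fin.toℕ-fromℕ< lt)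
      (subst (λ x → S x v ≡ cur) (sym (parent′-toℕ j)) (bag-cur (Fin.toℕ (parent j)) (subst (λ x → v Subset.∈ bag x)
        (sym (nodeAt-toℕ (parent j))) at-parent)))
      where
      j : Fin t
      j = Fin.fromℕ< lt
      y<t : y < suc t
      y<t = s≤s (ℕ.≤-trans y≤ (ℕ.<⇒≤ lt))
      at : ∀ x k → Fin.toℕ x ≡ k → v Subset.∈ bag (nodeAt k) → v Subset.∈ bag x
      at x .(Fin.toℕ x) refl = subst (λ x → v Subset.∈ bag x) (nodeAt-toℕ x)
      at-parent : v Subset.∈ bag (parent j)
      at-parent = path-exit parent parent-<
        (connected v (suc j) (Fin.fromℕ< y<t) (at (suc j) (suc i) (cong suc (Fin.toℕ-fromℕ< lt)) a)
          (at (Fin.fromℕ< y<t) y (Fin.toℕ-fromℕ< y<t) b)) apex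
        λ below → ℕ.<-irrefl refl (ℕ.<-≤-trans (below-> parent parent-< below)
          (ℕ.≤-trans (ℕ.≤-reflexive (Fin.toℕ-fromℕ< y<t)) (ℕ.≤-trans y≤ (ℕ.≤-reflexive (sym (Fin.toℕ-fromℕ< lt))))))

-- Tree decompositions from derivations

module _ {N : ℕ} {c : ℕ} where
  record Partial : Set where
    field
      t        : ℕ
      parent   : ℕ → ℕ
      bag      : ℕ → Fin N → Bool
      parent-≤ : ∀ {i} → i < t → parent i ≤ i
      running  : ∀ {i y v} → i < t → y ≤ i → bag (suc i) v ≡ true → bag y v ≡ true → bag (parent i) v ≡ true
      small    : ∀ {x} → x ≤ t → AtMost c (λ v → bag x v ≡ true)

  module _ (T : Partial) (p : ℕ) (p≤ : p ≤ Partial.t T) (B : Fin N → Bool) (B-small : AtMost c (λ v → B v ≡ true))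
    (B-running : ∀ {y v} → y ≤ Partial.t T → B v ≡ true → Partial.bag T y v ≡ true → Partial.bag T p v ≡ true) where
    open Partial T
    private
      parent₁ : ℕ → ℕ
      parent₁ i with i ℕ.≟ t
      ... | yes _ = p
      ... | no _ = parent i

      bag₁ : ℕ → Fin N → Bool
      bag₁ x with x ℕ.≟ suc t
      ... | yes _ = B
      ... | no _ = bag x

    addBag-old : ∀ {x} → x ≤ t → bag₁ x ≡ bag x
    addBag-old {x} le with x ℕ.≟ suc t
    ... | yes refl = ⊥-elim (ℕ.<-irrefl refl le)
    ... | no _ = refl

    addBag-new : bag₁ (suc t) ≡ B
    addBag-new with suc t ℕ.≟ suc t
    ... | yes _ = refl
    ... | no ne = ⊥-elim (ne refl)

    addBag : Partial
    addBag = record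
      { t = suc t ; parent = parent₁ ; bag = bag₁
      ; parent-≤ = parent-≤₁ ; running = running₁ ; small = small₁ }
      where
      parent-≤₁ : ∀ {i} → i < suc t → parent₁ i ≤ i
      parent-≤₁ {i} lt with i ℕ.≟ t
      ... | yes refl = p≤
      ... | no ne = parent-≤ (ℕ.≤∧≢⇒< (ℕ.≤-pred lt) ne)
      running₁ : ∀ {i y v} → i < suc t → y ≤ i → bag₁ (suc i) v ≡ true → bag₁ y v ≡ true → bag₁ (parent₁ i) v ≡ true
      running₁ {i} {y} {v} lt y≤ a b with i ℕ.≟ t
      ... | yes refl rewrite addBag-new | addBag-old y≤ | addBag-old p≤ = B-running y≤ a b
      ... | no ne rewrite addBag-old (ℕ.≤∧≢⇒< (ℕ.≤-pred lt) ne) | addBag-old (ℕ.≤-trans y≤ (ℕ.≤-pred lt))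
                        | addBag-old (ℕ.≤-trans (parent-≤ (ℕ.≤∧≢⇒< (ℕ.≤-pred lt) ne)) (ℕ.≤-pred lt)) =
        running (ℕ.≤∧≢⇒< (ℕ.≤-pred lt) ne) y≤ a b
      small₁ : ∀ {x} → x ≤ suc t → AtMost c (λ v → bag₁ x v ≡ true)
      small₁ {x} le with x ℕ.≟ suc t
      ... | yes _ = B-small
      ... | no ne = small (ℕ.≤-pred (ℕ.≤∧≢⇒< le ne))

  isCur : Status → Bool
  isCur cur = true
  isCur new = false
  isCur old = false

  isCur⁻ : ∀ {s} → isCur s ≡ true → s ≡ cur
  isCur⁻ {cur} _ = refl

  -- What a derivation adds to the tree built so far. `inside` confines the added bags to vertices
  -- that are not `old` in `st`; hence the vertices of the second branch of a split are still fresh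
  -- when its turn comes.
  record Covering (E : Fin N → Fin N → Set) (st : St {N}) (T : Partial) : Set where
    open Partial T
    field
      T′     : Partial
    open Partial T′ using () renaming (t to t′; bag to bag′)
    field
      t≤     : t ≤ t′
      same   : ∀ {x} → x ≤ t → bag′ x ≡ bag x
      inside : ∀ {x v} → t < x → x ≤ t′ → bag′ x v ≡ true → st v ≢ old
      vertex : ∀ {v} → st v ≡ new → Σ ℕ λ x → x ≤ t′ × bag′ x v ≡ true
      edge   : ∀ {u v} → st u ≡ new → st v ≢ old → E u v → Σ ℕ λ x → x ≤ t′ × bag′ x u ≡ true × bag′ x v ≡ true

  module CoverForget {E : Fin N → Fin N → Set} {st st′ : St {N}} {v : Fin N} {T : Partial} (E-sym : Symmetric E)
    (e : st v ≡ cur) (h : ∀ w → st w ≡ new → ¬ E v w) (up : Update st v old st′) where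
    still-old : ∀ w → st w ≡ old → st′ w ≡ old
    still-old w q with w Fin.≟ v
    ... | yes refl = proj₁ up
    ... | no ne = trans (proj₂ up w ne) q
    still-new : ∀ w → st w ≡ new → st′ w ≡ new
    still-new w q = trans (proj₂ up w λ { refl → case trans (sym e) q of λ () }) q
    was : ∀ {w s} → s ≢ old → st′ w ≡ s → st w ≡ s
    was {w} ne q with w Fin.≟ v
    ... | yes refl = ⊥-elim (ne (trans (sym q) (proj₁ up)))
    ... | no ne = trans (sym (proj₂ up w ne)) q
    cover : Covering E st′ T → Covering E st T
    cover C = record
      { T′ = T′ ; t≤ = t≤ ; same = same
      ; inside = λ {x} {w} lt le b → λ q → inside lt le b (still-old w q)
      ; vertex = λ {w} q → vertex (still-new w q)
      ; edge = edge′ }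
      where
      open Covering C
      edge′ : ∀ {u w} → st u ≡ new → st w ≢ old → E u w → _
      edge′ {u} {w} q ne uw with w Fin.≟ v
      ... | yes refl = ⊥-elim (h u q (E-sym uw))
      ... | no nv = edge (still-new u q) (λ r → ne (trans (sym (proj₂ up w nv)) r)) uw

  module CoverIntro {E : Fin N → Fin N → Set} {st st′ : St {N}} {v : Fin N} {m : ℕ} (E-sym : Symmetric E)
    (e : st v ≡ new) (le : suc m ≤ c) (up : Update st v cur st′) (n : Count st m)
    (T : Partial) (p : ℕ) (p≤ : p ≤ Partial.t T)
    (top : ∀ {v} → st v ≡ cur → Partial.bag T p v ≡ true)
    (fresh : ∀ {y v} → y ≤ Partial.t T → st v ≡ new → Partial.bag T y v ≢ true) where
    open Partial T using (t; bag)
    n₁ : Count st′ (suc m)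
    n₁ = count-intro Fin._≟_ n e up
    B : Fin N → Bool
    B w = isCur (st′ w)
    B-small : AtMost c (λ w → B w ≡ true)
    B-small = let xs , _ , l , f , _ = n₁ in xs , ℕ.≤-trans (ℕ.≤-reflexive l) le , λ w q → f w (isCur⁻ q)
    B-running : ∀ {y w} → y ≤ t → B w ≡ true → bag y w ≡ true → bag p w ≡ true
    B-running {y} {w} y≤ a b with w Fin.≟ v
    ... | yes refl = ⊥-elim (fresh y≤ e b)
    ... | no ne = top (trans (sym (proj₂ up w ne)) (isCur⁻ a))
    T₁ : Partial
    T₁ = addBag T p p≤ B B-small B-running
    at : ∀ {w} → st′ w ≡ cur → Partial.bag T₁ (suc t) w ≡ true
    at {w} q = trans (cong (λ f → f w) (addBag-new T p p≤ B B-small B-running)) (cong isCur q)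
    was-new : ∀ {w} → st′ w ≡ new → st w ≡ new
    was-new {w} q with w Fin.≟ v
    ... | yes refl = e
    ... | no ne = trans (sym (proj₂ up w ne)) q
    fresh₁ : ∀ {y w} → y ≤ suc t → st′ w ≡ new → Partial.bag T₁ y w ≢ true
    fresh₁ {y} {w} y≤ q b with y ℕ.≟ suc t
    ... | yes refl = case trans (sym q) (isCur⁻ b) of λ ()
    ... | no ne = fresh (ℕ.≤-pred (ℕ.≤∧≢⇒< y≤ ne)) (was-new q) b
    cover : Covering E st′ T₁ → Covering E st T
    cover C = record
      { T′ = T′ ; t≤ = ℕ.≤-trans (ℕ.n≤1+n _) t≤
      ; same = λ x≤ → trans (same (ℕ.m≤n⇒m≤1+n x≤)) (addBag-old T p p≤ B B-small B-running x≤)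
      ; inside = inside′ ; vertex = vertex′ ; edge = edge′ }
      where
      open Covering C
      not-old′ : ∀ {w} → st′ w ≢ old → st w ≢ old
      not-old′ {w} ne q with w Fin.≟ v
      ... | yes refl = case trans (sym e) q of λ ()
      ... | no nv = ne (trans (proj₂ up w nv) q)
      here′ : ∀ {w} → st′ w ≡ cur → Partial.bag T′ (suc t) w ≡ true
      here′ {w} q = trans (cong (λ f → f w) (same ℕ.≤-refl)) (at q)
      inside′ : ∀ {x w} → t < x → x ≤ Partial.t T′ → Partial.bag T′ x w ≡ true → st w ≢ old
      inside′ {x} {w} lt le b with x ℕ.≟ suc t
      ... | no ne = not-old′ (inside (ℕ.≤∧≢⇒< lt (λ q → ne (sym q))) le b)
      ... | yes refl = not-old′ λ q → case trans (sym q) (isCur⁻ {st′ w} (trans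
              (sym (cong (λ f → f w) (trans (same ℕ.≤-refl) (addBag-new T p p≤ B B-small B-running)))) b)) of λ ()
      vertex′ : ∀ {w} → st w ≡ new → Σ ℕ λ x → x ≤ Partial.t T′ × Partial.bag T′ x w ≡ true
      vertex′ {w} q with w Fin.≟ v
      ... | yes refl = suc t , t≤ , here′ (proj₁ up)
      ... | no ne = vertex (trans (proj₂ up w ne) q)
      edge′ : ∀ {u w} → st u ≡ new → st w ≢ old → E u w → Σ ℕ λ x →
        x ≤ Partial.t T′ × Partial.bag T′ x u ≡ true × Partial.bag T′ x w ≡ true
      edge′ {u} {w} q ne uw with u Fin.≟ v | w Fin.≟ v
      ... | yes refl | yes refl = suc t , t≤ , here′ (proj₁ up) , here′ (proj₁ up)
      ... | no nu | yes refl = edge (trans (proj₂ up u nu) q) (λ r → case trans (sym (proj₁ up)) r of λ ()) uw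
      ... | no nu | no nw = edge (trans (proj₂ up u nu) q) (λ r → ne (trans (sym (proj₂ up w nw)) r)) uw
      ... | yes refl | no nw with not-old (st w) ne
      ...   | inj₂ r = suc t , t≤ , here′ (proj₁ up) , here′ (trans (proj₂ up w nw) r)
      ...   | inj₁ r = let x , x≤ , a , b = edge (trans (proj₂ up w nw) r)
                                              (λ s → case trans (sym (proj₁ up)) s of λ ()) (E-sym uw)
                       in x , x≤ , b , a

  module CoverSplit {E : Fin N → Fin N → Set} {st st₁ st₂ : St {N}} (E-sym : Symmetric E)
    (d : ∀ v → Distribute (st v) (st₁ v) (st₂ v)) (h : ∀ u v → st₁ u ≡ new → st₂ v ≡ new → ¬ E u v)
    (T : Partial) (p : ℕ) (p≤ : p ≤ Partial.t T)
    (top : ∀ {v} → st v ≡ cur → Partial.bag T p v ≡ true)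
    (fresh : ∀ {y v} → y ≤ Partial.t T → st v ≡ new → Partial.bag T y v ≢ true)
    (C₁ : Covering E st₁ T) where
    private module C₁ = Covering C₁
    d′ : ∀ v → Distribute (st v) (st₂ v) (st₁ v)
    d′ v = Distribute-sym (d v)
    fresh₂ : ∀ {y v} → y ≤ Partial.t C₁.T′ → st₂ v ≡ new → Partial.bag C₁.T′ y v ≢ true
    fresh₂ {y} {v} y≤ q b with y ≤? Partial.t T
    ... | yes le = fresh le (Distribute-new (d′ v) q) (trans (cong (λ f → f v) (sym (C₁.same le))) b)
    ... | no nle with Distribute-choose (d v) (Distribute-new (d′ v) q)
    ...   | inj₁ (_ , r) = case trans (sym q) r of λ ()
    ...   | inj₂ (r , _) = C₁.inside (ℕ.≰⇒> nle) y≤ b r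
    top₂ : ∀ {v} → st₂ v ≡ cur → Partial.bag C₁.T′ p v ≡ true
    top₂ {v} q = trans (cong (λ f → f v) (C₁.same p≤)) (top (Distribute-cur (d′ v) q))
    cover : Covering E st₂ C₁.T′ → Covering E st T
    cover C₂ = record
      { T′ = C₂.T′ ; t≤ = ℕ.≤-trans C₁.t≤ C₂.t≤
      ; same = λ x≤ → trans (C₂.same (ℕ.≤-trans x≤ C₁.t≤)) (C₁.same x≤)
      ; inside = inside′ ; vertex = vertex′ ; edge = edge′ }
      where
      module C₂ = Covering C₂
      moved : ∀ {x v} → x ≤ Partial.t C₁.T′ → Partial.bag C₁.T′ x v ≡ true → Partial.bag C₂.T′ x v ≡ true
      moved {v = v} le b = trans (cong (λ f → f v) (C₂.same le)) b
      inside′ : ∀ {x v} → Partial.t T < x → x ≤ Partial.t C₂.T′ → Partial.bag C₂.T′ x v ≡ true → st v ≢ old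
      inside′ {x} {v} lt le b q with x ≤? Partial.t C₁.T′
      ... | yes le₁ = C₁.inside lt le₁ (trans (cong (λ f → f v) (sym (C₂.same le₁))) b) (Distribute-old⁻ (d v) q)
      ... | no nle = C₂.inside (ℕ.≰⇒> nle) le b (Distribute-old⁻ (d′ v) q)
      vertex′ : ∀ {v} → st v ≡ new → Σ ℕ λ x → x ≤ Partial.t C₂.T′ × Partial.bag C₂.T′ x v ≡ true
      vertex′ {v} q with Distribute-choose (d v) q
      ... | inj₁ (r , _) = let x , x≤ , b = C₁.vertex r in x , ℕ.≤-trans x≤ C₂.t≤ , moved x≤ b
      ... | inj₂ (_ , r) = C₂.vertex r
      edge′ : ∀ {u v} → st u ≡ new → st v ≢ old → E u v → Σ ℕ λ x →
        x ≤ Partial.t C₂.T′ × Partial.bag C₂.T′ x u ≡ true × Partial.bag C₂.T′ x v ≡ true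
      edge′ {u} {v} q ne uv with Distribute-choose (d u) q | not-old (st v) ne
      ... | inj₂ (_ , r) | inj₂ s = C₂.edge r (λ o → case trans (sym (Distribute-cur⁻ (d′ v) s)) o of λ ()) uv
      ... | inj₁ (r , _) | inj₂ s = first r (λ o → case trans (sym (Distribute-cur⁻ (d v) s)) o of λ ())
        where
        first : st₁ u ≡ new → st₁ v ≢ old → _
        first r ne = let x , x≤ , a , b = C₁.edge r ne uv in x , ℕ.≤-trans x≤ C₂.t≤ , moved x≤ a , moved x≤ b
      edge′ {u} {v} q ne uv | side | inj₁ s with side | Distribute-choose (d v) s
      ... | inj₁ (r , _) | inj₁ (r′ , _) = let x , x≤ , a , b = C₁.edge r (λ o → case trans (sym r′) o of λ ()) uv in
                                           x , ℕ.≤-trans x≤ C₂.t≤ , moved x≤ a , moved x≤ b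
      ... | inj₁ (r , _) | inj₂ (_ , r′) = ⊥-elim (h u v r r′ uv)
      ... | inj₂ (_ , r) | inj₁ (r′ , _) = ⊥-elim (h v u r′ r (E-sym uv))
      ... | inj₂ (_ , r) | inj₂ (_ , r′) = C₂.edge r (λ o → case trans (sym r′) o of λ ()) uv


  -- Only an introduction adds a node: it is a child of p and has exactly the current bag.
  -- Forgetting leaves p in place, whose bag still contains the current one. By `fresh` the
  -- introduced vertex occurs for the first time, which gives the running intersection property.
  build : ∀ {E st m} → Symmetric E → Good E c st m → Count st m → (T : Partial) → ∀ p → p ≤ Partial.t T →
    (∀ {v} → st v ≡ cur → Partial.bag T p v ≡ true) →
    (∀ {y v} → y ≤ Partial.t T → st v ≡ new → Partial.bag T y v ≢ true) → Covering E st T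
  build E-sym (leaf h) n T p p≤ top fresh = record
    { T′ = T ; t≤ = ℕ.≤-refl ; same = λ _ → refl
    ; inside = λ lt le → ⊥-elim (ℕ.<-irrefl refl (ℕ.<-≤-trans lt le))
    ; vertex = λ e → ⊥-elim (h _ e) ; edge = λ e → ⊥-elim (h _ e) }
  build {E} E-sym (forget v e h up g) n T p p≤ top fresh
    with count-forget Fin._≟_ n e up
  ... | _ , refl , n₁ = cover (build E-sym g n₁ T p p≤ (λ q → top (was (λ ()) q)) (λ y≤ q → fresh y≤ (was (λ ()) q)))
    where open CoverForget {E = E} {T = T} E-sym e h up
  build {E} E-sym (intro v e le up g) n T p p≤ top fresh = cover (build E-sym g n₁ T₁ _ ℕ.≤-refl at fresh₁)
    where open CoverIntro {E = E} E-sym e le up n T p p≤ top fresh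
  build {E} E-sym (split {st₁ = st₁} d h g₁ g₂) n T p p≤ top fresh =
    cover (build E-sym g₂ (count-split (λ v → Distribute-sym (d v)) n) (Covering.T′ C₁) p
      (ℕ.≤-trans p≤ (Covering.t≤ C₁)) top₂ fresh₂)
    where
    C₁ : Covering E st₁ T
    C₁ = build E-sym g₁ (count-split d n) T p p≤ (λ q → top (Distribute-cur (d _) q))
           (λ y≤ q → fresh y≤ (Distribute-new (d _) q))
    open CoverSplit {E = E} E-sym d h T p p≤ top fresh C₁

path-snoc : ∀ {t} {parent : Fin t → Fin (suc t)} {S x y z} → PathIn parent S x y → TreeAdj parent y z → S z →
  PathIn parent S x z
path-snoc (here s) a s′ = there s a (here s′)
path-snoc (there s a π) b s′ = there s a (path-snoc π b s′)

good-decomposition : ∀ {N c} {E : Fin N → Fin N → Set} → Symmetric E → Good E c (λ _ → new) 0 →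
  Σ (TreeDecomposition N E) λ D → ∀ x → Subset.∣ TreeDecomposition.bag D x ∣ ≤ c
good-decomposition {N} {c} {E} E-sym g = record
    { t = t ; parent = parent′ ; parent-< = parent-<
    ; bag = λ x → Vec.tabulate (bag (Fin.toℕ x))
    ; cover-vert = λ v → let x , x≤ , b = vertex refl in Fin.fromℕ< (s≤s x≤) , mem⁺ (at x≤ b)
    ; cover-edge = λ u v uv → let x , x≤ , a , b = edge refl (λ ()) uv in
        Fin.fromℕ< (s≤s x≤) , mem⁺ (at x≤ a) , mem⁺ (at x≤ b)
    ; connected = λ v x y a b → walk v _ x y a b ℕ.≤-refl } ,
  size-bound
  where
  C : Covering E (λ _ → new) _
  C = build E-sym g (count-empty λ _ ())
    -- The construction starts from a single node with an empty bag.
    record { t = 0 ; parent = λ _ → 0 ; bag = λ _ _ → false ; parent-≤ = λ () ; running = λ ()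
           ; small = λ _ → [] , z≤n , λ _ () }
    0 z≤n (λ ()) (λ _ _ ())
  open Covering C using (T′; vertex; edge)
  open Partial T′
  InBag : Fin N → Fin (suc t) → Set
  InBag v x = v Subset.∈ Vec.tabulate (bag (Fin.toℕ x))
  mem⁺ : ∀ {v x} → bag (Fin.toℕ x) v ≡ true → InBag v x
  mem⁺ {v} {x} e = Vec.lookup⇒[]= v _ (trans (Vec.lookup∘tabulate (bag (Fin.toℕ x)) v) e)
  mem⁻ : ∀ {v x} → InBag v x → bag (Fin.toℕ x) v ≡ true
  mem⁻ {v} {x} p = trans (sym (Vec.lookup∘tabulate (bag (Fin.toℕ x)) v)) (Vec.[]=⇒lookup p)
  at : ∀ {x v} (x≤ : x ≤ t) → bag x v ≡ true → bag (Fin.toℕ (Fin.fromℕ< (s≤s x≤))) v ≡ true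
  at {v = v} x≤ b = trans (cong (λ x → bag x v) (Fin.toℕ-fromℕ< (s≤s x≤))) b
  bound : ∀ (i : Fin t) → parent (Fin.toℕ i) < suc t
  bound i = s≤s (ℕ.≤-trans (parent-≤ (Fin.toℕ<n i)) (ℕ.<⇒≤ (Fin.toℕ<n i)))
  parent′ : Fin t → Fin (suc t)
  parent′ i = Fin.fromℕ< (bound i)
  parent-< : ∀ i → Fin.toℕ (parent′ i) ≤ Fin.toℕ i
  parent-< i = ℕ.≤-trans (ℕ.≤-reflexive (Fin.toℕ-fromℕ< (bound i))) (parent-≤ (Fin.toℕ<n i))
  up : ∀ v i y → InBag v (suc i) → InBag v y → Fin.toℕ y ≤ Fin.toℕ i → InBag v (parent′ i)
  up v i y a b le = mem⁺ (trans (cong (λ x → bag x v) (Fin.toℕ-fromℕ< (bound i)))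
    (running (Fin.toℕ<n i) le (mem⁻ {x = suc i} a) (mem⁻ {x = y} b)))
  -- The end with the larger number moves to its parent, whose bag contains v by the running
  -- intersection property; the sum of the two numbers decreases.
  walk : ∀ v k x y → InBag v x → InBag v y → Fin.toℕ x + Fin.toℕ y < k → PathIn parent′ (InBag v) x y
  walk v (suc k) x y a b (s≤s lt) with ℕ.<-cmp (Fin.toℕ x) (Fin.toℕ y)
  walk v (suc k) x y a b (s≤s lt) | tri≈ _ e _ with Fin.toℕ-injective e
  ... | refl = here a
  walk v (suc k) x (suc j) a b (s≤s lt) | tri< (s≤s le) _ _ = path-snoc
    (walk v k x (parent′ j) a (up v j x b a le)
      (ℕ.<-≤-trans (ℕ.+-monoʳ-< (Fin.toℕ x) (s≤s (parent-< j))) lt)) (j , inj₂ (refl , refl)) b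
  walk v (suc k) (suc i) y a b (s≤s lt) | tri> _ _ (s≤s le) = there a (i , inj₁ (refl , refl))
    (walk v k (parent′ i) y (up v i y a b le) b
      (ℕ.<-≤-trans (s≤s (ℕ.+-monoˡ-≤ (Fin.toℕ y) (parent-< i))) lt))
  size-bound : ∀ x → Subset.∣ Vec.tabulate (bag (Fin.toℕ x)) ∣ ≤ c
  size-bound x with elements (Vec.tabulate (bag (Fin.toℕ x))) | small {Fin.toℕ x} (ℕ.≤-pred (Fin.toℕ<n x))
  ... | xs , u , l , _ , g | ys , le , f = ℕ.≤-trans (ℕ.≤-reflexive (sym l))
    (ℕ.≤-trans (unique-⊆-length u λ v v∈ → f v (mem⁻ {x = x} (g v v∈))) le)

-- The graph on the live vertices of an obstruction

∨-true : ∀ {a b} → a ∨ b ≡ true → a ≡ true ⊎ b ≡ true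
∨-true {true} _ = inj₁ refl
∨-true {false} e = inj₂ e

module _ {N : ℕ} where
  -- The isolated vertex gets a branch of its own with a bag of size one, which is where `1 ≤ c`
  -- enters.
  good-add-isolated : ∀ {E : Fin N → Fin N → Set} {c st v} → 1 ≤ c → (∀ u → st u ≢ cur) → st v ≡ old →
    (∀ u → ¬ E u v) → Good E c st 0 → Good E c (update Fin._≟_ st v new) 0
  good-add-isolated {E} {c} {st} {v} 1≤c nc ev iso g = split distribute apart g only-v
    where
    st₂ = update Fin._≟_ (λ _ → old) v new
    distribute : ∀ u → Distribute (update Fin._≟_ st v new u) (st u) (st₂ u)
    distribute u with u Fin.≟ v
    ... | yes refl rewrite ev = right
    ... | no _ with st u in e
    ...   | new = left
    ...   | cur = ⊥-elim (nc u e)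
    ...   | old = outside
    apart : ∀ u w → st u ≡ new → st₂ w ≡ new → ¬ E u w
    apart u w _ q uw with w Fin.≟ v
    apart u w _ q uw | yes refl = iso u uw
    apart u w _ () uw | no _
    only-v : Good E c st₂ 0
    only-v = intro v (proj₁ (update-Update Fin._≟_ (λ _ → old) v new)) 1≤c (update-Update Fin._≟_ st₂ v cur) (leaf none)
      where
      none : ∀ u → update Fin._≟_ st₂ v cur u ≢ new
      none u e with u Fin.≟ v
      none u () | yes _
      ... | no ne = case trans (sym e) (proj₂ (update-Update Fin._≟_ (λ _ → old) v new) u ne) of λ ()

  good-add-all-isolated : ∀ {E : Fin N → Fin N → Set} {c st} → 1 ≤ c → (∀ u → st u ≢ cur) →
    (∀ {u v} → E u v → st v ≡ new) → Good E c st 0 → Good E c (λ _ → new) 0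
  good-add-all-isolated {E} {c} 1≤c nc edges = go (allFin N) nc edges λ v ne → ⊥-elim (ne (∈.∈-allFin v))
    where
    go : ∀ xs {st} → (∀ u → st u ≢ cur) → (∀ {u v} → E u v → st v ≡ new) → (∀ v → v ∉ xs → st v ≡ new) →
      Good E c st 0 → Good E c (λ _ → new) 0
    go [] nc edges out = Good-resp λ v → out v λ ()
    go (x ∷ xs) {st} nc edges out g with st x in e
    ... | cur = ⊥-elim (nc x e)
    ... | new = go xs nc edges (λ v v∉ → case v Fin.≟ x of λ
            { (yes refl) → e ; (no ne) → out v λ { (here p) → ne p ; (there p) → v∉ p } }) g
    ... | old = go xs nc₁ (λ p → keep (edges p)) out₁
            (good-add-isolated 1≤c nc e (λ u p → case trans (sym e) (edges p) of λ ()) g)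
      where
      st₁ = update Fin._≟_ st x new
      nc₁ : ∀ u → st₁ u ≢ cur
      nc₁ u q with u Fin.≟ x
      nc₁ u () | yes _
      ... | no _ = nc u q
      keep : ∀ {u} → st u ≡ new → st₁ u ≡ new
      keep {u} q with u Fin.≟ x
      ... | yes _ = refl
      ... | no _ = q
      out₁ : ∀ v → v ∉ xs → st₁ v ≡ new
      out₁ v v∉ with v Fin.≟ x
      ... | yes _ = refl
      ... | no ne = out v λ { (here p) → ne p ; (there p) → v∉ p }

  module _ {c : ℕ} {E : Rel {N}} (O : Obstruction c E) where
    open Obstruction O
    open Live live
    private
      m : ℕ
      m = size new L
      ι : Fin m → Fin N
      ι = List.lookup (members new L)
      ι-injective : ∀ {i j} → ι i ≡ ι j → i ≡ j
      ι-injective = unique-lookup-injective (members-unique new L)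
      ι-new : ∀ i → L (ι i) ≡ new
      ι-new i = ∈-members⁻ L _ (∈.∈-lookup {xs = members new L} i)
      ι-onto : ∀ u → L u ≡ new → Σ (Fin m) λ i → ι i ≡ u
      ι-onto u e = let u∈ = ∈-members⁺ L u e in Any.index u∈ , sym (Any.lookup-index u∈)

    coreMatrix : Vec (Vec Bool m) m
    coreMatrix = Vec.tabulate λ i → Vec.tabulate λ j → F (ι i) (ι j)

    private
      H : Rel {m}
      H = graphOf coreMatrix

      entry : ∀ i j → lookup (lookup coreMatrix i) j ≡ F (ι i) (ι j)
      entry i j = trans (cong (λ r → lookup r j) (Vec.lookup∘tabulate _ i)) (Vec.lookup∘tabulate _ j)

      core⁺ : ∀ i j → ⟦ F ⟧ (ι i) (ι j) → ⟦ H ⟧ i j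
      core⁺ i j e with i Fin.≟ j
      ... | yes refl = ⊥-elim (E-irr (ι i) e)
      ... | no _ rewrite entry i j | e = refl

      core⁻ : ∀ i j → ⟦ H ⟧ i j → ⟦ F ⟧ (ι i) (ι j)
      core⁻ i j e with ∨-true (proj₂ (∧-true {not ⌊ i Fin.≟ j ⌋} e))
      ... | inj₁ p = trans (sym (entry i j)) p
      ... | inj₂ p = E-sym (trans (sym (entry j i)) p)

      centerOf : ∀ u → Dec (L u ≡ new) → Maybe (Fin m)
      centerOf u (yes e) = just (proj₁ (ι-onto u e))
      centerOf u (no _) = nothing

      core-model : MinorModel ⟦ H ⟧ ⟦ F ⟧
      core-model = record
        { φ = just ∘ ι
        ; center = λ u → centerOf u (L u ≟ₛ new)
        ; connected = λ S u _ a b p q → cong S (ι-injective (trans (just-injective p) (sym (just-injective q))))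
        ; edge = λ {u} {w} e →
            let i , p = ι-onto u (edges e) ; j , q = ι-onto w (edges (E-sym e)) in
            i , j , cong just p , cong just q , core⁺ i j (subst₂ ⟦ F ⟧ (sym p) (sym q) e) }

    core-bad : 1 ≤ c → ¬ Good ⟦ H ⟧ c (λ _ → new) 0
    core-bad 1≤c g = bad (good-add-all-isolated 1≤c L-cur (λ e → edges (E-sym e))
      (good-minor Fin._≟_ Fin._≟_ (graphOf-sym coreMatrix) core-model g (λ _ _ ()) (count-empty λ _ ())
        (record { center-new = centre ; fibre-new = λ _ _ _ _ → refl ; fibre-cur = λ u e → ⊥-elim (L-cur u e) })
        (count-empty L-cur)))
      where
      centre : ∀ u → L u ≡ new → Σ (Fin m) λ i → centerOf u (L u ≟ₛ new) ≡ just i × just (ι i) ≡ just u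
      centre u e with L u ≟ₛ new
      ... | yes p = proj₁ (ι-onto u p) , refl , cong just (proj₂ (ι-onto u p))
      ... | no np = ⊥-elim (np e)

    core-embedding : Embedding (graphPattern coreMatrix) F
    core-embedding = record
      { place = ι ∘ proj₁ ; target = target
      ; same = λ _ _ → cong ι
      ; diff = λ _ _ ne e → ne (ι-injective e)
      ; edge = edge ; match = match ; no-pos = λ _ _ → refl }
      where
      target : Fin m × Fin m → Fin N
      target (i , j) with H i j
      ... | true = ι j
      -- This point lies on no negative edge; any edge at its vertex will do.
      ... | false = proj₁ (neighbor (ι i) (ι-new i))
      edge : ∀ x → ⟦ F ⟧ (ι (proj₁ x)) (target x)
      edge (i , j) with H i j in e
      ... | true = core⁻ i j e
      ... | false = proj₂ (neighbor (ι i) (ι-new i))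
      match : ∀ x y → patternNeg H x y ≡ true → target x ≡ ι (proj₁ y)
      match (i , j) y e with patternNeg⁻ H (i , j) y e
      ... | refl , h rewrite h = refl

-- Constraint graphs and patterns

module _ (I : Instance) where
  constraintGraph : Rel {n I}
  constraintGraph u v = not ⌊ u Fin.≟ v ⌋ ∧ ⌊ Fin.any? (λ a → Fin.any? λ b → rel I u v a b Bool.≟ false) ⌋

  constraint⁻ : ∀ u v → ⟦ constraintGraph ⟧ u v → ConstraintEdge I u v
  constraint⁻ u v e with ∧-true e
  ... | p , q = not⌊⌋-true (u Fin.≟ v) p , ⌊⌋-true (Fin.any? (λ a → Fin.any? λ b → rel I u v a b Bool.≟ false)) q

  constraint⁺ : ∀ u v → ConstraintEdge I u v → ⟦ constraintGraph ⟧ u v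
  constraint⁺ u v (ne , w) with u Fin.≟ v
  ... | yes e = ⊥-elim (ne e)
  ... | no _ = ⌊⌋-true⁺ (Fin.any? (λ a → Fin.any? λ b → rel I u v a b Bool.≟ false)) w

  constraint-edge-sym : Symmetric (ConstraintEdge I)
  constraint-edge-sym {u} {v} (ne , a , b , r) = ne ∘ sym , b , a , trans (rel-sym I v u b a) r

  constraint-sym : Symmetric ⟦ constraintGraph ⟧
  constraint-sym {u} {v} e = constraint⁺ v u (constraint-edge-sym (constraint⁻ u v e))

  -- The two ends of an edge must choose the same forbidden pair, whence the comparison of u and v.
  forbidden : ∀ u v → ⟦ constraintGraph ⟧ u v → Fin (dom I u)
  forbidden u v e with Fin.<-cmp u v
  ... | tri< _ _ _ = proj₁ (proj₂ (constraint⁻ u v e))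
  ... | tri≈ _ p _ = ⊥-elim (proj₁ (constraint⁻ u v e) p)
  ... | tri> _ _ _ = proj₁ (proj₂ (proj₂ (constraint⁻ v u (constraint-sym e))))

  forbidden-rel : ∀ u v e e′ → rel I u v (forbidden u v e) (forbidden v u e′) ≡ false
  forbidden-rel u v e e′ with Fin.<-cmp u v | Fin.<-cmp v u
  -- The chosen pair depends on a proof that uv is an edge. Equality proofs of Booleans are unique,
  -- so both ends read off the same pair.
  ... | tri< _ _ _ | tri> _ _ _ rewrite ≡-irrelevant (constraint-sym e′) e = proj₂ (proj₂ (proj₂ (constraint⁻ u v e)))
  ... | tri> _ _ _ | tri< _ _ _ rewrite ≡-irrelevant (constraint-sym e) e′ =
    trans (rel-sym I u v _ _) (proj₂ (proj₂ (proj₂ (constraint⁻ v u e′))))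
  ... | tri≈ _ p _ | _ = ⊥-elim (proj₁ (constraint⁻ u v e) p)
  ... | tri< _ _ _ | tri≈ _ p _ = ⊥-elim (proj₁ (constraint⁻ u v e) (sym p))
  ... | tri> _ _ _ | tri≈ _ p _ = ⊥-elim (proj₁ (constraint⁻ u v e) (sym p))
  ... | tri< _ _ p | tri< q _ _ = ⊥-elim (p q)
  ... | tri> p _ _ | tri> _ _ q = ⊥-elim (p q)

  -- Points of one part may take different values, so each takes the value forbidden along its own
  -- reserved edge. By `match`, the two ends of a negative edge reserve the same edge, seen from
  -- opposite ends.
  embedding-hom : ∀ {Q} → Embedding Q constraintGraph → Q →SP patternOf I
  embedding-hom {Q} M = f , same , (λ x y e → case trans (sym e) (no-pos x y) of λ ()) , negative , diff
    where
    open Embedding M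
    f : Point Q → Point (patternOf I)
    f x = place x , forbidden (place x) (target x) (edge x)
    chosen : ∀ {u v u′ v′} (e : ⟦ constraintGraph ⟧ u u′) (e′ : ⟦ constraintGraph ⟧ v v′) → u′ ≡ v → v′ ≡ u →
      rel I u v (forbidden u u′ e) (forbidden v v′ e′) ≡ false
    chosen {u} {v} e e′ refl refl = forbidden-rel u v e e′
    negative : ∀ x y → neg Q x y ≡ true → neg (patternOf I) (f x) (f y) ≡ true
    negative x y e with place x Fin.≟ place y
    ... | yes p = ⊥-elim (diff x y (neg-irr Q x y e) p)
    ... | no _ rewrite chosen (edge x) (edge y) (match x y e) (match y x (trans (neg-sym Q y x) e)) = refl

-- Minors exhibited by homomorphisms from subdivisions

record PartModel (Q : Pattern) {m : ℕ} (H : Fin m → Fin m → Set) : Set where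
  field
    ρ         : Part Q → Maybe (Fin m)
    center    : Fin m → Point Q
    center-ρ  : ∀ u → ρ (part Q (center u)) ≡ just u
    -- The cuts live on points, as homomorphisms do, and are constant on parts, since a whole part
    -- is mapped to one variable of the instance.
    connected : ∀ (S : Point Q → Bool) → (∀ x y → part Q x ≡ part Q y → S x ≡ S y) → ∀ u →
      (∀ x y → ρ (part Q x) ≡ just u → ρ (part Q y) ≡ just u → neg Q x y ≡ true → S x ≡ S y) →
      ∀ x y → ρ (part Q x) ≡ just u → ρ (part Q y) ≡ just u → S x ≡ S y
    edge      : ∀ {u u′} → H u u′ → Σ (Point Q) λ x → Σ (Point Q) λ y →
      ρ (part Q x) ≡ just u × ρ (part Q y) ≡ just u′ × neg Q x y ≡ true

graphPattern-model : ∀ {m} (M : Vec (Vec Bool m) m) → PartModel (graphPattern M) ⟦ graphOf M ⟧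
graphPattern-model M = record
  { ρ = just ; center = λ u → u , u ; center-ρ = λ _ → refl
  ; connected = λ S const u _ x y p q → const x y (trans (just-injective p) (sym (just-injective q)))
  ; edge = λ {u} {u′} e → (u , u′) , (u′ , u) , refl , refl , patternNeg⁺ (graphOf M) u u′ e }

-- The new part is merged into U whenever a negative edge joins U and V.
module _ {Q : Pattern} {m : ℕ} {H : Fin m → Fin m → Set} (U V : Part Q) (M : PartModel Q H)
  (d : Dec (Subdiv.NegE Q U V)) where
  open PartModel M
  open Subdiv Q U V using (UV; btw; NegE; SPoint; end)
  private
    Q′ : Pattern
    Q′ = subdivide Q U V

    merged : Dec NegE → Maybe (Fin m)
    merged (yes _) = ρ U
    merged (no _) = nothing

    ρ′ : Maybe (Part Q) → Maybe (Fin m)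
    ρ′ (just P) = ρ P
    ρ′ nothing = merged d

    ρ′-new : NegE → ρ′ nothing ≡ ρ U
    ρ′-new e = eq d
      where
      eq : ∀ d → merged d ≡ ρ U
      eq (yes _) = refl
      eq (no ne) = ⊥-elim (ne e)

    z : NegE → Bool → SPoint
    z e b = inj₂ (inj₂ (e , b))

    negE⁻ : ∀ (e : NegE) → part Q (proj₁ (proj₁ e)) ≡ U
    negE⁻ (_ , t) = ⌊⌋-true (_≟pa_ Q _ _) (proj₁ (∧-true (proj₁ (∧-true (T⇒true t)))))

    negE⁺ : ∀ {x y} → UV x y ≡ true → neg Q x y ≡ true → NegE
    negE⁺ {x} {y} p q = (x , y) , subst T (sym (∧-true⁺ p q)) tt

    UV⁻ : ∀ {x y} → UV x y ≡ true → part Q x ≡ U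
    UV⁻ p = ⌊⌋-true (_≟pa_ Q _ _) (proj₁ (∧-true p))

    at-end : ∀ e b → neg Q′ (inj₁ (end b (proj₁ (proj₁ e)) (proj₂ (proj₁ e)))) (z e b) ≡ true
    at-end e b = ⌊⌋-true⁺ (_≟pt_ Q _ _) refl

    old-edge : ∀ {x y} → neg Q x y ≡ true → UV x y ≡ false → UV y x ≡ false → neg Q′ (inj₁ x) (inj₁ y) ≡ true
    old-edge p q r rewrite p | q | r = refl

    edge′ : ∀ {u u′} → H u u′ → Σ SPoint λ x → Σ SPoint λ y →
      ρ′ (part Q′ x) ≡ just u × ρ′ (part Q′ y) ≡ just u′ × neg Q′ x y ≡ true
    edge′ h with edge h
    ... | x , y , px , py , xy with UV x y in p | UV y x in q
    ...   | false | false = inj₁ x , inj₁ y , px , py , old-edge xy p q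
    -- The new part has joined the branch set of U, so the half of the edge between z″ and V now
    -- represents it.
    ...   | true | _ = let e = negE⁺ p xy in
            z e true , inj₁ y , trans (ρ′-new e) (trans (cong ρ (sym (UV⁻ {x} {y} p))) px) , py , at-end e true
    ...   | false | true = let e = negE⁺ q (trans (neg-sym Q y x) xy) in
            inj₁ x , z e true , px , trans (ρ′-new e) (trans (cong ρ (sym (UV⁻ {y} {x} q))) py) , at-end e true

    module _ (S : SPoint → Bool) (const : ∀ x y → part Q′ x ≡ part Q′ y → S x ≡ S y) (u : Fin m)
      (flat : ∀ x y → ρ′ (part Q′ x) ≡ just u → ρ′ (part Q′ y) ≡ just u → neg Q′ x y ≡ true → S x ≡ S y) where
      across : ∀ e b → let x = end b (proj₁ (proj₁ e)) (proj₂ (proj₁ e)) in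
        ρ U ≡ just u → ρ (part Q x) ≡ just u → S (inj₁ x) ≡ S (z e b)
      across e b p q = flat _ (z e b) q (trans (ρ′-new e) p) (at-end e b)

      -- A cut is followed from x over z′ and z″ to y; the two middle points share the new part.
      through : ∀ {x y} → UV x y ≡ true → neg Q x y ≡ true → ρ (part Q x) ≡ just u → ρ (part Q y) ≡ just u →
        S (inj₁ x) ≡ S (inj₁ y)
      through {x} {y} p xy px py = let e = negE⁺ p xy ; pU = trans (cong ρ (sym (UV⁻ {x} {y} p))) px in
        trans (across e false pU px) (trans (const (z e false) (z e true) refl) (sym (across e true pU py)))

      flat-old : ∀ x y → ρ (part Q x) ≡ just u → ρ (part Q y) ≡ just u → neg Q x y ≡ true → S (inj₁ x) ≡ S (inj₁ y)
      flat-old x y px py xy with UV x y in p | UV y x in q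
      ... | false | false = flat (inj₁ x) (inj₁ y) px py (old-edge xy p q)
      ... | true | _ = through p xy px py
      ... | false | true = sym (through q (trans (neg-sym Q y x) xy) py px)

      retract : ∀ x → ρ′ (part Q′ x) ≡ just u → Σ (Point Q) λ y → ρ (part Q y) ≡ just u × S x ≡ S (inj₁ y)
      retract (inj₁ x) p = x , p , refl
      retract (inj₂ x) p = by d p
        where
        by : ∀ d → merged d ≡ just u → Σ (Point Q) λ y → ρ (part Q y) ≡ just u × S (inj₂ x) ≡ S (inj₁ y)
        by (yes e) p = let q = trans (cong ρ (negE⁻ e)) p in
          proj₁ (proj₁ e) , q , trans (const (inj₂ x) (z e false) refl) (sym (across e false p q))

      connected′ : ∀ x y → ρ′ (part Q′ x) ≡ just u → ρ′ (part Q′ y) ≡ just u → S x ≡ S y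
      connected′ x y p q with retract x p | retract y q
      ... | x₀ , p₀ , e | y₀ , q₀ , e′ = trans e (trans
        (connected (S ∘ inj₁) (λ a b r → const (inj₁ a) (inj₁ b) (cong just r)) u flat-old x₀ y₀ p₀ q₀) (sym e′))

  subdivide-model : PartModel (subdivide Q U V) H
  subdivide-model = record
    { ρ = ρ′ ; center = inj₁ ∘ center ; center-ρ = center-ρ ; connected = connected′ ; edge = edge′ }

subdivision-model : ∀ {P Q m} {H : Fin m → Fin m → Set} → IsSubdivisionOf P Q → PartModel P H → DN (PartModel Q H)
subdivision-model done M = pure M
subdivision-model (step {Q} s U V _) M = do
  M′ ← subdivision-model s M
  d ← lem (Subdiv.NegE Q U V)
  pure (subdivide-model U V M′ d)

module _ (I : Instance) {Q : Pattern} {m : ℕ} {H : Fin m → Fin m → Set} (M : PartModel Q H)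
  (hom : Q →SP patternOf I) (d : ∀ w → Dec (Σ (Point Q) λ x → proj₁ (proj₁ hom x) ≡ w)) where
  open PartModel M
  private
    place : Point Q → Fin (n I)
    place x = proj₁ (proj₁ hom x)

    injective : ∀ x y → place x ≡ place y → part Q x ≡ part Q y
    injective x y e with _≟pa_ Q (part Q x) (part Q y)
    ... | yes p = p
    ... | no np = ⊥-elim (proj₂ (proj₂ (proj₂ (proj₂ hom))) x y np e)

    located : ∀ {w} → Dec (Σ (Point Q) λ x → place x ≡ w) → Maybe (Fin m)
    located (yes (x , _)) = ρ (part Q x)
    located (no _) = nothing

    φ : Fin (n I) → Maybe (Fin m)
    φ w = located (d w)

    φ-place : ∀ x → φ (place x) ≡ ρ (part Q x)
    φ-place x with d (place x)
    ... | yes (y , e) = cong ρ (injective y x e)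
    ... | no np = ⊥-elim (np (x , refl))

    φ⁻ : ∀ w {u} → φ w ≡ just u → Σ (Point Q) λ x → place x ≡ w × ρ (part Q x) ≡ just u
    φ⁻ w e with d w
    ... | yes (x , p) = x , p , e

    hom-edge : ∀ x y → neg Q x y ≡ true → ⟦ constraintGraph I ⟧ (place x) (place y)
    hom-edge x y e with ∧-true (proj₁ (proj₂ (proj₂ (proj₂ hom))) x y e)
    ... | p , q = constraint⁺ I (place x) (place y) (not⌊⌋-true (place x Fin.≟ place y) p ,
      proj₂ (proj₁ hom x) , proj₂ (proj₁ hom y) , Bool.not-injective q)

    connected-φ : ∀ (S : Fin (n I) → Bool) u →
      (∀ a b → φ a ≡ just u → φ b ≡ just u → ⟦ constraintGraph I ⟧ a b → S a ≡ S b) →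
      ∀ a b → φ a ≡ just u → φ b ≡ just u → S a ≡ S b
    connected-φ S u flat a b p q with φ⁻ a p | φ⁻ b q
    ... | x , refl , px | y , refl , py = connected (S ∘ place)
      (λ x y e → cong S (proj₁ (proj₂ hom) x y e)) u
      (λ x y px py e → flat (place x) (place y) (trans (φ-place x) px) (trans (φ-place y) py) (hom-edge x y e)) x y px py

  hom-minor : MinorModel ⟦ constraintGraph I ⟧ H
  hom-minor = record
    { φ = φ ; center = λ u → just (place (center u)) ; connected = connected-φ
    ; edge = λ h → let x , y , px , py , e = edge h in
        place x , place y , trans (φ-place x) px , trans (φ-place y) py , hom-edge x y e }

  hom-good : ∀ {c} → Good ⟦ constraintGraph I ⟧ c (λ _ → new) 0 → Good H c (λ _ → new) 0
  hom-good g = good-minor Fin._≟_ Fin._≟_ (constraint-sym I) hom-minor g (λ _ _ ()) (count-empty λ _ ())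
    (record { center-new = λ u _ → place (center u) , refl , trans (φ-place (center u)) (center-ρ u)
            ; fibre-new = λ _ _ _ _ → refl ; fibre-cur = λ _ () })
    (count-empty λ _ ())

TM-good : ∀ {c m} (M : Vec (Vec Bool m) m) (I : Instance) → graphPattern M →TM patternOf I →
  Good ⟦ constraintGraph I ⟧ c (λ _ → new) 0 → DN (Good ⟦ graphOf M ⟧ c (λ _ → new) 0)
TM-good M I (Q , s , hom) g = do
  M′ ← subdivision-model s (graphPattern-model M)
  d ← DN-Fin λ w → lem (Σ (Point Q) λ x → proj₁ (proj₁ hom x) ≡ w)
  pure (hom-good I M′ hom d g)

bad-TM : ∀ {c} (I : Instance) → 1 ≤ c → ¬ Good ⟦ constraintGraph I ⟧ c (λ _ → new) 0 →
  DN (Σ ℕ λ m → m ≤ obstructionBound c × Σ (Vec (Vec Bool m) m) λ M →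
    ¬ Good ⟦ graphOf M ⟧ c (λ _ → new) 0 × (graphPattern M →TM patternOf I))
bad-TM {c} I 1≤c bad = do
  O ← obstruction _ live ℕ.≤-refl bad
  Q , s , M ← embedding-≼ done (core-embedding O) (Obstruction.minor O)
  pure (_ , Obstruction.small O , coreMatrix O , core-bad O 1≤c , Q , s , embedding-hom I M)
  where
  live : Live (constraintGraph I) (λ _ → new)
  live = record
    { E-sym = constraint-sym I ; E-irr = λ v e → proj₁ (constraint⁻ I v v e) refl
    ; L-cur = λ _ () ; edges = λ _ → refl }

-- The finite list of obstruction patterns

module _ (c : ℕ) where
  bad? : ∀ {m} (M : Vec (Vec Bool m) m) → Dec (¬ Good ⟦ graphOf M ⟧ c (λ _ → new) 0)
  bad? M = ¬? (decompose? (graphOf M) c)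

  allMatrices : ∀ m → List (Vec (Vec Bool m) m)
  allMatrices m = allVec (allVec allBool m) m

  obstructionsOfSize : ℕ → List Pattern
  obstructionsOfSize m = map graphPattern (filter bad? (allMatrices m))

  obstructions : List Pattern
  obstructions = List.concatMap obstructionsOfSize (List.upTo (suc (obstructionBound c)))

  ∈-obstructions⁺ : ∀ {m} (M : Vec (Vec Bool m) m) → m ≤ obstructionBound c →
    ¬ Good ⟦ graphOf M ⟧ c (λ _ → new) 0 → graphPattern M ∈ obstructions
  ∈-obstructions⁺ {m} M m≤ bad = ∈.∈-concatMap⁺ obstructionsOfSize
    (lose (∈.∈-upTo⁺ (s≤s m≤)) (∈.∈-map⁺ graphPattern
      (∈.∈-filter⁺ bad? (∈-allVec (∈-allVec ∈-allBool) M) bad)))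

  ∈-obstructions⁻ : ∀ {Q} → Q ∈ obstructions → Σ ℕ λ m → Σ (Vec (Vec Bool m) m) λ M →
    Q ≡ graphPattern M × ¬ Good ⟦ graphOf M ⟧ c (λ _ → new) 0
  ∈-obstructions⁻ Q∈ with find (∈.∈-concatMap⁻ obstructionsOfSize {xs = List.upTo (suc (obstructionBound c))} Q∈)
  ... | m , _ , Q∈m with ∈.∈-map⁻ graphPattern Q∈m
  ...   | M , M∈ , e = m , M , e , proj₂ (∈.∈-filter⁻ bad? {xs = allMatrices m} M∈)

  obstructions-finite : ∀ {Q} → Q ∈ obstructions → FinitePattern Q
  obstructions-finite Q∈ = let m , M , e , _ = ∈-obstructions⁻ Q∈ in
    subst FinitePattern (sym e) (m * m , ↔-sym (Fin.*↔× {m} {m}))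

  obstructions-sound : ∀ {Q} I → Q ∈ obstructions → Q →TM patternOf I →
    ¬ Good ⟦ constraintGraph I ⟧ c (λ _ → new) 0
  obstructions-sound I Q∈ tm g = let m , M , e , bad = ∈-obstructions⁻ Q∈ in
    TM-good M I (subst (_→TM patternOf I) e tm) g bad

  obstructions-complete : 1 ≤ c → ∀ I → InCSP-TM obstructions I → Good ⟦ constraintGraph I ⟧ c (λ _ → new) 0
  obstructions-complete 1≤c I avoid = decidable-stable (decompose? (constraintGraph I) c) λ bad →
    bad-TM I 1≤c bad λ { (m , m≤ , M , bad′ , tm) → avoid (graphPattern M) (∈-obstructions⁺ M m≤ bad′) tm }

Good-map : ∀ {V : Set} {E E′ : V → V → Set} {c st m} → (∀ u v → E′ u v → E u v) → Good E c st m → Good E′ c st m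
Good-map f (leaf h) = leaf h
Good-map f (intro v e le up g) = intro v e le up (Good-map f g)
Good-map f (forget v e h up g) = forget v e (λ w p → h w p ∘ f v w) up (Good-map f g)
Good-map f (split d h g₁ g₂) = split d (λ u v p q → h u v p q ∘ f u v) (Good-map f g₁) (Good-map f g₂)

theorem4p5 : (k : ℕ) → 1 ≤ k →
  Σ (List Pattern) λ S →
    All FinitePattern S ×
    ((I : Instance) → ConstraintTreewidthAtMost k I ⇔ InCSP-TM S I)
theorem4p5 k _ = obstructions (suc k) , All.tabulate (obstructions-finite (suc k)) , λ I → mk⇔
  (λ { (D , bounded) Q Q∈ tm → obstructions-sound (suc k) I Q∈ tm
    (Good-map (constraint⁻ I) (decomposition-good D bounded)) })
  (λ avoid → good-decomposition (constraint-edge-sym I)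
    (Good-map (constraint⁺ I) (obstructions-complete (suc k) (s≤s z≤n) I avoid)))
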